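{- Let $I=(X_i\geq\varphi_i)_{1\leq i\leq n}$ be a system of inequalities over $\Omega=(\Omega_v,\Omega_p)$ with $\Omega_v=\{X_1,\dots,X_n\}$, and let $\mathbf P\in(2^V)^{\Omega_p}$ be an assignment in which each $\mathbf P(P)$, $P\in\Omega_p$, is a finite union of hemihedra. Let $\mathbf X=(\mathbf X_1,\dots,\mathbf X_n)$ be the unique smallest solution of $I$ under $\mathbf P$. Then each $\mathbf X_i$, $1\leq i\leq n$, is a hemihedron. Moreover, there exists an algorithm which takes as input the system $I$ and descriptions of the finite unions of hemihedra $\mathbf P(P)$, $P\in\Omega_p$, and produces as output semi-linear descriptions of the hemihedra $\mathbf X_i$, $1\leq i\leq n$ (i.e. each $\mathbf X_i$ is described by a quantifier-free first-order formula whose atoms are affine equalities or inequalities).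
   Context: $V$ is a finite-dimensional real vector space, $2^V$ its set of subsets, $\mathcal C(V)$ its set of convex subsets (including $\emptyset$). A hemihedron is a convex set $H\subset V$ for which there exist finitely many polytopes $Q_1,\dots,Q_m\subset V$ with $H=\bigcup_{i=1}^m\operatorname{relint}(Q_i)$ (with $\operatorname{relint}(Q)=Q$ if $Q$ is a point; the empty union is allowed). Equivalently, a hemihedron is a bounded convex semi-linear subset of $V$. For $A,B\subset V$ and $\rho\in\mathbb R$: $\rho\cdot A=\{\rho x: x\in A\}$; $A+B=\{a+b: a\in A,b\in B\}$; $A\,\widehat\oplus\,B=A\cup B$; and the positive geometric join is $A\,\mathring\star\,B=\{\lambda a+(1-\lambda)b: 0<\lambda<1,\ a\in A,\ b\in B\}$ (associative and commutative). Syntax. $\Omega_v$ (variables) and $\Omega_p$ (parameters) are disjoint finite sets of symbols, $\Omega=(\Omega_v,\Omega_p)$. $\mathrm{CL}(\Omega)$ is the set of formal convex linear combinations $E=\sum_{\omega\in\Omega_v\cup\Omega_p}\lambda_\omega\cdot\omega$ with $\lambda_\omega\geq0$, $\sum\lambda_\omega=1$. A monomial over $\Omega$ is a formal product $E_1\mathring\star\cdots\mathring\star E_k$, $k\geq1$, of distinct elements of $\mathrm{CL}(\Omega)$, up to permutation of factors (formally $E\mathring\star E=E$). A polynomial over $\Omega$ is a formal sum $M_1\widehat\oplus\cdots\widehat\oplus M_k$, $k\geq0$, of distinct monomials, up to permutation (formally $M\widehat\oplus M=M$); $\mathbb P[\Omega]$ is the set of polynomials. A system of inequalities over $\Omega$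 is a tuple $(X_i\geq\varphi_i)_{1\leq i\leq n}$ with $\Omega_v=\{X_1,\dots,X_n\}$ and $\varphi_i\in\mathbb P[\Omega]$. Evaluation. For $\mathbf X\in\mathcal C(V)^{\Omega_v}$ and $\mathbf P\in(2^V)^{\Omega_p}$: $\operatorname{eval}(E;\mathbf X,\mathbf P)=\sum_{X\in\Omega_v,\lambda_X>0}\lambda_X\cdot\mathbf X(X)+\sum_{P\in\Omega_p,\lambda_P>0}\lambda_P\cdot\mathbf P(P)$ (Minkowski sums); for a monomial, $\operatorname{eval}$ is the positive geometric join of the evaluations of its distinct factors; for a polynomial, the union of the evaluations of its monomials (the empty polynomial evaluates to $\emptyset$). Solutions. Write $\mathbf X_i=\mathbf X(X_i)$. $\mathbf X\in\mathcal C(V)^{\Omega_v}$ is a solution of $I$ under $\mathbf P$ if $\mathbf X_i\supseteq\operatorname{eval}(\varphi_i;\mathbf X,\mathbf P)$ for all $i$. The smallest solution is the minimum solution under componentwise inclusion, i.e. the componentwise intersection of all solutions (it is always itself a solution). "Algorithm" means an algorithm performing arithmetic operations and comparisons on real numbers, with input sets described by quantifier-free formulas. -}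

module Defs where

open import Level using (0ℓ; suc)
open import Algebra.Bundles using (CommutativeRing)
open import Algebra.Module.Bundles using (Module)
import Algebra.Properties.Monoid.Sum as MonoidSum
open import Axiom.ExcludedMiddle using (ExcludedMiddle)
open import Data.Bool.Base using (Bool)
open import Data.Fin.Base using (Fin)
open import Data.List.Base using (List; []; _∷_; map; foldr; filter; allFin; _++_)
open import Data.List.NonEmpty.Base using (List⁺; _∷_; foldr₁; toList) renaming (map to map⁺)
import Data.List.Membership.Setoid as Membership
open import Data.List.Relation.Unary.All using (All)
import Data.List.Relation.Binary.Permutation.Setoid as Permutation
import Data.List.Relation.Unary.Unique.Setoid as UniqueSetoid
open import Data.Maybe.Base using (Maybe; just; nothing)
open import Data.Nat.Base using (ℕ) renaming (_<_ to _<ᴺ_)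
open import Data.Product.Base using (_×_; _,_; proj₁; proj₂; Σ-syntax; ∃-syntax)
open import Data.Sum.Base using (_⊎_; inj₁; inj₂; [_,_]′)
open import Data.Unit.Base using (⊤)
open import Data.Empty using (⊥)
open import Relation.Binary.Bundles using (Setoid)
import Relation.Binary.Construct.NonStrictToStrict as ToStrict
import Relation.Binary.Construct.On as On
open import Relation.Binary.Core using (Rel)
open import Relation.Binary.Definitions using (Decidable; _Respects_)
open import Relation.Binary.PropositionalEquality.Core using (_≡_)
open import Relation.Binary.Structures using (IsDecTotalOrder)
open import Relation.Nullary.Decidable using (does; True; toWitness; fromWitness)
open import Relation.Nullary.Negation.Core using (¬_)
open import Relation.Unary using (Pred; _∪_; ∅; _⊆_; _≐_; ⋃)

------------------------------------------------------------------------
-- Real numbers and finite-dimensional real vector spaces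

-- The real numbers, up to isomorphism: a Dedekind-complete ordered field.
-- As for DecTotalOrder, the comparisons come with decision procedures.

record Reals : Set (suc 0ℓ) where
  infix  4 _≤_ _<_ _<?_
  infix  8 _⁻¹
  field
    commutativeRing : CommutativeRing 0ℓ 0ℓ
  open CommutativeRing commutativeRing public
    renaming (Carrier to ℝ)
  field
    _≤_             : Rel ℝ 0ℓ
    isDecTotalOrder : IsDecTotalOrder _≈_ _≤_
    0≉1             : ¬ (0# ≈ 1#)
    +-monoˡ-≤       : ∀ z {x y} → x ≤ y → x + z ≤ y + z
    *-nonNeg        : ∀ {x y} → 0# ≤ x → 0# ≤ y → 0# ≤ x * y
    _⁻¹             : ℝ → ℝ
    ⁻¹-inverseʳ     : ∀ {x} → ¬ (x ≈ 0#) → x * x ⁻¹ ≈ 1#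
    -- Division by zero is totalised.
    0⁻¹             : ∀ {x} → x ≈ 0# → x ⁻¹ ≈ 0#
    supremum        : (S : Pred ℝ 0ℓ) →
                      (∃[ x ] S x) →
                      (∃[ b ] (∀ x → S x → x ≤ b)) →
                      ∃[ s ] ((∀ x → S x → x ≤ s) ×
                              (∀ b → (∀ x → S x → x ≤ b) → s ≤ b))
  open IsDecTotalOrder isDecTotalOrder public
    using (_≟_; _≤?_)

  _<_ : Rel ℝ 0ℓ
  _<_ = ToStrict._<_ _≈_ _≤_

  _<?_ : Decidable _<_
  _<?_ = ToStrict.<-decidable _≈_ _≤_ _≟_ _≤?_

  open MonoidSum +-monoid public using (sum)

record FiniteDimensional (R : Reals) : Set (suc 0ℓ) where
  open Reals R using (commutativeRing; ℝ; _≈_)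
  field
    module′ : Module commutativeRing 0ℓ 0ℓ
  open Module module′ public
    renaming (Carrierᴹ to V)
  open MonoidSum +ᴹ-monoid public
    renaming (sum to sumᴹ) using ()
  field
    dim          : ℕ
    basis        : Fin dim → V
    coord        : V → Fin dim → ℝ
    coord-expand : ∀ v → v ≈ᴹ sumᴹ (λ j → coord v j *ₗ basis j)
    coord-unique : ∀ v (c : Fin dim → ℝ) → v ≈ᴹ sumᴹ (λ j → c j *ₗ basis j) →
                   ∀ j → c j ≈ coord v j

------------------------------------------------------------------------
-- Raw syntax, over an arbitrary set A of scalars.  This is the data that an
-- algorithm receives; the conditions on the scalars are in IsSystem below.

-- n variables and p parameters
Symbol : ℕ → ℕ → Set
Symbol n p = Fin n ⊎ Fin p

LinComb : Set → ℕ → ℕ → Set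
LinComb A n p = Symbol n p → A

Monomial : Set → ℕ → ℕ → Set
Monomial A n p = List⁺ (LinComb A n p)

Polynomial : Set → ℕ → ℕ → Set
Polynomial A n p = List (Monomial A n p)

System : Set → ℕ → ℕ → Set
System A n p = Fin n → Polynomial A n p

-- Quantifier-free formulas in d real unknowns with affine atoms;
-- atom ∼ a b stands for  a₁ x₁ + … + a_d x_d ∼ b.

data Comparison : Set where
  eq le lt : Comparison

data Formula (A : Set) (d : ℕ) : Set where
  atom      : Comparison → (Fin d → A) → A → Formula A d
  tt ff     : Formula A d
  _and_     : Formula A d → Formula A d → Formula A d
  _or_      : Formula A d → Formula A d → Formula A d
  not_      : Formula A d → Formula A d

------------------------------------------------------------------------
-- Algorithms performing arithmetic operations and comparisons

record Arithmetic (A : Set) : Set where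
  field
    zero one      : A
    add mul       : A → A → A
    neg inv       : A → A
    leq           : A → A → Bool

-- An algorithm is uniform in the type of scalars and sees them only through
-- the arithmetic operations and the comparison: it has access neither to
-- suprema nor to excluded middle.  The last argument is a bound on the running
-- time, nothing meaning that the computation has not finished yet; hence
-- unbounded search is allowed and termination is part of the specification.

Algorithm : Set (suc 0ℓ)
Algorithm = ∀ {A : Set} → Arithmetic A →
            (d n p : ℕ) → System A n p → (Fin p → Formula A d) →
            ℕ → Maybe (Fin n → Formula A d)

_returns_ : {B : Set} → (ℕ → Maybe B) → B → Set
run returns b = ∃[ k ] (run k ≡ just b × (∀ j → j <ᴺ k → run j ≡ nothing))

arithmetic : (R : Reals) → Arithmetic (Reals.ℝ R)
arithmetic R = record
  { zero = 0# ; one = 1# ; add = _+_ ; mul = _*_ ; neg = -_ ; inv = _⁻¹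
  ; leq = λ x y → does (x ≤? y) }
  where open Reals R

------------------------------------------------------------------------
-- Well-formed systems

module Syntax (R : Reals) where
  open Reals R

  IsConvexCombination : ∀ {n p} → Pred (LinComb ℝ n p) 0ℓ
  IsConvexCombination c =
    (∀ ω → 0# ≤ c ω) × sum (λ i → c (inj₁ i)) + sum (λ q → c (inj₂ q)) ≈ 1#

  linCombSetoid : ℕ → ℕ → Setoid 0ℓ 0ℓ
  linCombSetoid n p = record
    { Carrier = LinComb ℝ n p
    ; _≈_ = λ c c′ → ∀ ω → c ω ≈ c′ ω
    ; isEquivalence = record
      { refl  = λ _ → refl
      ; sym   = λ e ω → sym (e ω)
      ; trans = λ e e′ ω → trans (e ω) (e′ ω)
      }
    }

  -- Monomials are taken up to permutation of their factors.
  monomialSetoid : ℕ → ℕ → Setoid 0ℓ 0ℓ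
  monomialSetoid n p =
    On.setoid (Permutation.↭-setoid (linCombSetoid n p)) toList

  IsMonomial : ∀ {n p} → Pred (Monomial ℝ n p) 0ℓ
  IsMonomial {n} {p} M =
    All IsConvexCombination (toList M) ×
    UniqueSetoid.Unique (linCombSetoid n p) (toList M)

  IsPolynomial : ∀ {n p} → Pred (Polynomial ℝ n p) 0ℓ
  IsPolynomial {n} {p} φ =
    All IsMonomial φ × UniqueSetoid.Unique (monomialSetoid n p) φ

  IsSystem : ∀ {n p} → Pred (System ℝ n p) 0ℓ
  IsSystem I = ∀ i → IsPolynomial (I i)

------------------------------------------------------------------------
-- Geometry and semantics

module Semantics (R : Reals) (𝕍 : FiniteDimensional R) where
  open Reals R
  open FiniteDimensional 𝕍
  open Syntax R public

  Subset : Set (suc 0ℓ)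
  Subset = Pred V 0ℓ

  -- Convex sets, polytopes and hemihedra

  IsConvex : Subset → Set
  IsConvex C =
    C Respects _≈ᴹ_ ×
    (∀ {x y} t → 0# ≤ t → t ≤ 1# → C x → C y → C (t *ₗ x +ᴹ (1# - t) *ₗ y))

  affineHull : Subset → Subset
  affineHull S v =
    Σ[ k ∈ ℕ ] Σ[ t ∈ (Fin k → ℝ) ] Σ[ x ∈ (Fin k → V) ]
      (∀ i → S (x i)) × sum t ≈ 1# × v ≈ᴹ sumᴹ (λ i → t i *ₗ x i)

  convexHull : Subset → Subset
  convexHull S v =
    Σ[ k ∈ ℕ ] Σ[ t ∈ (Fin k → ℝ) ] Σ[ x ∈ (Fin k → V) ]
      (∀ i → 0# ≤ t i) ×
      (∀ i → S (x i)) × sum t ≈ 1# × v ≈ᴹ sumᴹ (λ i → t i *ₗ x i)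

  IsPolytope : Subset → Set
  IsPolytope Q = Σ[ vs ∈ List V ] Q ≐ convexHull (_∈ vs)
    where open Membership ≈ᴹ-setoid using (_∈_)

  -- Open balls of the maximum norm in coordinates; they generate the
  -- topology of V, for every choice of basis.
  Ball : V → ℝ → Subset
  Ball x ε y =
    ∀ j → coord y j - coord x j < ε × coord x j - coord y j < ε

  -- Interior relative to the affine hull; a point is its own relative
  -- interior.
  relint : Subset → Subset
  relint Q x =
    Q x × ∃[ ε ] (0# < ε × (∀ y → affineHull Q y → Ball x ε y → Q y))

  IsHemihedron : Subset → Set₁
  IsHemihedron H =
    IsConvex H ×
    Σ[ m ∈ ℕ ] Σ[ Q ∈ (Fin m → Subset) ]
      (∀ i → IsPolytope (Q i)) × H ≐ ⋃ (Fin m) (λ i → relint (Q i))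

  IsFiniteUnionOfHemihedra : Subset → Set₁
  IsFiniteUnionOfHemihedra A =
    Σ[ m ∈ ℕ ] Σ[ H ∈ (Fin m → Subset) ]
      (∀ i → IsHemihedron (H i)) × A ≐ ⋃ (Fin m) H

  -- Operations on subsets

  infixr 7 _·_
  infixr 6 _⊞_ _⋆_

  _·_ : ℝ → Subset → Subset
  (ρ · A) v = ∃[ a ] (A a × v ≈ᴹ ρ *ₗ a)

  _⊞_ : Subset → Subset → Subset
  (A ⊞ B) v = ∃[ a ] ∃[ b ] (A a × B b × v ≈ᴹ a +ᴹ b)

  ⨁ : List Subset → Subset
  ⨁ = foldr _⊞_ (_≈ᴹ 0ᴹ)

  -- positive geometric join
  _⋆_ : Subset → Subset → Subset
  (A ⋆ B) v =
    ∃[ t ] ∃[ a ] ∃[ b ]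
      (0# < t × t < 1# × A a × B b × v ≈ᴹ t *ₗ a +ᴹ (1# - t) *ₗ b)

  -- Evaluation

  symbols : ∀ n p → List (Symbol n p)
  symbols n p = map inj₁ (allFin n) ++ map inj₂ (allFin p)

  module _ {n p : ℕ} (X : Fin n → Subset) (P : Fin p → Subset) where

    evalLinComb : LinComb ℝ n p → Subset
    evalLinComb c =
      ⨁ (map (λ ω → c ω · [ X , P ]′ ω)
             (filter (λ ω → 0# <? c ω) (symbols n p)))

    evalMonomial : Monomial ℝ n p → Subset
    evalMonomial M = foldr₁ _⋆_ (map⁺ evalLinComb M)

    evalPolynomial : Polynomial ℝ n p → Subset
    evalPolynomial φ = foldr _∪_ ∅ (map evalMonomial φ)

  -- Solutions

  module _ {n p : ℕ} (I : System ℝ n p) (P : Fin p → Subset) where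

    IsSolution : (Fin n → Subset) → Set
    IsSolution X =
      (∀ i → IsConvex (X i)) × (∀ i → evalPolynomial X P (I i) ⊆ X i)

    IsSmallestSolution : (Fin n → Subset) → Set₁
    IsSmallestSolution X =
      IsSolution X × (∀ Y → IsSolution Y → ∀ i → X i ⊆ Y i)

  -- Semi-linear descriptions, in the coordinates given by the basis

  compare : Comparison → Rel ℝ 0ℓ
  compare eq = _≈_
  compare le = _≤_
  compare lt = _<_

  ⟦_⟧ : Formula ℝ dim → Subset
  ⟦ atom ∼ a b ⟧ v = compare ∼ (sum (λ j → a j * coord v j)) b
  ⟦ tt ⟧         v = ⊤
  ⟦ ff ⟧         v = ⊥
  ⟦ F and G ⟧    v = ⟦ F ⟧ v × ⟦ G ⟧ v
  ⟦ F or G ⟧     v = ⟦ F ⟧ v ⊎ ⟦ G ⟧ v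
  ⟦ not F ⟧      v = ¬ ⟦ F ⟧ v

  ----------------------------------------------------------------------
  -- The smallest solution exists: it is the intersection of all solutions.
  -- Excluded middle only serves to bring the intersection down to level 0ℓ.

  module _ {n p : ℕ} {X Y : Fin n → Subset} {P : Fin p → Subset}
           (X⊆Y : ∀ i → X i ⊆ Y i) where

    private
      symbol-mono : ∀ ω → [ X , P ]′ ω ⊆ [ Y , P ]′ ω
      symbol-mono (inj₁ i) = X⊆Y i
      symbol-mono (inj₂ q) = λ z → z

      sum-mono : ∀ (c : LinComb ℝ n p) ωs →
                 ⨁ (map (λ ω → c ω · [ X , P ]′ ω) ωs) ⊆
                 ⨁ (map (λ ω → c ω · [ Y , P ]′ ω) ωs)
      sum-mono c []       z = z
      sum-mono c (ω ∷ ωs) (a , b , (x , x∈ , a≈) , b∈ , v≈) =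
        a , b , (x , symbol-mono ω x∈ , a≈) , sum-mono c ωs b∈ , v≈

      linComb-mono : ∀ c → evalLinComb X P c ⊆ evalLinComb Y P c
      linComb-mono c = sum-mono c (filter (λ ω → 0# <? c ω) (symbols n p))

      monomial-mono : ∀ c cs → evalMonomial X P (c ∷ cs) ⊆
                               evalMonomial Y P (c ∷ cs)
      monomial-mono c []        z = linComb-mono c z
      monomial-mono c (c′ ∷ cs) (t , a , b , 0<t , t<1 , a∈ , b∈ , v≈) =
        t , a , b , 0<t , t<1 , linComb-mono c a∈ , monomial-mono c′ cs b∈ , v≈

    eval-mono : ∀ φ → evalPolynomial X P φ ⊆ evalPolynomial Y P φ
    eval-mono []             z        = z
    eval-mono ((c ∷ cs) ∷ φ) (inj₁ z) = inj₁ (monomial-mono c cs z)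
    eval-mono (M ∷ φ)        (inj₂ z) = inj₂ (eval-mono φ z)

  smallestSolution : ExcludedMiddle (suc 0ℓ) → ∀ {n p} (I : System ℝ n p) P →
                     Σ[ X ∈ (Fin n → Subset) ] IsSmallestSolution I P X
  smallestSolution em {n} I P = X , (convex , solves) , below
    where
    X : Fin n → Subset
    X i v = True (em {∀ Y → IsSolution I P Y → Y i v})

    below : ∀ Y → IsSolution I P Y → ∀ i → X i ⊆ Y i
    below Y sol i v∈ = toWitness v∈ Y sol

    convex : ∀ i → IsConvex (X i)
    convex i =
      (λ v≈w v∈ → fromWitness λ Y sol →
        proj₁ (proj₁ sol i) v≈w (below Y sol i v∈)) ,
      (λ t 0≤t t≤1 x∈ y∈ → fromWitness λ Y sol →
        proj₂ (proj₁ sol i) t 0≤t t≤1 (below Y sol i x∈) (below Y sol i y∈))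

    solves : ∀ i → evalPolynomial X P (I i) ⊆ X i
    solves i v∈ = fromWitness λ Y sol →
      proj₂ sol i (eval-mono (below Y sol) (I i) v∈)

{-# OPTIONS --safe #-}

-- The variables are eliminated one after the other.  For a single variable X, a monomial whose factors λX + (1 - λ)E
-- involve X has the same least solution as X ⋆ ⋆E, the product being over the factors with λ < 1: iterating x ↦ λx + (1 - λ)e
-- approaches e, so the half-open segment [x, e) lies in X, whatever λ > 0.  Hence the least X is the union of the products
-- k ⋆ S, where k is a monomial free of X and S is any product of further such monomials and of the remainders ⋆E, and this
-- polynomial can be substituted for X.  After the last elimination only the parameters are left.  If these are points, then
-- every monomial is the relative interior of a polytope; if they are given by linear inequalities, then the points
-- of a monomial are described by linear inequalities with auxiliary unknowns, which Fourier–Motzkin elimination removes.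

module Submission where

open import Defs
import Algebra.Properties.CommutativeMonoid.Sum as CommutativeMonoidSum
import Algebra.Properties.Monoid.Mult.TCOptimised as Mult
import Algebra.Properties.Ring as RingProperties
import Algebra.Properties.Semiring.Mult.TCOptimised as SemiringMult
import Algebra.Properties.Semiring.Sum as SemiringSum
import Algebra.Solver.Ring as RingSolver
open import Algebra.Solver.Ring.AlmostCommutativeRing using (fromCommutativeRing; _-Raw-AlmostCommutative⟶_)
open import Axiom.ExcludedMiddle using (ExcludedMiddle)
open import Data.Bool.Base using (Bool; true; false; if_then_else_; T; _∨_; _∧_) renaming (not to notᵇ)
open import Data.Bool.ListAction using (all)
open import Data.Empty using (⊥; ⊥-elim)
open import Data.Fin.Base using (Fin; _↑ˡ_)
open import Data.Fin.Properties using () renaming (_≟_ to _≟ᶠ_)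
import Data.Integer.Base as ℤ
import Data.Integer.Properties as ℤ
open import Data.List.Base using (List; []; _∷_; _++_; map; concatMap; filterᵇ; cartesianProductWith; filter; tabulate; allFin; foldr; length; lookup; concat)
open import Data.List.Membership.Propositional using (_∈_; find; lose)
open import Data.List.Membership.Propositional.Properties using (∈-map⁺; ∈-map⁻; ∈-++⁺ˡ; ∈-++⁺ʳ; ∈-++⁻; ∈-filter⁺; ∈-filter⁻; ∈-cartesianProductWith⁺; ∈-cartesianProductWith⁻; ∈-concatMap⁺; ∈-concatMap⁻; ∈-allFin; ∈-lookup; ∈-concat⁺′)
import Data.List.Membership.Setoid as Membership
open import Data.List.NonEmpty.Base using (toList; _∷_)
open import Data.List.Properties using (map-tabulate; ++-identityʳ; filter-accept; filter-reject)
open import Data.List.Relation.Unary.All as All using (All; []; _∷_)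
import Data.List.Relation.Unary.All.Properties as All
open import Data.List.Relation.Unary.Any as Any using (Any; here; there; index)
import Data.List.Relation.Unary.Any.Properties as Any
open import Data.Maybe.Base using (Maybe; just; nothing)
import Data.Nat.Base as ℕ
open import Data.Nat.Base using (ℕ) renaming (_+_ to _+ᴺ_)
open import Data.Product.Base using (_×_; _,_; proj₁; proj₂; Σ-syntax; ∃-syntax)
import Data.Sign.Base as Sign
open import Data.Sum.Base using (_⊎_; inj₁; inj₂; [_,_]′)
open import Data.Unit.Base using (⊤; tt)
open import Data.Vec.Functional using () renaming (_∷_ to _∷ᶠ_)
open import Function.Base using (_∘_; id)
open import Level using (Lift; lift; lower)
open import Relation.Binary.PropositionalEquality.Core using (_≡_; cong; cong₂) renaming (refl to ≡-refl; sym to ≡-sym; subst to ≡-subst; trans to ≡-trans)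
import Relation.Binary.Reasoning.Setoid as SetoidReasoning
open import Relation.Binary.Structures using (IsDecTotalOrder)
open import Relation.Nullary.Decidable using (yes; no; Dec; T?; map′)
open import Relation.Nullary.Negation.Core using (¬_)
open import Relation.Unary using (_⊆_; _≐_)

-- Monomials are handled homogeneously: a point of a set is stored together with a positive weight,
-- so that joins turn into sums and a coefficient only rescales a weight. An inequality X ⊇ M then
-- says that a share of weight a in X plus a remainder of weight b lies in X with weight a + b, and
-- the approach along a segment becomes one statement about cones. It is the only step that uses
-- completeness. The obstacle is that parameters are arbitrary unions, while shares can be merged
-- and divided only in convex sets. Hulls cost nothing: solutions are convex, and scaling, Minkowski
-- sum and join commute with taking convex hulls. The hull of a parameter is itself a least
-- solution, so the same elimination produces it. The two conclusions start from different data: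
-- polytopes require vertices, whereas the algorithm sees only formulas. Hence the elimination is
-- purely symbolic, over a finite list of convex generators, and is proved correct for every
-- assignment of cones to them; it is then interpreted with points and with cells of a disjunctive
-- normal form.

module IntegerCoefficients (R : Reals) where
  open Reals R hiding (zero)
  open Mult +-monoid using (1+×; ×-homo-+) renaming (_×_ to _×′_)
  open SemiringMult semiring using (×1-homo-*)
  open RingProperties ring
  open SetoidReasoning setoid

  private
    ⟪_⟫ : ℤ.ℤ → ℝ
    ⟪ ℤ.+ n ⟫      = n ×′ 1#
    ⟪ ℤ.-[1+ n ] ⟫ = - (ℕ.suc n ×′ 1#)

    cancel : ∀ x y z → (z + x) - (z + y) ≈ x - y
    cancel x y z = begin
      (z + x) - (z + y)       ≈⟨ +-cong (+-comm z x) (sym (-‿+-comm z y)) ⟩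
      (x + z) + (- z + - y)   ≈⟨ +-assoc x z _ ⟩
      x + (z + (- z + - y))   ≈⟨ +-congˡ (+-assoc z (- z) _) ⟨
      x + ((z - z) + - y)     ≈⟨ +-congˡ (+-congʳ (-‿inverseʳ z)) ⟩
      x + (0# + - y)          ≈⟨ +-congˡ (+-identityˡ _) ⟩
      x - y                   ∎

    ⊖-homo : ∀ m n → ⟪ m ℤ.⊖ n ⟫ ≈ m ×′ 1# - n ×′ 1#
    ⊖-homo ℕ.zero    ℕ.zero    = sym (-‿inverseʳ 0#)
    ⊖-homo ℕ.zero    (ℕ.suc n) = sym (+-identityˡ _)
    ⊖-homo (ℕ.suc m) ℕ.zero    = sym (trans (+-congˡ -0#≈0#) (+-identityʳ _))
    ⊖-homo (ℕ.suc m) (ℕ.suc n) rewrite ℤ.[1+m]⊖[1+n]≡m⊖n m n = begin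
      ⟪ m ℤ.⊖ n ⟫                          ≈⟨ ⊖-homo m n ⟩
      m ×′ 1# - n ×′ 1#                     ≈⟨ cancel _ _ 1# ⟨
      (1# + m ×′ 1#) - (1# + n ×′ 1#)       ≈⟨ +-cong (1+× m 1#) (-‿cong (1+× n 1#)) ⟨
      ℕ.suc m ×′ 1# - ℕ.suc n ×′ 1#         ∎

    +-homo : ∀ i j → ⟪ i ℤ.+ j ⟫ ≈ ⟪ i ⟫ + ⟪ j ⟫
    +-homo (ℤ.+ m)      (ℤ.+ n)      = ×-homo-+ 1# m n
    +-homo (ℤ.+ m)      ℤ.-[1+ n ]   = ⊖-homo m (ℕ.suc n)
    +-homo ℤ.-[1+ m ]   (ℤ.+ n)      = trans (⊖-homo n (ℕ.suc m)) (+-comm _ _)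
    +-homo ℤ.-[1+ m ]   ℤ.-[1+ n ]   = begin
      - (ℕ.suc (ℕ.suc (m ℕ.+ n)) ×′ 1#)    ≈⟨ -‿cong (1+× (ℕ.suc (m ℕ.+ n)) 1#) ⟩
      - (1# + (ℕ.suc m ℕ.+ n) ×′ 1#)       ≈⟨ -‿cong (+-congˡ (×-homo-+ 1# (ℕ.suc m) n)) ⟩
      - (1# + (ℕ.suc m ×′ 1# + n ×′ 1#))   ≈⟨ -‿cong
          (trans (sym (+-assoc _ _ _)) (trans (+-congʳ (+-comm _ _)) (+-assoc _ _ _))) ⟩
      - (ℕ.suc m ×′ 1# + (1# + n ×′ 1#))   ≈⟨ -‿cong (+-congˡ (1+× n 1#)) ⟨
      - (ℕ.suc m ×′ 1# + ℕ.suc n ×′ 1#)    ≈⟨ -‿+-comm _ _ ⟨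
      - (ℕ.suc m ×′ 1#) - ℕ.suc n ×′ 1#    ∎

    pos-homo : ∀ n → ⟪ Sign.+ ℤ.◃ n ⟫ ≈ n ×′ 1#
    pos-homo ℕ.zero    = refl
    pos-homo (ℕ.suc n) = refl

    neg-homo : ∀ n → ⟪ Sign.- ℤ.◃ n ⟫ ≈ - (n ×′ 1#)
    neg-homo ℕ.zero    = sym -0#≈0#
    neg-homo (ℕ.suc n) = refl

    *-homo : ∀ i j → ⟪ i ℤ.* j ⟫ ≈ ⟪ i ⟫ * ⟪ j ⟫
    *-homo (ℤ.+ m)    (ℤ.+ n)    = trans (pos-homo (m ℕ.* n)) (×1-homo-* m n)
    *-homo (ℤ.+ m)    ℤ.-[1+ n ] = trans (neg-homo (m ℕ.* ℕ.suc n))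
      (trans (-‿cong (×1-homo-* m (ℕ.suc n))) (-‿distribʳ-* _ _))
    *-homo ℤ.-[1+ m ] (ℤ.+ n)    = trans (neg-homo (ℕ.suc m ℕ.* n))
      (trans (-‿cong (×1-homo-* (ℕ.suc m) n)) (-‿distribˡ-* _ _))
    *-homo ℤ.-[1+ m ] ℤ.-[1+ n ] = begin
      ⟪ Sign.+ ℤ.◃ (ℕ.suc m ℕ.* ℕ.suc n) ⟫          ≈⟨ pos-homo (ℕ.suc m ℕ.* ℕ.suc n) ⟩
      (ℕ.suc m ℕ.* ℕ.suc n) ×′ 1#                    ≈⟨ ×1-homo-* (ℕ.suc m) (ℕ.suc n) ⟩
      ℕ.suc m ×′ 1# * (ℕ.suc n ×′ 1#)                ≈⟨ -‿involutive _ ⟨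
      - - (ℕ.suc m ×′ 1# * (ℕ.suc n ×′ 1#))          ≈⟨ -‿cong (-‿distribʳ-* _ _) ⟩
      - (ℕ.suc m ×′ 1# * - (ℕ.suc n ×′ 1#))          ≈⟨ -‿distribˡ-* _ _ ⟩
      - (ℕ.suc m ×′ 1#) * - (ℕ.suc n ×′ 1#)          ∎

    -‿homo : ∀ i → ⟪ ℤ.- i ⟫ ≈ - ⟪ i ⟫
    -‿homo (ℤ.+ ℕ.zero)    = sym -0#≈0#
    -‿homo (ℤ.+ ℕ.suc n)   = refl
    -‿homo ℤ.-[1+ n ]      = sym (-‿involutive _)

    homomorphism : ℤ.+-*-rawRing -Raw-AlmostCommutative⟶ fromCommutativeRing commutativeRing
    homomorphism = record
      { ⟦_⟧ = ⟪_⟫ ; +-homo = +-homo ; *-homo = *-homo ; -‿homo = -‿homo ; 0-homo = refl ; 1-homo = refl }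

    -- The solver cancels terms by evaluating this test. Equality of integers computes, whereas
    -- equality of elements of an abstract field does not reduce, so literals are taken from ℤ.
    coefficient-≟ : ∀ i j → Maybe (⟪ i ⟫ ≈ ⟪ j ⟫)
    coefficient-≟ i j with i ℤ.≟ j
    ... | yes ≡-refl = just refl
    ... | no _       = nothing

  module Solver = RingSolver ℤ.+-*-rawRing (fromCommutativeRing commutativeRing) homomorphism coefficient-≟
  open Solver public using (solve; _:=_; _:+_; _:*_; :-_; _:-_)

  :0 :1 : ∀ {n} → Solver.Polynomial n
  :0 = Solver.con (ℤ.+ 0)
  :1 = Solver.con (ℤ.+ 1)

-- Ordered field arithmetic.

module OrderedField (R : Reals) where
  open Reals R hiding (zero)
  open IsDecTotalOrder isDecTotalOrder public
    using () renaming (refl to ≤-refl; reflexive to ≤-reflexive; trans to ≤-trans; antisym to ≤-antisym; total to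
        ≤-total; ≤-respˡ-≈ to ≤-respˡ; ≤-respʳ-≈ to ≤-respʳ)
  open IntegerCoefficients R public

  <⇒≤ : ∀ {x y} → x < y → x ≤ y
  <⇒≤ = proj₁

  ≤∧≉⇒< : ∀ {x y} → x ≤ y → ¬ (x ≈ y) → x < y
  ≤∧≉⇒< = _,_

  <⇒≱ : ∀ {x y} → x < y → ¬ (y ≤ x)
  <⇒≱ (x≤y , x≉y) y≤x = x≉y (≤-antisym x≤y y≤x)

  ≰⇒> : ∀ {x y} → ¬ (x ≤ y) → y < x
  ≰⇒> {x} {y} x≰y with ≤-total x y
  ... | inj₁ x≤y = ⊥-elim (x≰y x≤y)
  ... | inj₂ y≤x = y≤x , λ y≈x → x≰y (≤-reflexive (sym y≈x))

  <-≤-trans : ∀ {x y z} → x < y → y ≤ z → x < z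
  <-≤-trans x<y y≤z = ≤-trans (<⇒≤ x<y) y≤z , λ x≈z → <⇒≱ x<y (≤-respʳ (sym x≈z) y≤z)

  ≤-<-trans : ∀ {x y z} → x ≤ y → y < z → x < z
  ≤-<-trans x≤y y<z = ≤-trans x≤y (<⇒≤ y<z) , λ x≈z → <⇒≱ y<z (≤-respˡ x≈z x≤y)

  <-respʳ : ∀ {x y z} → y ≈ z → x < y → x < z
  <-respʳ y≈z x<y = <-≤-trans x<y (≤-reflexive y≈z)

  <-respˡ : ∀ {x y z} → y ≈ z → y < x → z < x
  <-respˡ y≈z y<x = ≤-<-trans (≤-reflexive (sym y≈z)) y<x

  <-irrefl : ∀ {x y} → x ≈ y → ¬ (x < y)
  <-irrefl x≈y x<y = proj₂ x<y x≈y

  +-mono-≤ : ∀ {x y u v} → x ≤ y → u ≤ v → x + u ≤ y + v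
  +-mono-≤ {x} {y} {u} {v} x≤y u≤v = ≤-trans (+-monoˡ-≤ u x≤y)
    (≤-respˡ (+-comm u y) (≤-respʳ (+-comm v y) (+-monoˡ-≤ y u≤v)))

  0≤-+ : ∀ {x y} → 0# ≤ x → 0# ≤ y → 0# ≤ x + y
  0≤-+ 0≤x 0≤y = ≤-respˡ (+-identityˡ 0#) (+-mono-≤ 0≤x 0≤y)

  x≤y⇒0≤y-x : ∀ {x y} → x ≤ y → 0# ≤ y - x
  x≤y⇒0≤y-x {x} x≤y = ≤-respˡ (-‿inverseʳ x) (+-monoˡ-≤ (- x) x≤y)

  0≤y-x⇒x≤y : ∀ {x y} → 0# ≤ y - x → x ≤ y
  0≤y-x⇒x≤y {x} {y} p = ≤-respˡ (+-identityˡ x)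
    (≤-respʳ (solve 2 (λ x y → y :- x :+ x := y) refl x y) (+-monoˡ-≤ x p))

  x<y⇒0<y-x : ∀ {x y} → x < y → 0# < y - x
  x<y⇒0<y-x {x} {y} (x≤y , x≉y) = x≤y⇒0≤y-x x≤y , λ 0≈y-x → x≉y
    (trans (sym (+-identityˡ x)) (trans (+-congʳ 0≈y-x) (solve 2 (λ x y → y :- x :+ x := y) refl x y)))

  0<y-x⇒x<y : ∀ {x y} → 0# < y - x → x < y
  0<y-x⇒x<y {x} {y} (p , q) = 0≤y-x⇒x≤y p , λ x≈y → q (sym (trans (+-congʳ (sym x≈y)) (-‿inverseʳ x)))

  0<-+ˡ : ∀ {x y} → 0# < x → 0# ≤ y → 0# < x + y
  0<-+ˡ {x} {y} 0<x 0≤y = <-≤-trans 0<x (≤-respˡ (+-identityʳ x) (+-mono-≤ ≤-refl 0≤y))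

  0<-+ʳ : ∀ {x y} → 0# ≤ x → 0# < y → 0# < x + y
  0<-+ʳ {x} {y} 0≤x 0<y = <-respʳ (+-comm y x) (0<-+ˡ 0<y 0≤x)

  *-monoˡ-≤ : ∀ {x y} z → 0# ≤ z → x ≤ y → z * x ≤ z * y
  *-monoˡ-≤ {x} {y} z 0≤z x≤y = 0≤y-x⇒x≤y
    (≤-respʳ (solve 3 (λ x y z → z :* (y :- x) := z :* y :- z :* x) refl x y z) (*-nonNeg 0≤z (x≤y⇒0≤y-x x≤y)))

  0≤-x : ∀ {x} → x ≤ 0# → 0# ≤ - x
  0≤-x {x} x≤0 = ≤-respʳ (+-identityˡ (- x)) (x≤y⇒0≤y-x x≤0)

  0<-x : ∀ {x} → x < 0# → 0# < - x
  0<-x {x} x<0 = <-respʳ (+-identityˡ (- x)) (x<y⇒0<y-x x<0)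

  0<⇒≉0 : ∀ {x} → 0# < x → ¬ (x ≈ 0#)
  0<⇒≉0 0<x x≈0 = proj₂ 0<x (sym x≈0)

  0≤1 : 0# ≤ 1#
  0≤1 with ≤-total 0# 1#
  ... | inj₁ p = p
  ... | inj₂ p = ≤-respʳ (solve 0 (:- :1 :* :- :1 := :1) refl) (*-nonNeg (0≤-x p) (0≤-x p))

  0<1 : 0# < 1#
  0<1 = 0≤1 , 0≉1

  ⁻¹-inverseˡ : ∀ {x} → ¬ (x ≈ 0#) → x ⁻¹ * x ≈ 1#
  ⁻¹-inverseˡ x≉0 = trans (*-comm _ _) (⁻¹-inverseʳ x≉0)

  *-cancel-0 : ∀ {x y} → ¬ (x ≈ 0#) → x * y ≈ 0# → y ≈ 0#
  *-cancel-0 {x} {y} x≉0 xy≈0 = trans (sym (*-identityˡ y)) (trans (*-congʳ (sym (⁻¹-inverseˡ x≉0)))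
    (trans (*-assoc _ _ _) (trans (*-congˡ xy≈0) (zeroʳ _))))

  0<-* : ∀ {x y} → 0# < x → 0# < y → 0# < x * y
  0<-* 0<x 0<y = *-nonNeg (<⇒≤ 0<x) (<⇒≤ 0<y) , λ 0≈xy → 0<⇒≉0 0<y (*-cancel-0 (0<⇒≉0 0<x) (sym 0≈xy))

  0<-⁻¹ : ∀ {x} → 0# < x → 0# < x ⁻¹
  0<-⁻¹ {x} 0<x with ≤-total 0# (x ⁻¹)
  ... | inj₁ p = p , λ 0≈x⁻¹ → 0≉1 (trans (sym (zeroʳ x)) (trans (*-congˡ 0≈x⁻¹) (⁻¹-inverseʳ (0<⇒≉0 0<x))))
  ... | inj₂ p = ⊥-elim (<⇒≱ 0<1 (0≤y-x⇒x≤y (≤-respʳ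
      (trans (solve 2 (λ x y → x :* (:- y) := :- (x :* y)) refl x (x ⁻¹))
        (trans (-‿cong (⁻¹-inverseʳ (0<⇒≉0 0<x))) (sym (+-identityˡ _))))
      (*-nonNeg (<⇒≤ 0<x) (0≤-x p)))))

  0≤⇒0≈⊎0< : ∀ {x} → 0# ≤ x → x ≈ 0# ⊎ 0# < x
  0≤⇒0≈⊎0< {x} 0≤x with x ≟ 0#
  ... | yes x≈0 = inj₁ x≈0
  ... | no  x≉0 = inj₂ (0≤x , λ e → x≉0 (sym e))

  ⁻¹-cancelˡ : ∀ {s} → 0# < s → ∀ x → s ⁻¹ * (s * x) ≈ x
  ⁻¹-cancelˡ 0<s x = trans (sym (*-assoc _ _ _)) (trans (*-congʳ (⁻¹-inverseˡ (0<⇒≉0 0<s))) (*-identityˡ x))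

  ⁻¹-cancelʳ : ∀ {s} → 0# < s → ∀ x → s * (s ⁻¹ * x) ≈ x
  ⁻¹-cancelʳ 0<s x = trans (sym (*-assoc _ _ _)) (trans (*-congʳ (⁻¹-inverseʳ (0<⇒≉0 0<s))) (*-identityˡ x))

-- Coordinate vectors.

module Vectors (R : Reals) where
  open import Data.Fin.Base using (zero; suc)
  open import Data.Nat.Base using (zero; suc)
  open OrderedField R
  open Reals R hiding (zero)

  infix  4 _≋_
  infixl 6 _⊕_
  infixr 7 _⊙_

  Vect : ℕ → Set
  Vect d = Fin d → ℝ

  _≋_ : ∀ {d} → Vect d → Vect d → Set
  u ≋ v = ∀ j → u j ≈ v j

  _⊕_ : ∀ {d} → Vect d → Vect d → Vect d
  (u ⊕ v) j = u j + v j

  _⊙_ : ∀ {d} → ℝ → Vect d → Vect d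
  (s ⊙ u) j = s * u j

  0v : ∀ {d} → Vect d
  0v _ = 0#

  +-interchange : ∀ a b c e → (a + b) + (c + e) ≈ (a + c) + (b + e)
  +-interchange = solve 4 (λ a b c e → (a :+ b) :+ (c :+ e) := (a :+ c) :+ (b :+ e)) refl

  module _ {d : ℕ} where

    ≋-refl : ∀ {u : Vect d} → u ≋ u
    ≋-refl _ = refl

    ≋-sym : ∀ {u v : Vect d} → u ≋ v → v ≋ u
    ≋-sym p j = sym (p j)

    ≋-trans : ∀ {u v w : Vect d} → u ≋ v → v ≋ w → u ≋ w
    ≋-trans p q j = trans (p j) (q j)

    ⊕-cong : ∀ {u u′ v v′ : Vect d} → u ≋ u′ → v ≋ v′ → u ⊕ v ≋ u′ ⊕ v′
    ⊕-cong p q j = +-cong (p j) (q j)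

    ⊙-cong : ∀ {s s′} {u u′ : Vect d} → s ≈ s′ → u ≋ u′ → s ⊙ u ≋ s′ ⊙ u′
    ⊙-cong p q j = *-cong p (q j)

    ⊕-identityˡ : ∀ {u v : Vect d} → v ≋ 0v → v ⊕ u ≋ u
    ⊕-identityˡ p j = trans (+-congʳ (p j)) (+-identityˡ _)

    ⊕-identityʳ : ∀ {u v : Vect d} → v ≋ 0v → u ⊕ v ≋ u
    ⊕-identityʳ p j = trans (+-congˡ (p j)) (+-identityʳ _)

    0⊕ : ∀ {u v : Vect d} → v ≋ 0v → u ≋ v ⊕ u
    0⊕ p = ≋-sym (⊕-identityˡ p)

    ⊕0 : ∀ {u v : Vect d} → v ≋ 0v → u ≋ u ⊕ v
    ⊕0 p = ≋-sym (⊕-identityʳ p)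

    ⊕-interchange : ∀ (a b c e : Vect d) → (a ⊕ b) ⊕ (c ⊕ e) ≋ (a ⊕ c) ⊕ (b ⊕ e)
    ⊕-interchange a b c e j = +-interchange (a j) (b j) (c j) (e j)

    ∷-≋ : {u v : Vect (suc d)} → u zero ≈ v zero → u ∘ suc ≋ v ∘ suc → u ≋ v
    ∷-≋ p q zero    = p
    ∷-≋ p q (suc j) = q j

    ⊙-zeroʳ : ∀ s {u : Vect d} → u ≋ 0v → s ⊙ u ≋ 0v
    ⊙-zeroʳ s p j = trans (*-congˡ (p j)) (zeroʳ s)

  *-⁻¹-cancel : ∀ {s} a → 0# < s → (a * s ⁻¹) * s ≈ a
  *-⁻¹-cancel a 0<s = trans (*-assoc _ _ _) (trans (*-congˡ (⁻¹-inverseˡ (0<⇒≉0 0<s))) (*-identityʳ a))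

-- Cones over convex sets, and monomials evaluated in them.

-- A convex set X is replaced by the cone {(t , u) : t > 0, u ∈ t X} ∪ {(0 , 0)}, so that joins become sums.
module Cones (R : Reals) (d : ℕ) where
  open import Data.Fin.Base using (zero; suc)
  open import Data.Nat.Base using (zero; suc)
  open OrderedField R
  open Reals R hiding (zero)
  open Vectors R

  Coned : Set₁
  Coned = ℝ → Vect d → Set

  -- `positive` excludes directions of recession, and `zero-∈` asks for the apex even over the empty
  -- set. So the slice at weight 0 is always the zero vector alone, in agreement with `evalLinComb`,
  -- which omits the symbols of coefficient 0 whatever their sets are.
  record IsCone (K : Coned) : Set where
    field
      resp     : ∀ {t t′ u u′} → t ≈ t′ → u ≋ u′ → K t u → K t′ u′
      zero-∈   : K 0# 0v
      add      : ∀ {t t′ u u′} → K t u → K t′ u′ → K (t + t′) (u ⊕ u′)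
      scale    : ∀ {s t u} → 0# < s → K t u → K (s * t) (s ⊙ u)
      positive : ∀ {t u} → K t u → 0# < t ⊎ (t ≈ 0# × u ≋ 0v)

    zero-∈′ : ∀ {t u} → t ≈ 0# → u ≋ 0v → K t u
    zero-∈′ t≈0 u≈0 = resp (sym t≈0) (≋-sym u≈0) zero-∈

    vanish : ∀ {t u} → t ≈ 0# → K t u → u ≋ 0v
    vanish t≈0 k with positive k
    ... | inj₁ 0<t      = ⊥-elim (0<⇒≉0 0<t t≈0)
    ... | inj₂ (_ , u≈0) = u≈0

    -- The converse of `add`: both summands are multiples of `u`, by a / (a + b) and b / (a + b). A
    -- weight 0 receives the apex, which also covers a + b = 0.
    split : ∀ {a b u} → 0# ≤ a → 0# ≤ b → K (a + b) u →
            ∃[ v ] ∃[ w ] (K a v × K b w × u ≋ v ⊕ w)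
    split {a} {b} {u} 0≤a 0≤b k with 0≤⇒0≈⊎0< 0≤a | 0≤⇒0≈⊎0< 0≤b
    ... | inj₁ a≈0 | _ = 0v , u , zero-∈′ a≈0 ≋-refl , resp (trans (+-congʳ a≈0) (+-identityˡ b)) ≋-refl k
                       , 0⊕ ≋-refl
    ... | inj₂ _ | inj₁ b≈0 = u , 0v , resp (trans (+-congˡ b≈0) (+-identityʳ a)) ≋-refl k , zero-∈′ b≈0 ≋-refl
                       , ⊕0 ≋-refl
    ... | inj₂ 0<a | inj₂ 0<b = (a * i) ⊙ u , (b * i) ⊙ u
                       , resp (*-⁻¹-cancel a 0<s) ≋-refl (scale (0<-* 0<a 0<i) k)
                       , resp (*-⁻¹-cancel b 0<s) ≋-refl (scale (0<-* 0<b 0<i) k)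
                       , λ j → trans (sym (*-identityˡ (u j))) (trans (*-congʳ (sym (⁻¹-inverseʳ (0<⇒≉0 0<s))))
                           (solve 4 (λ a b i u → (a :+ b) :* i :* u := a :* i :* u :+ b :* i :* u) refl a b i (u j)))
      where
      0<s = 0<-+ˡ 0<a 0≤b
      i   = (a + b) ⁻¹
      0<i = 0<-⁻¹ 0<s

  open IsCone

  pointed : Coned → Coned
  pointed K t u = (t ≈ 0# × u ≋ 0v) ⊎ K t u

  pointed-isCone : ∀ {K : Coned} →
    (∀ {t t′ u u′} → t ≈ t′ → u ≋ u′ → K t u → K t′ u′) →
    (∀ {t t′ u u′} → K t u → K t′ u′ → K (t + t′) (u ⊕ u′)) →
    (∀ {s t u} → 0# < s → K t u → K (s * t) (s ⊙ u)) →
    (∀ {t u} → K t u → 0# < t ⊎ (t ≈ 0# × u ≋ 0v)) → IsCone (pointed K)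
  pointed-isCone r a s p .resp e f (inj₁ (g , h)) = inj₁ (trans (sym e) g , ≋-trans (≋-sym f) h)
  pointed-isCone r a s p .resp e f (inj₂ k)       = inj₂ (r e f k)
  pointed-isCone r a s p .zero-∈ = inj₁ (refl , ≋-refl)
  pointed-isCone r a s p .add (inj₁ (e , f)) (inj₁ (g , h)) = inj₁
      (trans (+-cong e g) (+-identityˡ 0#) , ≋-trans (⊕-identityˡ f) h)
  pointed-isCone r a s p .add (inj₁ (e , f)) (inj₂ k) = inj₂ (r (sym (trans (+-congʳ e) (+-identityˡ _))) (0⊕ f) k)
  pointed-isCone r a s p .add (inj₂ k) (inj₁ (e , f)) = inj₂ (r (sym (trans (+-congˡ e) (+-identityʳ _))) (⊕0 f) k)
  pointed-isCone r a s p .add (inj₂ k) (inj₂ l) = inj₂ (a k l)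
  pointed-isCone r a s p .scale 0<c (inj₁ (e , f)) = inj₁ (trans (*-congˡ e) (zeroʳ _) , ⊙-zeroʳ _ f)
  pointed-isCone r a s p .scale 0<c (inj₂ k)       = inj₂ (s 0<c k)
  pointed-isCone r a s p .positive (inj₁ z) = inj₂ z
  pointed-isCone r a s p .positive (inj₂ k) = p k

  Cones : ∀ {N} → (Fin N → Coned) → Set
  Cones Z = ∀ i → IsCone (Z i)

  -- The combination of the sets behind `Z` with coefficients `g`: an element of weight `g i` is
  -- already `g i` times a point of the i-th set, so no scalar multiplication occurs.
  act : ∀ {N} → Vect N → (Fin N → Coned) → Vect d → Set
  act {zero}  g Z u = u ≋ 0v
  act {suc N} g Z u = ∃[ y ] ∃[ v ] (Z zero (g zero) y × act (g ∘ suc) (Z ∘ suc) v × u ≋ y ⊕ v)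

  act-resp : ∀ {N} {g g′ : Vect N} {Z u u′} → Cones Z → g ≋ g′ → u ≋ u′ → act g Z u → act g′ Z u′
  act-resp {zero}  cz p q u≈0 = ≋-trans (≋-sym q) u≈0
  act-resp {suc N} cz p q (y , v , z , a , e) =
    y , v , resp (cz zero) (p zero) ≋-refl z , act-resp (cz ∘ suc) (p ∘ suc) ≋-refl a , ≋-trans (≋-sym q) e

  act-≋ : ∀ {N} {g : Vect N} Z {u u′} → u ≋ u′ → act g Z u → act g Z u′
  act-≋ {zero}  Z p u≈0                   = ≋-trans (≋-sym p) u≈0
  act-≋ {suc N} Z p (y , v , z , a , e) = y , v , z , a , ≋-trans (≋-sym p) e

  act-mono : ∀ {N} {g : Vect N} {Z Z′ : Fin N → Coned} {u} → (∀ i {t v} → Z i t v → Z′ i t v) → act g Z u → act g Z′ u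
  act-mono {zero}  f a = a
  act-mono {suc N} f (y , v , z , a , e) = y , v , f zero z , act-mono (λ i → f (suc i)) a , e

  act-zero : ∀ {N} {g : Vect N} {Z} → Cones Z → g ≋ 0v → act g Z 0v
  act-zero {zero}  cz p = ≋-refl
  act-zero {suc N} cz p = 0v , 0v , zero-∈′ (cz zero) (p zero) ≋-refl , act-zero (cz ∘ suc) (p ∘ suc)
                        , 0⊕ ≋-refl

  act-vanish : ∀ {N} {g : Vect N} {Z u} → Cones Z → g ≋ 0v → act g Z u → u ≋ 0v
  act-vanish {zero}  cz p a = a
  act-vanish {suc N} cz p (y , v , z , a , e) =
    ≋-trans e (≋-trans (⊕-identityˡ (vanish (cz zero) (p zero) z)) (act-vanish (cz ∘ suc) (p ∘ suc) a))

  act-add : ∀ {N} {g g′ : Vect N} {Z u u′} → Cones Z → act g Z u → act g′ Z u′ → act (g ⊕ g′) Z (u ⊕ u′)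
  act-add {zero}  cz a a′ = ≋-trans (⊕-identityˡ a) a′
  act-add {suc N} cz (y , v , z , a , e) (y′ , v′ , z′ , a′ , e′) =
    y ⊕ y′ , v ⊕ v′ , add (cz zero) z z′ , act-add (cz ∘ suc) a a′
    , ≋-trans (⊕-cong e e′) (⊕-interchange y v y′ v′)

  act-scale : ∀ {N} {g : Vect N} {Z u s} → Cones Z → 0# < s → act g Z u → act (s ⊙ g) Z (s ⊙ u)
  act-scale {zero}  {s = s} cz 0<s a = ⊙-zeroʳ s a
  act-scale {suc N} {s = s} cz 0<s (y , v , z , a , e) =
    s ⊙ y , s ⊙ v , scale (cz zero) 0<s z , act-scale (cz ∘ suc) 0<s a
    , λ j → trans (*-congˡ (e j)) (distribˡ s (y j) (v j))

  act-split : ∀ {N} {g g′ : Vect N} {Z u} → Cones Z → (∀ i → 0# ≤ g i) → (∀ i → 0# ≤ g′ i) → act (g ⊕ g′) Z u →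
              ∃[ v ] ∃[ w ] (act g Z v × act g′ Z w × u ≋ v ⊕ w)
  act-split {zero}  cz p q a = 0v , 0v , ≋-refl , ≋-refl , ≋-trans a (0⊕ ≋-refl)
  act-split {suc N} cz p q (y , v , z , a , e) with split (cz zero) (p zero) (q zero) z | act-split (cz ∘ suc)
      (p ∘ suc) (q ∘ suc) a
  ... | y₁ , y₂ , z₁ , z₂ , e₁ | v₁ , v₂ , a₁ , a₂ , e₂ =
    y₁ ⊕ v₁ , y₂ ⊕ v₂ , (y₁ , v₁ , z₁ , a₁ , ≋-refl) , (y₂ , v₂ , z₂ , a₂ , ≋-refl)
    , ≋-trans e (≋-trans (⊕-cong e₁ e₂) (⊕-interchange y₁ y₂ v₁ v₂))

  -- Eval Z M t v : v lies in t times the positive join of the symbolic points of M, evaluated at Z.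
  data Eval {N} (Z : Fin N → Coned) : List (Vect N) → ℝ → Vect d → Set where
    nil  : ∀ {t v} → t ≈ 0# → v ≋ 0v → Eval Z [] t v
    cons : ∀ {c M t v s u t′ v′} → 0# < s → act (s ⊙ c) Z u → Eval Z M t′ v′ →
           t ≈ s + t′ → v ≋ u ⊕ v′ → Eval Z (c ∷ M) t v

  module _ {N} {Z : Fin N → Coned} where

    eval-resp : ∀ {M t t′ v v′} → t ≈ t′ → v ≋ v′ → Eval Z M t v → Eval Z M t′ v′
    eval-resp p q (nil e f)           = nil (trans (sym p) e) (≋-trans (≋-sym q) f)
    eval-resp p q (cons 0<s a ev e f) = cons 0<s a ev (trans (sym p) e) (≋-trans (≋-sym q) f)

    eval-positive : ∀ {M t v} → Eval Z M t v → 0# < t ⊎ (t ≈ 0# × v ≋ 0v)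
    eval-positive (nil e f) = inj₂ (e , f)
    eval-positive (cons 0<s a ev e f) with eval-positive ev
    ... | inj₁ 0<t′      = inj₁ (<-respʳ (sym e) (0<-+ˡ 0<s (<⇒≤ 0<t′)))
    ... | inj₂ (t′≈0 , _) = inj₁ (<-respʳ (sym e) (0<-+ˡ 0<s (≤-reflexive (sym t′≈0))))

    eval-nonNegative : ∀ {M t v} → Eval Z M t v → 0# ≤ t
    eval-nonNegative ev with eval-positive ev
    ... | inj₁ 0<t       = <⇒≤ 0<t
    ... | inj₂ (t≈0 , _) = ≤-reflexive (sym t≈0)

    eval-cons-positive : ∀ {c M t v} → Eval Z (c ∷ M) t v → 0# < t
    eval-cons-positive (cons 0<s a ev e f) = <-respʳ (sym e) (0<-+ˡ 0<s (eval-nonNegative ev))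

    eval-++ : ∀ {M M′ t t′ v v′} → Eval Z M t v → Eval Z M′ t′ v′ → Eval Z (M ++ M′) (t + t′) (v ⊕ v′)
    eval-++ (nil e f) ev′ = eval-resp (sym (trans (+-congʳ e) (+-identityˡ _))) (0⊕ f) ev′
    eval-++ (cons 0<s a ev e f) ev′ = cons 0<s a (eval-++ ev ev′)
      (trans (+-congʳ e) (+-assoc _ _ _)) (λ j → trans (+-congʳ (f j)) (+-assoc _ _ _))

    eval-++⁻ : ∀ M {M′ t v} → Eval Z (M ++ M′) t v →
               ∃[ t₁ ] ∃[ t₂ ] ∃[ v₁ ] ∃[ v₂ ] (Eval Z M t₁ v₁ × Eval Z M′ t₂ v₂ × t ≈ t₁ + t₂ × v ≋ v₁ ⊕ v₂)
    eval-++⁻ [] ev = 0# , _ , 0v , _ , nil refl ≋-refl , ev , sym (+-identityˡ _) , 0⊕ ≋-refl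
    eval-++⁻ (c ∷ M) (cons 0<s a ev e f) with eval-++⁻ M ev
    ... | t₁ , t₂ , v₁ , v₂ , ev₁ , ev₂ , e′ , f′ =
      _ , t₂ , _ , v₂ , cons 0<s a ev₁ refl ≋-refl , ev₂
      , trans e (trans (+-congˡ e′) (sym (+-assoc _ _ _))) , λ j → trans (f j)
        (trans (+-congˡ (f′ j)) (sym (+-assoc _ _ _)))

    module _ (cz : Cones Z) where

      eval-add : ∀ {M t t′ v v′} → Eval Z M t v → Eval Z M t′ v′ → Eval Z M (t + t′) (v ⊕ v′)
      eval-add (nil e f) (nil e′ f′) = nil (trans (+-cong e e′) (+-identityˡ 0#)) (≋-trans (⊕-identityˡ f) f′)
      eval-add {c ∷ _} (cons {s = s} {u} {t} {v} 0<s a ev e f) (cons {s = s′} {u′} {t′} {v′} 0<s′ a′ ev′ e′ f′) =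
        cons (0<-+ˡ 0<s (<⇒≤ 0<s′))
          (act-resp cz (λ ω → sym (distribʳ (c ω) s s′)) ≋-refl (act-add cz a a′))
          (eval-add ev ev′)
          (trans (+-cong e e′) (+-interchange s t s′ t′)) (≋-trans (⊕-cong f f′) (⊕-interchange u v u′ v′))

      eval-scale : ∀ {M s t v} → 0# < s → Eval Z M t v → Eval Z M (s * t) (s ⊙ v)
      eval-scale {s = s} 0<s (nil e f) = nil (trans (*-congˡ e) (zeroʳ s)) (⊙-zeroʳ s f)
      eval-scale {s = s} 0<s (cons 0<s′ a ev e f) = cons (0<-* 0<s 0<s′)
        (act-resp cz (λ ω → sym (*-assoc _ _ _)) ≋-refl (act-scale cz 0<s a)) (eval-scale 0<s ev)
        (trans (*-congˡ e) (distribˡ _ _ _)) (λ j → trans (*-congˡ (f j)) (distribˡ _ _ _))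

  eval-mono : ∀ {N} {Z Z′ : Fin N → Coned} {M t v} → (∀ i {t v} → Z i t v → Z′ i t v) → Eval Z M t v → Eval Z′ M t v
  eval-mono f (nil e e′)           = nil e e′
  eval-mono f (cons 0<s a ev e e′) = cons 0<s (act-mono f a) (eval-mono f ev) e e′

  -- The evaluation of M with the contribution of variable 0 left out:
  -- a is the total weight that is missing.
  data Rest {N} (Z : Fin N → Coned) : List (Vect (suc N)) → ℝ → ℝ → Vect d → Set where
    nil  : ∀ {t a r} → t ≈ 0# → a ≈ 0# → r ≋ 0v → Rest Z [] t a r
    cons : ∀ {c M t a r s u t′ a′ r′} → 0# < s → act (s ⊙ (c ∘ suc)) Z u → Rest Z M t′ a′ r′ →
           t ≈ s + t′ → a ≈ s * c zero + a′ → r ≋ u ⊕ r′ → Rest Z (c ∷ M) t a r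

-- Symbolic elimination of variables.

module Elimination {A : Set} (arith : Arithmetic A) where
  open import Data.Fin.Base using (zero; suc)
  open import Data.Nat.Base using (zero; suc)
  open Arithmetic arith renaming (zero to #0; one to #1)

  -- A symbolic point is a combination of N symbols, and a list of lists of points stands for the union of the
  -- positive joins of the inner lists.
  Pt : ℕ → Set
  Pt N = Fin N → A

  Poly : ℕ → Set
  Poly N = List (List (Pt N))

  -- Coefficients are non-negative, so comparison with 0 from one side tests for vanishing.
  constant? : ∀ {N} → List (Pt (suc N)) → Bool
  constant? = all (λ c → leq (c zero) #0)

  constants : ∀ {N} → Poly (suc N) → Poly N
  constants φ = map (map (_∘ suc)) (filterᵇ constant? φ)

  -- The point E of a factor λX + (1 - λ)E. It is formed only for λ < 1, where 1 - λ is invertible.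
  normalise : ∀ {N} → Pt (suc N) → Pt N
  normalise c ω = mul (inv (add #1 (neg (c zero)))) (c (suc ω))

  -- A factor that is the variable itself leaves no remainder; a factor without the variable is
  -- divided by 1 and stays. The result may be empty, for instance for the monomial X.
  loop : ∀ {N} → List (Pt (suc N)) → List (Pt N)
  loop []      = []
  loop (c ∷ M) = if leq #1 (c zero) then loop M else normalise c ∷ loop M

  loops : ∀ {N} → Poly (suc N) → Poly N
  loops φ = map loop (filterᵇ (notᵇ ∘ constant?) φ)

  -- One product for each subfamily, the empty one included. Taking each member at most once loses
  -- nothing, since the join of a convex set with itself is that set.
  unions : ∀ {B : Set} → List (List B) → List (List B)
  unions []       = [] ∷ []
  unions (N ∷ Ns) = unions Ns ++ map (N ++_) (unions Ns)

  -- The least convex X with X ⊇ φ(X)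
  least : ∀ {N} → Poly (suc N) → Poly N
  least φ = cartesianProductWith _++_ (constants φ) (unions (constants φ ++ loops φ))

  insertPt : ∀ {N} → Pt (suc N) → Pt N → Pt N
  insertPt c q ω = add (mul (c zero) (q ω)) (c (suc ω))

  -- A combination distributes over a join, λ(q ⋆ q′) + E = (λq + E) ⋆ (λq′ + E), because E is
  -- convex. A single `m` is put into all factors of `M`: as the union being substituted is convex,
  -- the points used in different factors add up to a share in one of its monomials.
  insert : ∀ {N} → List (Pt (suc N)) → List (Pt N) → List (Pt N)
  insert M m = concatMap (λ c → map (insertPt c) m) M

  -- Monomials without the variable are kept as they are: inserting would lose them when `ψ` is
  -- empty, that is, when the variable is the empty set.
  substMonomial : ∀ {N} → Poly N → List (Pt (suc N)) → Poly N
  substMonomial ψ M = if constant? M then map (_∘ suc) M ∷ [] else map (insert M) ψ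

  subst : ∀ {N} → Poly N → Poly (suc N) → Poly N
  subst ψ = concatMap (substMonomial ψ)

  -- `χ` is a query in all the unknowns that undergoes the same substitutions; with a single
  -- variable as query, its component is read off at the end.
  eliminate : ∀ K {N} → (Fin K → Poly (K +ᴺ N)) → Poly (K +ᴺ N) → Poly N
  eliminate zero    Φ χ = χ
  eliminate (suc K) Φ χ = eliminate K (subst ψ ∘ Φ ∘ suc) (subst ψ χ)
    where ψ = least (Φ zero)

  append : ∀ {a} {B : Set a} {K N} → (Fin K → B) → (Fin N → B) → Fin (K +ᴺ N) → B
  append {K = zero}  f g i       = g i
  append {K = suc K} f g zero    = f zero
  append {K = suc K} f g (suc i) = append (f ∘ suc) g i

  flat : ∀ {n p} → LinComb A n p → Pt (n +ᴺ p)
  flat c = append (λ i → c (inj₁ i)) (λ q → c (inj₂ q))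

  flatPolynomial : ∀ {n p} → Polynomial A n p → Poly (n +ᴺ p)
  flatPolynomial = map (λ M → map flat (toList M))

  unit : ∀ {N} → Fin N → Pt N
  unit zero    zero    = #1
  unit zero    (suc _) = #0
  unit (suc k) zero    = #0
  unit (suc k) (suc i) = unit k i

  fromLeft : ∀ {K N} → Poly K → Poly (K +ᴺ N)
  fromLeft = map (map λ c → append c λ _ → #0)

  fromRight : ∀ {K N} → Poly N → Poly (K +ᴺ N)
  fromRight {K} = map (map (append {K = K} λ _ → #0))

  -- A parameter P_q may be replaced by its convex hull, which is the value of a new variable Y_q subject to Y_q ≥ π_q.
  solution : ∀ {n p N} → System A n p → (Fin p → Poly N) → Fin n → Poly N
  solution {n} {p} I π i = eliminate p (λ q → fromRight (π q))
    (fromLeft (eliminate n (λ j → flatPolynomial (I j)) ((unit (i ↑ˡ p) ∷ []) ∷ [])))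

-- Correctness of the elimination.

module LeastSolution (R : Reals) (dec : ∀ (P : Set) → Dec P) (d : ℕ) where
  open import Data.Fin.Base using (zero; suc)
  open import Data.Nat.Base using (zero; suc)
  open OrderedField R
  open Reals R hiding (zero)
  open Vectors R
  open Cones R d
  open IsCone
  open Elimination (arithmetic R)
  open SemiringSum semiring using (∑-distrib-+; *-distribˡ-sum)

  Convex : ∀ {N} → Vect N → Set
  Convex c = (∀ ω → 0# ≤ c ω) × sum c ≈ 1#

  NonEmpty : ∀ {B : Set} → List B → Set
  NonEmpty []      = ⊥
  NonEmpty (_ ∷ _) = ⊤

  Good : ∀ {N} → List (Vect N) → Set
  Good M = NonEmpty M × All Convex M

  sum-nonNeg : ∀ {N} (c : Vect N) → (∀ ω → 0# ≤ c ω) → 0# ≤ sum c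
  sum-nonNeg {zero}  c p = ≤-refl
  sum-nonNeg {suc N} c p = 0≤-+ (p zero) (sum-nonNeg (c ∘ suc) (p ∘ suc))

  sum-0 : ∀ {N} (c : Vect N) → (∀ ω → 0# ≤ c ω) → sum c ≤ 0# → c ≋ 0v
  sum-0 {suc N} c p q zero    = ≤-antisym
      (≤-trans (≤-respˡ (+-identityʳ _) (+-mono-≤ ≤-refl (sum-nonNeg (c ∘ suc) (p ∘ suc)))) q) (p zero)
  sum-0 {suc N} c p q (suc i) = sum-0 (c ∘ suc) (p ∘ suc)
    (≤-trans (≤-respˡ (+-identityˡ _) (+-mono-≤ (p zero) ≤-refl)) q) i

  module _ {N} {c : Vect (suc N)} (cv : Convex c) where

    tail-sum : sum (c ∘ suc) ≈ 1# - c zero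
    tail-sum = trans (solve 2 (λ x y → y := (x :+ y) :- x) refl (c zero) _) (+-congʳ (proj₂ cv))

    coefficient≤1 : c zero ≤ 1#
    coefficient≤1 = 0≤y-x⇒x≤y (≤-respʳ tail-sum (sum-nonNeg (c ∘ suc) (proj₁ cv ∘ suc)))

    tail-vanish : 1# ≤ c zero → c ∘ suc ≋ 0v
    tail-vanish p = sum-0 (c ∘ suc) (proj₁ cv ∘ suc) (≤-respˡ (sym tail-sum)
      (0≤y-x⇒x≤y (≤-respʳ (solve 1 (λ x → x :- :1 := :0 :- (:1 :- x)) refl _) (x≤y⇒0≤y-x p))))

    tail-convex : c zero ≈ 0# → Convex (c ∘ suc)
    tail-convex e = proj₁ cv ∘ suc , trans tail-sum (trans (+-congˡ (-‿cong e)) (solve 0 (:1 :- :0 := :1) refl))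

    normalise-convex : 0# < 1# - c zero → Convex (normalise c)
    normalise-convex 0<w = (λ ω → *-nonNeg (<⇒≤ (0<-⁻¹ 0<w)) (proj₁ cv (suc ω)))
      , trans (sym (*-distribˡ-sum _ (c ∘ suc))) (trans (*-congˡ tail-sum) (⁻¹-inverseˡ (0<⇒≉0 0<w)))

    insert-convex : ∀ {q} → Convex q → Convex (insertPt c q)
    insert-convex {q} (p , e) = (λ ω → 0≤-+ (*-nonNeg (proj₁ cv zero) (p ω)) (proj₁ cv (suc ω)))
      , trans (∑-distrib-+ (c zero ⊙ q) (c ∘ suc))
        (trans (+-cong (trans (sym (*-distribˡ-sum _ q)) (trans (*-congˡ e) (*-identityʳ _))) tail-sum)
          (solve 1 (λ x → x :+ (:1 :- x) := :1) refl _))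

  nonEmpty-++ : ∀ {B : Set} {xs ys : List B} → NonEmpty xs → NonEmpty (xs ++ ys)
  nonEmpty-++ {xs = _ ∷ _} _ = tt

  nonEmpty-map : ∀ {B C : Set} {f : B → C} {xs} → NonEmpty xs → NonEmpty (map f xs)
  nonEmpty-map {xs = _ ∷ _} _ = tt

  constant⁻ : ∀ {N} (M : List (Vect (suc N))) → All Convex M → T (constant? M) → All (λ c → c zero ≈ 0#) M
  constant⁻ []      _         _ = []
  constant⁻ (c ∷ M) (cv ∷ cvs) p with c zero ≤? 0#
  ... | yes c≤0 = ≤-antisym c≤0 (proj₁ cv zero) ∷ constant⁻ M cvs p

  nonconstant⁻ : ∀ {N} (M : List (Vect (suc N))) → T (notᵇ (constant? M)) → Any (λ c → 0# < c zero) M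
  nonconstant⁻ (c ∷ M) p with c zero ≤? 0#
  ... | yes _   = there (nonconstant⁻ M p)
  ... | no  c≰0 = here (≰⇒> c≰0)

  module _ {N} {φ : Poly (suc N)} where

    constants⁻ : ∀ {k} → k ∈ constants φ → ∃[ M ] (M ∈ φ × T (constant? M) × k ≡ map (_∘ suc) M)
    constants⁻ k∈ with ∈-map⁻ (map (_∘ suc)) k∈
    ... | M , M∈ , e with ∈-filter⁻ (T? ∘ constant?) {xs = φ} M∈
    ... | M∈φ , p = M , M∈φ , p , e

    loops⁻ : ∀ {k} → k ∈ loops φ → ∃[ M ] (M ∈ φ × T (notᵇ (constant? M)) × k ≡ loop M)
    loops⁻ k∈ with ∈-map⁻ loop k∈
    ... | M , M∈ , e with ∈-filter⁻ (T? ∘ (notᵇ ∘ constant?)) {xs = φ} M∈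
    ... | M∈φ , p = M , M∈φ , p , e

    constants⁺ : ∀ {M} → M ∈ φ → T (constant? M) → map (_∘ suc) M ∈ constants φ
    constants⁺ M∈ p = ∈-map⁺ (map (_∘ suc)) (∈-filter⁺ (T? ∘ constant?) M∈ p)

    loops⁺ : ∀ {M} → M ∈ φ → T (notᵇ (constant? M)) → loop M ∈ loops φ
    loops⁺ M∈ p = ∈-map⁺ loop (∈-filter⁺ (T? ∘ (notᵇ ∘ constant?)) M∈ p)

  tails-good : ∀ {N} {M : List (Vect (suc N))} → Good M → T (constant? M) → Good (map (_∘ suc) M)
  tails-good {M = M} (ne , cvs) p = nonEmpty-map ne , All.map⁺
      (All.zipWith (λ (cv , e) → tail-convex cv e) (cvs , constant⁻ M cvs p))

  loop-convex : ∀ {N} {M : List (Vect (suc N))} → All Convex M → All Convex (loop M)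
  loop-convex []                       = []
  loop-convex {M = c ∷ M} (cv ∷ cvs) with 1# ≤? c zero
  ... | yes _ = loop-convex cvs
  ... | no  p = normalise-convex cv (x<y⇒0<y-x (≰⇒> p)) ∷ loop-convex cvs

  unions-all : ∀ {B : Set} {P : B → Set} (Ns : List (List B)) → All (All P) Ns → All (All P) (unions Ns)
  unions-all []       _         = [] ∷ []
  unions-all (N ∷ Ns) (p ∷ ps) = All.++⁺ (unions-all Ns ps) (All.map⁺ (All.map (All.++⁺ p) (unions-all Ns ps)))

  constants-good : ∀ {N} {φ : Poly (suc N)} → All Good φ → All Good (constants φ)
  constants-good {φ = φ} g = All.tabulate λ k∈ → go (constants⁻ {φ = φ} k∈)
    where
    go : ∀ {k} → ∃[ M ] (M ∈ φ × T (constant? M) × k ≡ map (_∘ suc) M) → Good k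
    go (M , M∈ , p , ≡-refl) = tails-good (All.lookup g M∈) p

  loops-convex : ∀ {N} {φ : Poly (suc N)} → All Good φ → All (All Convex) (loops φ)
  loops-convex {φ = φ} g = All.tabulate λ k∈ → go (loops⁻ {φ = φ} k∈)
    where
    go : ∀ {k} → ∃[ M ] (M ∈ φ × T (notᵇ (constant? M)) × k ≡ loop M) → All Convex k
    go (M , M∈ , p , ≡-refl) = loop-convex (proj₂ (All.lookup g M∈))

  least-good : ∀ {N} {φ : Poly (suc N)} → All Good φ → All Good (least φ)
  least-good {φ = φ} g = All.tabulate λ m∈ → go
      (∈-cartesianProductWith⁻ _++_ (constants φ) (unions (constants φ ++ loops φ)) m∈)
    where
    go : ∀ {m} → ∃[ k ] ∃[ S ] (k ∈ constants φ × S ∈ unions (constants φ ++ loops φ) × m ≡ k ++ S) → Good m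
    go (k , S , k∈ , S∈ , ≡-refl) with All.lookup (constants-good g) k∈
    ... | ne , cvs = nonEmpty-++ ne , All.++⁺ cvs (All.lookup
      (unions-all _ (All.++⁺ (All.map proj₂ (constants-good g)) (loops-convex g))) S∈)

  insert-all-good : ∀ {N} {M : List (Vect (suc N))} {m} → Good M → Good m → Good (insert M m)
  insert-all-good {M = c ∷ M} {m} (_ , cvs) (ne , mcvs) = nonEmpty-++ (nonEmpty-map ne) , go cvs
    where
    go : ∀ {M} → All Convex M → All Convex (insert M m)
    go []         = []
    go (cv ∷ cvs) = All.++⁺ (All.map⁺ (All.map (insert-convex cv) mcvs)) (go cvs)

  substMonomial-good : ∀ {N} {ψ : Poly N} {M} → All Good ψ → Good M → All Good (substMonomial ψ M)
  substMonomial-good {M = M} gψ gM with constant? M in eq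
  ... | true  = tails-good gM (≡-subst T (≡-sym eq) tt) ∷ []
  ... | false = All.map⁺ (All.map (insert-all-good gM) gψ)

  subst-good : ∀ {N} {ψ : Poly N} {φ} → All Good ψ → All Good φ → All Good (subst ψ φ)
  subst-good gψ []         = []
  subst-good gψ (gM ∷ gφ) = All.++⁺ (substMonomial-good gψ gM) (subst-good gψ gφ)

  module _ {N} {Z : Fin N → Coned} where

    rest-nonNegative : ∀ {M t a r} → All Convex M → Rest Z M t a r → 0# ≤ a
    rest-nonNegative _ (nil e f g) = ≤-reflexive (sym f)
    rest-nonNegative (cv ∷ cvs) (cons 0<s a rest e f g) =
      ≤-respʳ (sym f) (0≤-+ (*-nonNeg (<⇒≤ 0<s) (proj₁ cv zero)) (rest-nonNegative cvs rest))

  module _ {N} {Z : Fin (suc N) → Coned} (cz : Cones Z) where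

    -- Each factor takes its own share of variable 0. Since the cone is closed under addition, the
    -- shares merge into one of their total weight `a`.
    open-eval : ∀ {M t v} → Eval Z M t v → ∃[ a ] ∃[ y ] ∃[ r ] (Rest (Z ∘ suc) M t a r × Z zero a y × v ≋ y ⊕ r)
    open-eval (nil e f) = 0# , 0v , 0v , nil e refl ≋-refl , zero-∈ (cz zero) , ≋-trans f (0⊕ ≋-refl)
    open-eval (cons 0<s (y , u , z , a , g) ev e f) with open-eval ev
    ... | a′ , y′ , r′ , rest , z′ , f′ = _ , y ⊕ y′ , u ⊕ r′ , cons 0<s a rest e refl ≋-refl , add (cz zero) z z′
      , ≋-trans f (≋-trans (⊕-cong g f′) (⊕-interchange y u y′ r′))

    -- Conversely, one share of weight `a` is divided among the factors by `split`, in the amounts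
    -- that their coefficients prescribe.
    close-eval : ∀ {M t a r y} → All Convex M → Rest (Z ∘ suc) M t a r → Z zero a y → Eval Z M t (y ⊕ r)
    close-eval _ (nil e f g) z = nil e (≋-trans (⊕-identityˡ (vanish (cz zero) f z)) g)
    close-eval (cv ∷ cvs) (cons {u = u} {r′ = r′} 0<s a rest e f g) z
      with split (cz zero) (*-nonNeg (<⇒≤ 0<s) (proj₁ cv zero)) (rest-nonNegative cvs rest) (resp (cz zero) f ≋-refl z)
    ... | y₁ , y₂ , z₁ , z₂ , h = cons 0<s (y₁ , u , z₁ , a , ≋-refl) (close-eval cvs rest z₂) e
      (≋-trans (⊕-cong h g) (⊕-interchange y₁ y₂ u r′))

  module _ {N} {Z : Fin N → Coned} where

    rest-positive : ∀ {M t a r} → All Convex M → Any (λ c → 0# < c zero) M → Rest Z M t a r → 0# < a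
    rest-positive (cv ∷ cvs) (here p)  (cons 0<s a rest e f g) = <-respʳ (sym f)
        (0<-+ˡ (0<-* 0<s p) (rest-nonNegative cvs rest))
    rest-positive (cv ∷ cvs) (there p) (cons 0<s a rest e f g) =
      <-respʳ (sym f) (0<-+ʳ (*-nonNeg (<⇒≤ 0<s) (proj₁ cv zero)) (rest-positive cvs p rest))

    rest-constant : ∀ {M t a r} → All (λ c → c zero ≈ 0#) M → Rest Z M t a r → a ≈ 0#
    rest-constant _ (nil e f g) = f
    rest-constant (c≈0 ∷ cs) (cons 0<s a rest e f g) =
      trans f (trans (+-cong (trans (*-congˡ c≈0) (zeroʳ _)) (rest-constant cs rest)) (+-identityˡ 0#))

    rest⇒tails : ∀ {M t a r} → Rest Z M t a r → Eval Z (map (_∘ suc) M) t r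
    rest⇒tails (nil e f g)               = nil e g
    rest⇒tails (cons 0<s a rest e f g) = cons 0<s a (rest⇒tails rest) e g

    tails⇒rest : ∀ M {t r} → Eval Z (map (_∘ suc) M) t r → ∃[ a ] Rest Z M t a r
    tails⇒rest []      (nil e f)         = 0# , nil e refl f
    tails⇒rest (c ∷ M) (cons 0<s a ev e f) = _ , cons 0<s a (proj₂ (tails⇒rest M ev)) e refl f

    module _ (cz : Cones Z) where

      -- A factor of weight s with coefficient λ uses the weight sλ of the variable and leaves s(1 -
      -- λ) to its remainder, so the weights of both add up to `t`.
      rest⇒loop : ∀ {M t a r} → All Convex M → Rest Z M t a r → ∃[ t₁ ] (t ≈ a + t₁ × Eval Z (loop M) t₁ r)
      rest⇒loop _ (nil e f g) = 0# , trans e (sym (trans (+-identityʳ _) f)) , nil refl g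
      rest⇒loop {c ∷ M} {t} {a} (cv ∷ cvs)
          (cons {s = s} {u} {t′} {a′} 0<s p rest e f g) with rest⇒loop cvs rest | 1# ≤? c zero
      ... | t₁ , e₁ , ev | yes 1≤c = t₁
        , trans e (trans (+-cong (trans (sym (*-identityʳ s)) (*-congˡ (≤-antisym 1≤c (coefficient≤1 cv)))) e₁)
            (trans (sym (+-assoc _ _ _)) (+-congʳ (sym f))))
        , eval-resp refl (≋-trans (≋-sym (⊕-identityˡ (act-vanish cz (⊙-zeroʳ s (tail-vanish cv 1≤c)) p))) (≋-sym g)) ev
      ... | t₁ , e₁ , ev | no  1≰c = s * w + t₁
        , trans e (trans (+-congˡ e₁) (trans
            (solve 4 (λ s a t₁ l → s :+ (a :+ t₁) := s :* l :+ a :+ (s :* (:1 :- l) :+ t₁)) refl s a′ t₁ (c zero))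
            (+-congʳ (sym f))))
        , cons (0<-* 0<s 0<w) (act-resp cz (λ ω → sym (begin-ω ω)) ≋-refl p) ev refl g
        where
        w = 1# - c zero
        0<w = x<y⇒0<y-x (≰⇒> 1≰c)
        begin-ω : ∀ ω → (s * w) * (w ⁻¹ * c (suc ω)) ≈ s * c (suc ω)
        begin-ω ω = trans (solve 4 (λ s w i x → (s :* w) :* (i :* x) := (w :* i) :* (s :* x)) refl s w (w ⁻¹)
            (c (suc ω)))
          (trans (*-congʳ (⁻¹-inverseʳ (0<⇒≉0 0<w))) (*-identityˡ _))

      loop⇒rest : ∀ {M t₁ r} → All Convex M → Eval Z (loop M) t₁ r → ∃[ t ] ∃[ a ] (t ≈ a + t₁ × Rest Z M t a r)
      loop⇒rest [] (nil e f) = 0# , 0# , sym (trans (+-identityˡ _) e) , nil refl refl f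
      loop⇒rest {c ∷ M} {t₁} (cv ∷ cvs) ev with 1# ≤? c zero
      loop⇒rest {c ∷ M} {t₁} (cv ∷ cvs) ev | yes 1≤c with loop⇒rest cvs ev
      -- A factor equal to the variable left no trace in `loop M`, so any positive weight will do
      -- for it.
      ... | t , a , e , rest = 1# + t , 1# * c zero + a
        , trans (+-congˡ e) (trans (sym (+-assoc _ _ _))
          (+-congʳ (+-congʳ (trans (≤-antisym 1≤c (coefficient≤1 cv)) (sym (*-identityˡ _))))))
        , cons 0<1 (act-zero cz (⊙-zeroʳ 1# (tail-vanish cv 1≤c))) rest refl refl (0⊕ ≋-refl)
      loop⇒rest {c ∷ M} {t₁} (cv ∷ cvs) (cons {s = s} {t′ = t₂} 0<s p ev e f) | no 1≰c with loop⇒rest cvs ev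
      -- The inverse of the passage in `rest⇒loop`: a remainder of weight s comes from a factor of
      -- weight s / (1 - λ).
      ... | t , a , e′ , rest = s * w ⁻¹ + t , s * w ⁻¹ * c zero + a
        , trans (+-congˡ e′) (trans
            (solve 4 (λ x a t l → x :+ (a :+ t) := x :* l :+ a :+ (x :* (:1 :- l) :+ t)) refl (s * w ⁻¹) a t₂ (c zero))
            (+-congˡ (trans (+-congʳ (*-⁻¹-cancel s 0<w)) (sym e))))
        , cons (0<-* 0<s (0<-⁻¹ 0<w)) (act-resp cz (λ ω → sym (*-assoc s (w ⁻¹) (c (suc ω)))) ≋-refl p) rest refl refl f
        where
        w = 1# - c zero
        0<w = x<y⇒0<y-x (≰⇒> 1≰c)

  -- The supremum of the τ for which x + τ r is reached would be exceeded by a further step.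
  absorb : ∀ {K : Coned} → IsCone K → ∀ {a t₁ r} → 0# < a → 0# ≤ t₁ →
           (∀ y → K a y → K (a + t₁) (y ⊕ r)) → ∀ {t₂ x} → 0# < t₂ → K t₂ x → K (t₂ + t₁) (x ⊕ r)
  absorb {K} ck {a} {t₁} {r} 0<a 0≤t₁ step {t₂} {x} 0<t₂ x∈ with dec (K (t₂ + t₁) (x ⊕ r))
  ... | yes p = p
  ... | no ¬p = ⊥-elim (<⇒≱ 0<δ (≤-respʳ (solve 1 (λ x → x :- x := :0) refl m)
                  (≤-respˡ (solve 2 (λ x y → x :+ y :- x := y) refl m δ) (+-monoˡ-≤ (- m) m+δ≤m))))
    where
    S : ℝ → Set
    S τ = 0# ≤ τ × K (t₂ + τ * t₁) (x ⊕ τ ⊙ r)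

    S-0 : S 0#
    S-0 = ≤-refl , resp ck (sym (trans (+-congˡ (zeroˡ t₁)) (+-identityʳ t₂)))
      (≋-sym (⊕-identityʳ λ j → zeroˡ (r j))) x∈

    S-1 : ∀ {τ} → τ ≈ 1# → S τ → ⊥
    S-1 τ≈1 (_ , k) = ¬p (resp ck (+-congˡ (trans (*-congʳ τ≈1) (*-identityˡ t₁)))
      (⊕-cong ≋-refl λ j → trans (*-congʳ τ≈1) (*-identityˡ (r j))) k)

    -- Past 1, a mixture of the point with x in the ratio 1 / τ would reach exactly 1, which is
    -- excluded by assumption.
    S-bounded : ∀ τ → S τ → τ ≤ 1#
    S-bounded τ (0≤τ , k) with τ ≤? 1#
    ... | yes τ≤1 = τ≤1
    ... | no  τ≰1 = ⊥-elim (S-1 (⁻¹-inverseˡ (0<⇒≉0 0<τ)) (0≤1′ , resp ck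
        (trans (solve 4 (λ i τ t₂ t₁ → (:1 :- i) :* t₂ :+ i :* (t₂ :+ τ :* t₁) := t₂ :+ (i :* τ) :* t₁) refl i τ t₂
          t₁) refl)
        (λ j → solve 4 (λ i τ t₂ t₁ → (:1 :- i) :* t₂ :+ i :* (t₂ :+ τ :* t₁) := t₂ :+ (i :* τ) :* t₁) refl i τ
          (x j) (r j))
        (add ck (scale ck 0<1-i x∈) (scale ck 0<i k))))
      where
      1<τ = ≰⇒> τ≰1
      0<τ = ≤-<-trans 0≤1 1<τ
      i   = τ ⁻¹
      0<i = 0<-⁻¹ 0<τ
      0≤1′ = *-nonNeg (<⇒≤ 0<i) (<⇒≤ 0<τ)
      0<1-i : 0# < 1# - i
      0<1-i = <-respʳ (trans (solve 2 (λ i τ → i :* (τ :- :1) := i :* τ :- i) refl i τ)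
                        (+-congʳ (⁻¹-inverseˡ (0<⇒≉0 0<τ))))
              (0<-* 0<i (x<y⇒0<y-x 1<τ))

    supS = supremum S (0# , S-0) (1# , S-bounded)
    m    = proj₁ supS
    -- A step from τ has length (t₂ + τ t₁) / a, and this is never below t₂ / a.
    δ    = t₂ * a ⁻¹
    0<δ  = 0<-* 0<t₂ (0<-⁻¹ 0<a)

    -- Shrink to weight `a`, apply `step`, and scale back: the added `r` returns multiplied by the
    -- current weight over `a`.
    advance : ∀ {τ} → S τ → S (τ + (t₂ + τ * t₁) * a ⁻¹)
    advance {τ} (0≤τ , k) = 0≤-+ 0≤τ (<⇒≤ 0<w/a)
      , resp ck
          (trans (distribˡ _ _ _) (trans (+-congʳ w/a*a)
            (solve 4 (λ t₂ τ t₁ q → t₂ :+ τ :* t₁ :+ q :* t₁ := t₂ :+ (τ :+ q) :* t₁) refl t₂ τ t₁ (w * a ⁻¹))))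
          (λ j → trans (solve 4 (λ q p x r → q :* (p :* x :+ r) := (q :* p) :* x :+ q :* r) refl (w * a ⁻¹)
            (a * w ⁻¹) (x j + τ * r j) (r j))
            (trans (+-congʳ (trans (*-congʳ both) (*-identityˡ _)))
              (solve 4 (λ x τ r q → x :+ τ :* r :+ q :* r := x :+ (τ :+ q) :* r) refl (x j) τ (r j) (w * a ⁻¹))))
          (scale ck 0<w/a (step _ (resp ck (*-⁻¹-cancel a 0<w) ≋-refl (scale ck (0<-* 0<a (0<-⁻¹ 0<w)) k))))
      where
      w = t₂ + τ * t₁
      0<w = 0<-+ˡ 0<t₂ (*-nonNeg 0≤τ 0≤t₁)
      0<w/a = 0<-* 0<w (0<-⁻¹ 0<a)
      w/a*a = *-⁻¹-cancel w 0<a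
      both : (w * a ⁻¹) * (a * w ⁻¹) ≈ 1#
      both = trans (solve 4 (λ w i a k → (w :* i) :* (a :* k) := (i :* a) :* (w :* k)) refl w (a ⁻¹) a (w ⁻¹))
        (trans (*-cong (⁻¹-inverseˡ (0<⇒≉0 0<a)) (⁻¹-inverseʳ (0<⇒≉0 0<w))) (*-identityˡ 1#))

    m+δ≤m : m + δ ≤ m
    m+δ≤m = 0≤y-x⇒x≤y (≤-respʳ (solve 2 (λ m δ → m :- δ :- m := m :- (m :+ δ)) refl m δ) (x≤y⇒0≤y-x m≤m-δ))
      where
      m≤m-δ : m ≤ m - δ
      m≤m-δ = proj₂ (proj₂ supS) (m - δ) λ τ s → 0≤y-x⇒x≤y
        (≤-respʳ (solve 3 (λ m τ δ → m :- (τ :+ δ) := m :- δ :- τ) refl m τ δ) (x≤y⇒0≤y-x (≤-trans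
          (+-mono-≤ ≤-refl (≤-respʳ (*-comm _ _) (≤-respˡ (*-comm _ _) (*-monoˡ-≤ (a ⁻¹) (<⇒≤ (0<-⁻¹ 0<a))
            (≤-respˡ (+-identityʳ t₂) (+-mono-≤ ≤-refl (*-nonNeg (proj₁ s) 0≤t₁)))))))
          (proj₁ (proj₂ supS) _ (advance s)))))

  ⟦_⟧ᴾ : ∀ {N} → Poly N → (Fin N → Coned) → Coned
  ⟦ φ ⟧ᴾ Z t v = ∃[ M ] (M ∈ φ × Eval Z M t v)

  -- Only the apex is adjoined here. Closure under addition is a property of `φ`, established for
  -- single monomials and for `least φ`.
  Hull : ∀ {N} → Poly N → (Fin N → Coned) → Coned
  Hull φ Z = pointed (⟦ φ ⟧ᴾ Z)

  Hull-mono : ∀ {N} {φ : Poly N} {Z Z′} → (∀ i {t v} → Z i t v → Z′ i t v) → ∀ {t v} → Hull φ Z t v → Hull φ Z′ t v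
  Hull-mono f (inj₁ p)             = inj₁ p
  Hull-mono f (inj₂ (M , M∈ , ev)) = inj₂ (M , M∈ , eval-mono f ev)

  Hull-isCone : ∀ {N} {φ : Poly N} {Z} → Cones Z →
                (∀ {t t′ v v′} → ⟦ φ ⟧ᴾ Z t v → ⟦ φ ⟧ᴾ Z t′ v′ → ⟦ φ ⟧ᴾ Z (t + t′) (v ⊕ v′)) → IsCone (Hull φ Z)
  Hull-isCone cz plus = pointed-isCone (λ p q (M , M∈ , ev) → M , M∈ , eval-resp p q ev) plus
    (λ 0<s (M , M∈ , ev) → M , M∈ , eval-scale cz 0<s ev) (λ (M , M∈ , ev) → eval-positive ev)

  single-isCone : ∀ {N} {M : List (Vect N)} {Z} → Cones Z → IsCone (Hull (M ∷ []) Z)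
  single-isCone {M = M} {Z} cz = Hull-isCone cz plus
    where
    plus : ∀ {t t′ v v′} → ⟦ M ∷ [] ⟧ᴾ Z t v → ⟦ M ∷ [] ⟧ᴾ Z t′ v′ → ⟦ M ∷ [] ⟧ᴾ Z (t + t′) (v ⊕ v′)
    plus (_ , here ≡-refl , ev) (_ , here ≡-refl , ev′) = M , here ≡-refl , eval-add cz ev ev′

  module _ {N} {Z : Fin N → Coned} (cz : Cones Z) where

    -- Adjoining the apex to one monomial makes it optional. Thus `unions` is a sum of pointed cones
    -- of single monomials, which is how it inherits closure under addition.
    unions-∷⁺ : ∀ N₁ Ns {t₁ t₂ v₁ v₂} → Hull (N₁ ∷ []) Z t₁ v₁ → ⟦ unions Ns ⟧ᴾ Z t₂ v₂ →
                ⟦ unions (N₁ ∷ Ns) ⟧ᴾ Z (t₁ + t₂) (v₁ ⊕ v₂)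
    unions-∷⁺ N₁ Ns (inj₁ (e , f)) (S , S∈ , ev) =
      S , ∈-++⁺ˡ S∈ , eval-resp (sym (trans (+-congʳ e) (+-identityˡ _))) (0⊕ f) ev
    unions-∷⁺ N₁ Ns (inj₂ (_ , here ≡-refl , ev₁)) (S , S∈ , ev) =
      N₁ ++ S , ∈-++⁺ʳ (unions Ns) (∈-map⁺ (N₁ ++_) S∈) , eval-++ ev₁ ev

    unions-∷⁻ : ∀ N₁ Ns {t v} → ⟦ unions (N₁ ∷ Ns) ⟧ᴾ Z t v →
                ∃[ t₁ ] ∃[ t₂ ] ∃[ v₁ ] ∃[ v₂ ]
                    (Hull (N₁ ∷ []) Z t₁ v₁ × ⟦ unions Ns ⟧ᴾ Z t₂ v₂ × t ≈ t₁ + t₂ × v ≋ v₁ ⊕ v₂)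
    unions-∷⁻ N₁ Ns (S , S∈ , ev) with ∈-++⁻ (unions Ns) S∈
    ... | inj₁ S∈′ = 0# , _ , 0v , _ , inj₁ (refl , ≋-refl) , (S , S∈′ , ev) , sym (+-identityˡ _) , 0⊕ ≋-refl
    ... | inj₂ S∈′ with ∈-map⁻ (N₁ ++_) S∈′
    ... | S′ , S′∈ , ≡-refl with eval-++⁻ N₁ ev
    ... | t₁ , t₂ , v₁ , v₂ , ev₁ , ev₂ , e , f = t₁ , t₂ , v₁ , v₂ , inj₂ (N₁ , here ≡-refl , ev₁)
        , (S′ , S′∈ , ev₂) , e , f

    unions-zero : ∀ Ns → ⟦ unions Ns ⟧ᴾ Z 0# 0v
    unions-zero []       = [] , here ≡-refl , nil refl ≋-refl
    unions-zero (N₁ ∷ Ns) with unions-zero Ns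
    ... | S , S∈ , ev = S , ∈-++⁺ˡ S∈ , ev

    unions-single : ∀ Ns {M t v} → M ∈ Ns → Eval Z M t v → ⟦ unions Ns ⟧ᴾ Z t v
    unions-single (N₁ ∷ Ns) (here ≡-refl) ev with unions-∷⁺ N₁ Ns (inj₂ (N₁ , here ≡-refl , ev)) (unions-zero Ns)
    ... | S , S∈ , ev′ = S , S∈ , eval-resp (+-identityʳ _) (⊕-identityʳ ≋-refl) ev′
    unions-single (N₁ ∷ Ns) (there M∈) ev with unions-single Ns M∈ ev
    ... | S , S∈ , ev′ = S , ∈-++⁺ˡ S∈ , ev′

    unions-add : ∀ Ns {t t′ v v′} → ⟦ unions Ns ⟧ᴾ Z t v → ⟦ unions Ns ⟧ᴾ Z t′ v′ → ⟦ unions Ns ⟧ᴾ Z (t + t′) (v ⊕ v′)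
    unions-add [] (_ , here ≡-refl , ev) (_ , here ≡-refl , ev′) = [] , here ≡-refl , eval-add cz ev ev′
    unions-add (N₁ ∷ Ns) p q with unions-∷⁻ N₁ Ns p | unions-∷⁻ N₁ Ns q
    ... | t₁ , t₂ , v₁ , v₂ , h , u , e , f | t₁′ , t₂′ , v₁′ , v₂′ , h′ , u′ , e′ , f′
      with unions-∷⁺ N₁ Ns (add (single-isCone cz) h h′) (unions-add Ns u u′)
    ... | S , S∈ , ev = S , S∈ , eval-resp
      (sym (trans (+-cong e e′) (+-interchange t₁ t₂ t₁′ t₂′)))
      (≋-sym (≋-trans (⊕-cong f f′) (⊕-interchange v₁ v₂ v₁′ v₂′))) ev

  module _ {N} {φ : Poly (suc N)} where

    least⁺ : ∀ {k S} → k ∈ constants φ → S ∈ unions (constants φ ++ loops φ) → k ++ S ∈ least φ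
    least⁺ = ∈-cartesianProductWith⁺ _++_

    least⁻ : ∀ {m} → m ∈ least φ → ∃[ k ] ∃[ S ] (k ∈ constants φ × S ∈ unions (constants φ ++ loops φ) × m ≡ k ++ S)
    least⁻ = ∈-cartesianProductWith⁻ _++_ (constants φ) (unions (constants φ ++ loops φ))

    -- The sum of two products keeps the first leading constant, and the second one joins the
    -- optional factors. This is why the constants occur in both arguments of the product in
    -- `least`.
    least-isCone : ∀ {Z} → Cones Z → IsCone (Hull (least φ) Z)
    least-isCone {Z} cz = Hull-isCone cz plus
      where
      plus : ∀ {t t′ v v′} → ⟦ least φ ⟧ᴾ Z t v → ⟦ least φ ⟧ᴾ Z t′ v′ → ⟦ least φ ⟧ᴾ Z (t + t′) (v ⊕ v′)
      plus (m , m∈ , ev) (m′ , m′∈ , ev′) with least⁻ m∈ | least⁻ m′∈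
      ... | k , S , k∈ , S∈ , ≡-refl | k′ , S′ , k′∈ , S′∈ , ≡-refl with eval-++⁻ k ev | eval-++⁻ k′ ev′
      ... | t₁ , t₂ , v₁ , v₂ , ev₁ , ev₂ , e , f | t₁′ , t₂′ , v₁′ , v₂′ , ev₁′ , ev₂′ , e′ , f′
        with unions-add cz (constants φ ++ loops φ) (S , S∈ , ev₂)
               (unions-add cz (constants φ ++ loops φ) (unions-single cz (constants φ ++ loops φ) (∈-++⁺ˡ k′∈) ev₁′)
                 (S′ , S′∈ , ev₂′))
      ... | S″ , S″∈ , ev″ = k ++ S″ , least⁺ k∈ S″∈
          , eval-resp (trans (sym (+-assoc _ _ _)) (sym (+-cong e e′)))
              (λ j → trans (sym (+-assoc _ _ _)) (sym (+-cong (f j) (f′ j)))) (eval-++ ev₁ ev″)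

    module _ (gφ : All Good φ) {Z : Fin (suc N) → Coned} (cz : Cones Z) where

      private
        loop-absorbed : ∀ {M} → M ∈ φ → T (notᵇ (constant? M)) → (∀ {t v} → Eval Z M t v → Z zero t v) →
                        ∀ {t₁ t₂ v₁ v₂} → 0# < t₁ → Z zero t₁ v₁ → Eval (Z ∘ suc) (loop M) t₂ v₂ → Z zero (t₁ + t₂)
                            (v₁ ⊕ v₂)
        loop-absorbed {M} M∈ p closed 0<t₁ z ev with proj₂ (All.lookup gφ M∈)
        ... | cvs with loop⇒rest (cz ∘ suc) cvs ev
        ... | t , a , e , rest = absorb (cz zero) (rest-positive cvs (nonconstant⁻ M p) rest) (eval-nonNegative ev)
          (λ y y∈ → closed (eval-resp e ≋-refl (close-eval cz cvs rest y∈))) 0<t₁ z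

        constant-closed : ∀ {M} → M ∈ φ → T (constant? M) → (∀ {t v} → Eval Z M t v → Z zero t v) →
                          ∀ {t v} → Eval (Z ∘ suc) (map (_∘ suc) M) t v → Z zero t v
        constant-closed {M} M∈ p closed ev with proj₂ (All.lookup gφ M∈)
        ... | cvs with tails⇒rest M ev
        ... | a , rest = resp (cz zero) refl ≋-refl (closed (eval-resp refl (⊕-identityˡ ≋-refl)
          (close-eval cz cvs rest (zero-∈′ (cz zero) (rest-constant (constant⁻ M cvs p) rest) ≋-refl))))

      -- `absorb` can only extend a point that is already in the set. The leading constant supplies
      -- such a point of positive weight; the optional factors are then added one after the other,
      -- constants by convexity and remainders by `absorb`.
      least-below : (∀ {M t v} → M ∈ φ → Eval Z M t v → Z zero t v) → ∀ {t v} → Hull (least φ) (Z ∘ suc) t v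
          → Z zero t v
      least-below closed (inj₁ (e , f)) = zero-∈′ (cz zero) e f
      least-below closed (inj₂ (m , m∈ , ev)) with least⁻ m∈
      ... | k , S , k∈ , S∈ , ≡-refl with eval-++⁻ k ev
      ... | t₁ , t₂ , v₁ , v₂ , ev₁ , ev₂ , e , f = resp (cz zero) (sym e) (≋-sym f)
          (absorb-all (constants φ ++ loops φ) absorbed (S , S∈ , ev₂) (constant-positive k∈ ev₁)
            (constant-below k∈ ev₁))
        where
        constant-below : ∀ {k t v} → k ∈ constants φ → Eval (Z ∘ suc) k t v → Z zero t v
        constant-below k∈ ev with constants⁻ {φ = φ} k∈
        ... | M , M∈ , p , ≡-refl = constant-closed M∈ p (closed M∈) ev

        constant-positive : ∀ {k t v} → k ∈ constants φ → Eval (Z ∘ suc) k t v → 0# < t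
        constant-positive {k} k∈ ev with k | proj₁ (All.lookup (constants-good gφ) k∈)
        ... | _ ∷ _ | _ = eval-cons-positive ev

        absorbed : ∀ {M} → M ∈ constants φ ++ loops φ → ∀ {t₁ t₂ v₁ v₂} → 0# < t₁ → Z zero t₁ v₁ →
                   Eval (Z ∘ suc) M t₂ v₂ → Z zero (t₁ + t₂) (v₁ ⊕ v₂)
        absorbed M∈ 0<t₁ z ev with ∈-++⁻ (constants φ) M∈
        ... | inj₁ M∈′ = add (cz zero) z (constant-below M∈′ ev)
        ... | inj₂ M∈′ with loops⁻ {φ = φ} M∈′
        ... | M₀ , M₀∈ , p , ≡-refl = loop-absorbed M₀∈ p (closed M₀∈) 0<t₁ z ev

        absorb-all : ∀ Ns → (∀ {M} → M ∈ Ns → ∀ {t₁ t₂ v₁ v₂} → 0# < t₁ → Z zero t₁ v₁ →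
                     Eval (Z ∘ suc) M t₂ v₂ → Z zero (t₁ + t₂) (v₁ ⊕ v₂)) →
                     ∀ {t₁ t₂ v₁ v₂} → ⟦ unions Ns ⟧ᴾ (Z ∘ suc) t₂ v₂ → 0# < t₁ → Z zero t₁ v₁ → Z zero (t₁ + t₂)
                         (v₁ ⊕ v₂)
        absorb-all [] f (_ , here ≡-refl , nil e g) 0<t₁ z =
          resp (cz zero) (sym (trans (+-congˡ e) (+-identityʳ _))) (⊕0 g) z
        absorb-all (N₁ ∷ Ns) f u 0<t₁ z with unions-∷⁻ (cz ∘ suc) N₁ Ns u
        ... | a , b , x , y , inj₁ (p , q) , u′ , e , g = resp (cz zero)
          (+-congˡ (sym (trans e (trans (+-congʳ p) (+-identityˡ _)))))
          (⊕-cong ≋-refl (≋-sym (≋-trans g (⊕-identityˡ q))))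
          (absorb-all Ns (f ∘ there) u′ 0<t₁ z)
        ... | a , b , x , y , inj₂ (_ , here ≡-refl , ev) , u′ , e , g = resp (cz zero)
          (trans (+-assoc _ _ _) (+-congˡ (sym e)))
          (λ j → trans (+-assoc _ _ _) (+-congˡ (sym (g j))))
          (absorb-all Ns (f ∘ there) u′ (0<-+ˡ 0<t₁ (eval-nonNegative ev)) (f (here ≡-refl) 0<t₁ z ev))

      -- For a monomial with the variable, its share lies in some product k ⋆ S; adding the
      -- remainder amounts to enlarging S by one loop, and `unions` is closed under this.
      least-closed : (∀ {t v} → Z zero t v → Hull (least φ) (Z ∘ suc) t v) → ∀ {M t v} → M ∈ φ → Eval Z M t v →
                     Hull (least φ) (Z ∘ suc) t v
      least-closed below {M} M∈ ev with proj₂ (All.lookup gφ M∈) | open-eval cz ev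
      ... | cvs | a , y , r , rest , z , f with constant? M in eq
      ... | true with rest-constant (constant⁻ M cvs (≡-subst T (≡-sym eq) tt)) rest
      ...   | a≈0 = inj₂ (_ , least⁺ (constants⁺ {φ = φ} M∈ (≡-subst T (≡-sym eq) tt)) (proj₁ (proj₂ z₀))
          , eval-resp (+-identityʳ _)
                (λ j → trans (+-identityʳ _) (sym (≋-trans f (⊕-identityˡ (vanish (cz zero) a≈0 z)) j)))
                (eval-++ (rest⇒tails rest) (proj₂ (proj₂ z₀))))
        where z₀ = unions-zero (cz ∘ suc) (constants φ ++ loops φ)
      least-closed below {M} M∈ ev | cvs | a , y , r , rest , z , f | false with below z
      ... | inj₁ (a≈0 , _) = ⊥-elim (0<⇒≉0
          (rest-positive cvs (nonconstant⁻ M (≡-subst (T ∘ notᵇ) (≡-sym eq) tt)) rest) a≈0)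
      ... | inj₂ (m , m∈ , ev₀) with least⁻ m∈
      ... | k , S , k∈ , S∈ , ≡-refl with eval-++⁻ k ev₀ | rest⇒loop (cz ∘ suc) cvs rest
      ... | t₁ , t₂ , v₁ , v₂ , ev₁ , ev₂ , e , g | t₃ , e′ , ev₃
        with unions-add (cz ∘ suc) (constants φ ++ loops φ) (S , S∈ , ev₂)
               (unions-single (cz ∘ suc) (constants φ ++ loops φ)
                 (∈-++⁺ʳ (constants φ) (loops⁺ {φ = φ} M∈ (≡-subst (T ∘ notᵇ) (≡-sym eq) tt))) ev₃)
      ... | S′ , S′∈ , ev₄ = inj₂ (k ++ S′ , least⁺ k∈ S′∈
          , eval-resp (trans (sym (+-assoc _ _ _)) (sym (trans e′ (+-congʳ e))))
              (λ j → trans (sym (+-assoc _ _ _)) (sym (trans (f j) (+-congʳ (g j))))) (eval-++ ev₁ ev₄))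

  module _ {N} {Z : Fin (suc N) → Coned} (cz : Cones Z) where

    private
      Z′ = Z ∘ suc
      cz′ = cz ∘ suc

      weighted : Vect (suc N) → ℝ → Vect N → Vect N
      weighted c s q = (s * c zero) ⊙ q ⊕ s ⊙ (c ∘ suc)

      insertPt-weighted : ∀ c s q → s ⊙ insertPt c q ≋ weighted c s q
      insertPt-weighted c s q ω = trans (distribˡ _ _ _) (+-congʳ (sym (*-assoc _ _ _)))

    row-constant : ∀ {c} m {t v} → c zero ≈ 0# → Eval Z′ (map (insertPt c) m) t v → act (t ⊙ (c ∘ suc)) Z′ v
    row-constant [] c≈0 (nil e f) = act-resp cz′ ≋-refl (≋-sym f) (act-zero cz′ λ ω → trans (*-congʳ e) (zeroˡ _))
    row-constant {c} (q ∷ m) c≈0 (cons {s = s} {t′ = t′} 0<s a ev e f) =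
      act-resp cz′ (λ ω → trans (+-cong
          (trans (insertPt-weighted c s q ω)
            (trans (+-congʳ (trans (*-congʳ (trans (*-congˡ c≈0) (zeroʳ s))) (zeroˡ _))) (+-identityˡ _))) refl)
          (trans (sym (distribʳ (c (suc ω)) s t′)) (*-congʳ (sym e))))
        (≋-sym f) (act-add cz′ a (row-constant {c} m c≈0 ev))

    -- Each factor λq + E of the row is divided into its part in q and its part in E; the latter are
    -- collected into one element, since E is convex.
    row-split : ∀ {c m t v} → Convex c → All Convex m → 0# < c zero → Eval Z′ (map (insertPt c) m) t v →
                ∃[ y ] ∃[ u ] (act (t ⊙ (c ∘ suc)) Z′ u × Eval Z′ m (t * c zero) y × v ≋ y ⊕ u)
    row-split {m = []} cv cvs 0<c (nil e f) = 0v , 0v , act-zero cz′ (λ ω → trans (*-congʳ e) (zeroˡ _))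
      , nil (trans (*-congʳ e) (zeroˡ _)) ≋-refl , ≋-trans f (0⊕ ≋-refl)
    row-split {c} {q ∷ m} cv (qv ∷ cvs) 0<c (cons {s = s} {t′ = t′} 0<s a ev e f)
      with row-split {c} cv cvs 0<c ev | act-split {g = (s * c zero) ⊙ q} cz′
             (λ ω → *-nonNeg (<⇒≤ (0<-* 0<s 0<c)) (proj₁ qv ω)) (λ ω → *-nonNeg (<⇒≤ 0<s) (proj₁ cv (suc ω)))
             (act-resp cz′ (insertPt-weighted c s q) ≋-refl a)
    ... | y , u , b , ev′ , g | y₁ , u₁ , b₁ , b₂ , g₁ = y₁ ⊕ y , u₁ ⊕ u
      , act-resp cz′ (λ ω → trans (sym (distribʳ (c (suc ω)) s t′)) (*-congʳ (sym e))) ≋-refl (act-add cz′ b₂ b)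
      , cons (0<-* 0<s 0<c) b₁ ev′ (trans (*-congʳ e) (distribʳ _ _ _)) ≋-refl
      , ≋-trans f (≋-trans (⊕-cong g₁ g) (⊕-interchange y₁ u₁ y u))

    -- With coefficient 0 the share in `m` has weight 0, which no nonempty join attains; the apex of
    -- `Hull` stands in for it.
    row⁻ : ∀ {c m t v} → Convex c → All Convex m → Eval Z′ (map (insertPt c) m) t v →
           ∃[ y ] ∃[ u ] (act (t ⊙ (c ∘ suc)) Z′ u × Hull (m ∷ []) Z′ (t * c zero) y × v ≋ y ⊕ u)
    row⁻ {c} {m} cv cvs ev with 0≤⇒0≈⊎0< (proj₁ cv zero)
    ... | inj₁ c≈0 = 0v , _ , row-constant {c} m c≈0 ev , inj₁ (trans (*-congˡ c≈0) (zeroʳ _) , ≋-refl) , 0⊕ ≋-refl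
    ... | inj₂ 0<c with row-split {c} cv cvs 0<c ev
    ... | y , u , a , ev′ , f = y , u , a , inj₂ (m , here ≡-refl , ev′) , f

    insert⁻ : ∀ {M m t v} → All Convex M → All Convex m → NonEmpty m → Eval Z′ (insert M m) t v →
              ∃[ a ] ∃[ y ] ∃[ r ] (Rest Z′ M t a r × Hull (m ∷ []) Z′ a y × v ≋ y ⊕ r)
    insert⁻ {[]} _ _ _ (nil e f) = 0# , 0v , 0v , nil e refl ≋-refl , inj₁ (refl , ≋-refl) , ≋-trans f (0⊕ ≋-refl)
    insert⁻ {c ∷ M} {m@(_ ∷ _)} (cv ∷ cvs) gm ne ev with eval-++⁻ (map (insertPt c) m) ev
    ... | t₁ , t₂ , v₁ , v₂ , ev₁ , ev₂ , e , f with row⁻ {c} cv gm ev₁ | insert⁻ cvs gm ne ev₂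
    ... | y , u , a , h , g | a′ , y′ , r′ , rest , h′ , g′ = _ , y ⊕ y′ , u ⊕ r′
      , cons (eval-cons-positive ev₁) a rest e refl ≋-refl , add (single-isCone cz′) h h′
      , ≋-trans f (≋-trans (⊕-cong g g′) (⊕-interchange y u y′ r′))

    -- All factors of the row use the same point `u` of the remaining summands, each in proportion
    -- to its weight.
    row⁺ : ∀ {c m t x u} → Convex c → act (c ∘ suc) Z′ u → Eval Z′ m t x →
           Eval Z′ (map (insertPt c) m) t (c zero ⊙ x ⊕ t ⊙ u)
    row⁺ cv a (nil e f) = nil e (≋-trans (⊕-identityˡ (⊙-zeroʳ _ f)) λ j → trans (*-congʳ e) (zeroˡ _))
    row⁺ {c} {q ∷ m} {u = u} cv a (cons {s = s} {w} {t′} {x′} 0<s b ev e f) = cons 0<s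
      (act-resp cz′ (λ ω → trans (+-congʳ (trans (sym (*-assoc _ _ _)) (*-congʳ (*-comm _ _))))
        (sym (insertPt-weighted c s q ω))) ≋-refl
        (act-add cz′ scaled (act-scale cz′ 0<s a)))
      (row⁺ cv a ev) e
      (λ j → trans (+-cong (*-congˡ (f j)) (*-congʳ e))
        (solve 6 (λ c w x s t u → c :* (w :+ x) :+ (s :+ t) :* u := (c :* w :+ s :* u) :+ (c :* x :+ t :* u))
          refl (c zero) (w j) (x′ j) s t′ (u j)))
      where
      scaled : act (c zero ⊙ (s ⊙ q)) Z′ (c zero ⊙ w)
      scaled with 0≤⇒0≈⊎0< (proj₁ cv zero)
      ... | inj₁ c≈0 = act-resp cz′ ≋-refl (λ j → sym (trans (*-congʳ c≈0) (zeroˡ _)))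
                         (act-zero cz′ λ ω → trans (*-congʳ c≈0) (zeroˡ _))
      ... | inj₂ 0<c = act-scale cz′ 0<c b

    -- The point `x` of `m` is normalised to weight 1, so that each factor can use the multiple of
    -- it that its coefficient demands.
    insert⁺ : ∀ {M m t a r x} → All Convex M → Eval Z′ m 1# x → Rest Z′ M t a r → Eval Z′ (insert M m) t (a ⊙ x ⊕ r)
    insert⁺ _ ev (nil e f g) = nil e (≋-trans (⊕-identityˡ λ j → trans (*-congʳ f) (zeroˡ _)) g)
    insert⁺ {c ∷ M} {x = x} (cv ∷ cvs) ev (cons {s = s} {u} {t′} {a′} {r′} 0<s b rest e f g) =
      eval-resp (trans (+-congʳ (*-identityʳ s)) (sym e))
        (λ j → trans (+-congʳ (*-congˡ (+-congˡ (*-identityˡ _)))) (trans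
          (solve 7 (λ s i c x u a r → s :* (c :* x :+ i :* u) :+ (a :* x :+ r) := (s :* c :+ a) :* x :+
            ((i :* s) :* u :+ r))
            refl s (s ⁻¹) (c zero) (x j) (u j) a′ (r′ j))
          (+-cong (*-congʳ (sym f)) (trans (+-congʳ (trans (*-congʳ (⁻¹-inverseˡ (0<⇒≉0 0<s))) (*-identityˡ _)))
            (sym (g j))))))
        (eval-++ (eval-scale cz′ 0<s (row⁺ cv unscaled ev)) (insert⁺ cvs ev rest))
      where
      unscaled : act (c ∘ suc) Z′ (s ⁻¹ ⊙ u)
      unscaled = act-resp cz′ (λ ω → ⁻¹-cancelˡ 0<s _) ≋-refl
        (act-scale cz′ (0<-⁻¹ 0<s) b)

    module _ {ψ : Poly N} where

      substMonomial⁻ : ∀ {M t v} → All Good ψ → Good M → (∀ {t v} → Hull ψ Z′ t v → Z zero t v) →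
                       ⟦ substMonomial ψ M ⟧ᴾ Z′ t v → Eval Z M t v
      substMonomial⁻ {M} gψ gM below (M₁ , M₁∈ , ev) with constant? M in eq
      substMonomial⁻ {M} gψ gM below (_ , here ≡-refl , ev) | true with tails⇒rest M ev
      ... | a , rest = eval-resp refl (⊕-identityˡ ≋-refl) (close-eval cz (proj₂ gM) rest
        (zero-∈′ (cz zero) (rest-constant (constant⁻ M (proj₂ gM) (≡-subst T (≡-sym eq) tt)) rest) ≋-refl))
      substMonomial⁻ {M} gψ gM below (M₁ , M₁∈ , ev) | false with ∈-map⁻ (insert M) M₁∈
      ... | m , m∈ , ≡-refl with All.lookup gψ m∈
      ... | ne , cvs with insert⁻ (proj₂ gM) cvs ne ev
      ... | a , y , r , rest , h , f = eval-resp refl (≋-sym f) (close-eval cz (proj₂ gM) rest (below (included h)))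
        where
        included : ∀ {t v} → Hull (m ∷ []) Z′ t v → Hull ψ Z′ t v
        included (inj₁ p)                     = inj₁ p
        included (inj₂ (_ , here ≡-refl , ev)) = inj₂ (m , m∈ , ev)

      substMonomial⁺ : ∀ {M t v} → Good M → (∀ {t v} → Z zero t v → Hull ψ Z′ t v) →
                       Eval Z M t v → ⟦ substMonomial ψ M ⟧ᴾ Z′ t v
      substMonomial⁺ {M} gM above ev with constant? M in eq | open-eval cz ev
      ... | true | a , y , r , rest , z , f = _ , here ≡-refl , eval-resp refl
        (≋-sym (≋-trans f (⊕-identityˡ
          (vanish (cz zero) (rest-constant (constant⁻ M (proj₂ gM) (≡-subst T (≡-sym eq) tt)) rest) z))))
        (rest⇒tails rest)
      ... | false | a , y , r , rest , z , f with above z | rest-positive (proj₂ gM)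
          (nonconstant⁻ M (≡-subst (T ∘ notᵇ) (≡-sym eq) tt)) rest
      ... | inj₁ (a≈0 , _)     | 0<a = ⊥-elim (0<⇒≉0 0<a a≈0)
      ... | inj₂ (m , m∈ , ev₀) | 0<a = insert M m , ∈-map⁺ (insert M) m∈ , eval-resp refl
        (λ j → trans (+-congʳ (⁻¹-cancelʳ 0<a _)) (sym (f j)))
        (insert⁺ (proj₂ gM) (eval-resp (⁻¹-inverseˡ (0<⇒≉0 0<a)) ≋-refl (eval-scale cz′ (0<-⁻¹ 0<a) ev₀)) rest)

      -- One inclusion between `ψ` and the variable is assumed, because minimality in `leastCones`
      -- applies this to an arbitrary closed family, of which `ψ` gives merely a lower bound.
      subst⁻ : ∀ {φ t v} → All Good ψ → All Good φ → (∀ {t v} → Hull ψ Z′ t v → Z zero t v) →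
               ⟦ subst ψ φ ⟧ᴾ Z′ t v → ⟦ φ ⟧ᴾ Z t v
      subst⁻ {φ} gψ gφ below (M₁ , M₁∈ , ev) with find (∈-concatMap⁻ (substMonomial ψ) {xs = φ} M₁∈)
      ... | M , M∈ , M₁∈′ = M , M∈ , substMonomial⁻ gψ (All.lookup gφ M∈) below (M₁ , M₁∈′ , ev)

      subst⁺ : ∀ {φ t v} → All Good φ → (∀ {t v} → Z zero t v → Hull ψ Z′ t v) →
               ⟦ φ ⟧ᴾ Z t v → ⟦ subst ψ φ ⟧ᴾ Z′ t v
      subst⁺ {φ} gφ above (M , M∈ , ev) with substMonomial⁺ (All.lookup gφ M∈) above ev
      ... | M₁ , M₁∈ , ev₁ = M₁ , ∈-concatMap⁺ (substMonomial ψ) (lose M∈ M₁∈) , ev₁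

  Closed : ∀ {K N} → (Fin K → Poly (K +ᴺ N)) → (Fin N → Coned) → (Fin K → Coned) → Set
  Closed Φ C X = ∀ i {t v} → ⟦ Φ i ⟧ᴾ (append X C) t v → X i t v

  append-cones : ∀ {K N} {X : Fin K → Coned} {C : Fin N → Coned} → Cones X → Cones C → Cones (append X C)
  append-cones {K = zero}  cx cc i       = cc i
  append-cones {K = suc K} cx cc zero    = cx zero
  append-cones {K = suc K} cx cc (suc i) = append-cones (cx ∘ suc) cc i

  append-mono : ∀ {K N} {X Y : Fin K → Coned} {C : Fin N → Coned} → (∀ i {t v} → X i t v → Y i t v) →
                ∀ i {t v} → append X C i t v → append Y C i t v
  append-mono {K = zero}  f i       p = p
  append-mono {K = suc K} f zero    p = f zero p
  append-mono {K = suc K} f (suc i) p = append-mono (f ∘ suc) i p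

  -- The induction replaces the query `χ` by `subst ψ χ`, hence `sound` and `complete` have to speak
  -- about all queries.
  record LeastCones {K N} (Φ : Fin K → Poly (K +ᴺ N)) (C : Fin N → Coned) : Set₁ where
    field
      X       : Fin K → Coned
      isCone  : Cones X
      closed  : Closed Φ C X
      below   : ∀ Y → Cones Y → Closed Φ C Y → ∀ i {t v} → X i t v → Y i t v
      sound   : ∀ χ → All Good χ → ∀ {t v} → ⟦ eliminate K Φ χ ⟧ᴾ C t v → ⟦ χ ⟧ᴾ (append X C) t v
      complete : ∀ χ → All Good χ → ∀ {t v} → ⟦ χ ⟧ᴾ (append X C) t v → ⟦ eliminate K Φ χ ⟧ᴾ C t v
      good    : ∀ χ → All Good χ → All Good (eliminate K Φ χ)

  -- Bekić's rule for nested least fixed points. If `Y` is closed, its first component contains `ψ`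
  -- evaluated at its tail, so its tail is closed under the substituted system; minimality of the
  -- tail then gives minimality of the first component by monotonicity.
  leastCones : ∀ K {N} (Φ : Fin K → Poly (K +ᴺ N)) → (∀ i → All Good (Φ i)) → (C : Fin N → Coned) → Cones C
      → LeastCones Φ C
  leastCones zero    Φ gΦ C cC = record
    { X = λ () ; isCone = λ () ; closed = λ () ; below = λ _ _ _ ()
    ; sound = λ _ _ p → p ; complete = λ _ _ p → p ; good = λ _ g → g }
  leastCones (suc K) {N} Φ gΦ C cC = record
    { X        = X
    ; isCone   = isCone
    ; closed   = closed
    ; below    = below
    ; sound    = λ χ gχ p → subst⁻ cZ gψ gχ id (IH.sound (subst ψ χ) (subst-good gψ gχ) p)
    ; complete = λ χ gχ p → IH.complete (subst ψ χ) (subst-good gψ gχ) (subst⁺ cZ gχ id p)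
    ; good     = λ χ gχ → IH.good (subst ψ χ) (subst-good gψ gχ)
    }
    where
    ψ = least (Φ zero)
    gψ = least-good (gΦ zero)

    module IH = LeastCones (leastCones K (subst ψ ∘ Φ ∘ suc) (λ i → subst-good gψ (gΦ (suc i))) C cC)

    cZ′ : Cones (append IH.X C)
    cZ′ = append-cones IH.isCone cC

    X : Fin (suc K) → Coned
    X zero    = Hull ψ (append IH.X C)
    X (suc i) = IH.X i

    isCone : Cones X
    isCone zero    = least-isCone {φ = Φ zero} cZ′
    isCone (suc i) = IH.isCone i

    cZ : Cones (append X C)
    cZ = append-cones isCone cC

    closed : Closed Φ C X
    closed zero    (M , M∈ , ev) = least-closed {φ = Φ zero} (gΦ zero) cZ id M∈ ev
    closed (suc i) p             = IH.closed i (subst⁺ cZ (gΦ (suc i)) id p)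

    below : ∀ Y → Cones Y → Closed Φ C Y → ∀ i {t v} → X i t v → Y i t v
    below Y cY closedY = go
      where
      cZY : Cones (append Y C)
      cZY = append-cones cY cC

      ψ-below : ∀ {t v} → Hull ψ (append (Y ∘ suc) C) t v → Y zero t v
      ψ-below = least-below (gΦ zero) cZY λ M∈ ev → closedY zero (_ , M∈ , ev)

      tail-below : ∀ i {t v} → IH.X i t v → Y (suc i) t v
      tail-below = IH.below (Y ∘ suc) (cY ∘ suc) λ i p → closedY (suc i) (subst⁻ cZY gψ (gΦ (suc i)) ψ-below p)

      go : ∀ i {t v} → X i t v → Y i t v
      go zero    p = ψ-below (Hull-mono {φ = ψ} (append-mono tail-below) p)
      go (suc i) p = tail-below i p

-- Passage between vectors and their coordinates.

module Coordinates (R : Reals) (𝕍 : FiniteDimensional R) where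
  open import Data.Fin.Base using (zero; suc)
  open import Data.Nat.Base using (zero; suc)
  open Reals R hiding (zero)
  open FiniteDimensional 𝕍
  open Vectors R
  open CommutativeMonoidSum +ᴹ-commutativeMonoid using () renaming (sum-cong-≋ to sumᴹ-cong; ∑-distrib-+ to sumᴹ-+)

  lin : Vect dim → V
  lin w = sumᴹ (λ j → w j *ₗ basis j)

  sumᴹ-* : ∀ {k} s (f : Fin k → V) → sumᴹ (λ i → s *ₗ f i) ≈ᴹ s *ₗ sumᴹ f
  sumᴹ-* {zero}  s f = ≈ᴹ-sym (*ₗ-zeroʳ s)
  sumᴹ-* {suc k} s f = ≈ᴹ-trans (+ᴹ-congˡ (sumᴹ-* s (f ∘ suc))) (≈ᴹ-sym (*ₗ-distribˡ s _ _))

  expand : Vect dim → Fin dim → V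
  expand w j = w j *ₗ basis j

  coord-lin : ∀ w → coord (lin w) ≋ w
  coord-lin w j = sym (coord-unique (lin w) w ≈ᴹ-refl j)

  coord-cong : ∀ {v w} → v ≈ᴹ w → coord v ≋ coord w
  coord-cong {v} {w} e = coord-unique w (coord v) (≈ᴹ-trans (≈ᴹ-sym e) (coord-expand v))

  coord-injective : ∀ {v w} → coord v ≋ coord w → v ≈ᴹ w
  coord-injective {v} {w} e = ≈ᴹ-trans (coord-expand v)
    (≈ᴹ-trans (sumᴹ-cong {x = expand (coord v)} {expand (coord w)} λ j → *ₗ-congʳ (e j)) (≈ᴹ-sym (coord-expand w)))

  coord-+ : ∀ v w → coord (v +ᴹ w) ≋ coord v ⊕ coord w
  coord-+ v w j = sym (coord-unique (v +ᴹ w) (coord v ⊕ coord w)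
    (≈ᴹ-trans (+ᴹ-cong (coord-expand v) (coord-expand w))
      (≈ᴹ-trans (≈ᴹ-sym (sumᴹ-+ (expand (coord v)) (expand (coord w))))
      (sumᴹ-cong {y = expand (coord v ⊕ coord w)} λ j → ≈ᴹ-sym (*ₗ-distribʳ (basis j) (coord v j) (coord w j))))) j)

  coord-* : ∀ s v → coord (s *ₗ v) ≋ s ⊙ coord v
  coord-* s v j = sym (coord-unique (s *ₗ v) (s ⊙ coord v)
    (≈ᴹ-trans (*ₗ-congˡ (coord-expand v)) (≈ᴹ-trans (≈ᴹ-sym (sumᴹ-* s (expand (coord v))))
      (sumᴹ-cong {y = expand (s ⊙ coord v)} λ j → ≈ᴹ-sym (*ₗ-assoc s (coord v j) (basis j))))) j)

  coord-0 : coord 0ᴹ ≋ 0v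
  coord-0 j = trans (coord-cong (≈ᴹ-sym (*ₗ-zeroˡ 0ᴹ)) j) (trans (coord-* 0# 0ᴹ j) (zeroˡ _))

  coord-mix : ∀ t v w → coord (t *ₗ v +ᴹ (1# - t) *ₗ w) ≋ t ⊙ coord v ⊕ (1# - t) ⊙ coord w
  coord-mix t v w = ≋-trans (coord-+ _ _) (⊕-cong (coord-* t v) (coord-* (1# - t) w))

-- From subsets of V to cones.

module Reduction (R : Reals) (𝕍 : FiniteDimensional R) (dec : ∀ (P : Set) → Dec P) where
  open import Data.Fin.Base using (zero; suc)
  open import Data.Nat.Base using (zero; suc)
  open OrderedField R
  open Reals R hiding (zero)
  open FiniteDimensional 𝕍 using (V; dim; coord; _≈ᴹ_; ≈ᴹ-refl; ≈ᴹ-sym; ≈ᴹ-trans; _*ₗ_; _+ᴹ_)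
  open Vectors R
  open Cones R dim
  open IsCone
  open Elimination (arithmetic R)
  open LeastSolution R dec dim
  open Coordinates R 𝕍
  open Semantics R 𝕍 hiding (⟦_⟧; eval-mono)
  open SemiringSum semiring using (sum-replicate-zero)

  -- Generated by binary mixing, not by finite combinations as in `convexHull`: an affine map then
  -- acts on it by induction.
  data Conv (S : Subset) : Vect dim → Set where
    base : ∀ {x w} → S x → w ≋ coord x → Conv S w
    mix  : ∀ {a b w} t → 0# ≤ t → t ≤ 1# → Conv S a → Conv S b → w ≋ t ⊙ a ⊕ (1# - t) ⊙ b → Conv S w

  Conv-resp : ∀ {S w w′} → w ≋ w′ → Conv S w → Conv S w′
  Conv-resp p (base s e)           = base s (≋-trans (≋-sym p) e)
  Conv-resp p (mix t q r ca cb e) = mix t q r ca cb (≋-trans (≋-sym p) e)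

  Conv-mono : ∀ {S T w} → S ⊆ T → Conv S w → Conv T w
  Conv-mono f (base s e)           = base (f s) e
  Conv-mono f (mix t q r ca cb e) = mix t q r (Conv-mono f ca) (Conv-mono f cb) e

  Conv-convex : ∀ {S w v} → IsConvex S → Conv S w → coord v ≋ w → S v
  Conv-convex cS (base s e) p = proj₁ cS (coord-injective (≋-sym (≋-trans p e))) s
  Conv-convex cS (mix {a} {b} t q r ca cb e) p = proj₁ cS
    (coord-injective (≋-trans (coord-mix t (lin a) (lin b)) (≋-trans
      (⊕-cong (⊙-cong refl (coord-lin a)) (⊙-cong refl (coord-lin b))) (≋-sym (≋-trans p e)))))
    (proj₂ cS t q r (Conv-convex cS ca (coord-lin a)) (Conv-convex cS cb (coord-lin b)))

  Affine : (Vect dim → Vect dim) → Set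
  Affine F = ∀ t a b → F (t ⊙ a ⊕ (1# - t) ⊙ b) ≋ t ⊙ F a ⊕ (1# - t) ⊙ F b

  -- Used in one argument at a time. Minkowski sum, join and multiples are affine in each argument
  -- separately, so they carry hulls to hulls.
  Conv-map : ∀ {S T} (F : Vect dim → Vect dim) → (∀ {a b} → a ≋ b → F a ≋ F b) → Affine F →
             (∀ {x} → S x → Conv T (F (coord x))) → ∀ {w} → Conv S w → Conv T (F w)
  Conv-map F F-cong aff f (base s e)           = Conv-resp (≋-sym (F-cong e)) (f s)
  Conv-map F F-cong aff f (mix t q r ca cb e) =
    mix t q r (Conv-map F F-cong aff f ca) (Conv-map F F-cong aff f cb) (≋-trans (F-cong e) (aff t _ _))

  Conv-⊞ : ∀ {S T a b} → Conv S a → Conv T b → Conv (S ⊞ T) (a ⊕ b)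
  Conv-⊞ {S} {T} {a} {b} ca cb = Conv-map (_⊕ b) (λ e → ⊕-cong e ≋-refl)
    (λ t a a′ j → solve 4 (λ t a a′ b → t :* a :+ (:1 :- t) :* a′ :+ b := t :* (a :+ b) :+ (:1 :- t) :* (a′ :+ b))
      refl t (a j) (a′ j) (b j))
    (λ {x} s → Conv-map (coord x ⊕_) (⊕-cong ≋-refl)
      (λ t b b′ j → solve 4 (λ t b b′ x → x :+ (t :* b :+ (:1 :- t) :* b′) := t :* (x :+ b) :+ (:1 :- t) :*
        (x :+ b′)) refl t (b j) (b′ j) (coord x j))
      (λ {y} s′ → base (x , y , s , s′ , ≈ᴹ-refl) (≋-sym (coord-+ x y))) cb) ca

  Conv-⋆ : ∀ {S T a b} t → 0# < t → t < 1# → Conv S a → Conv T b → Conv (S ⋆ T) (t ⊙ a ⊕ (1# - t) ⊙ b)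
  Conv-⋆ {S} {T} {a} {b} t 0<t t<1 ca cb = Conv-map (λ a → t ⊙ a ⊕ (1# - t) ⊙ b) (λ e → ⊕-cong (⊙-cong refl e) ≋-refl)
    (λ r a a′ j → solve 5 (λ r a a′ b t → t :* (r :* a :+ (:1 :- r) :* a′) :+ (:1 :- t) :* b :=
        r :* (t :* a :+ (:1 :- t) :* b) :+ (:1 :- r) :* (t :* a′ :+ (:1 :- t) :* b)) refl r (a j) (a′ j) (b j) t)
    (λ {x} s → Conv-map (λ b → t ⊙ coord x ⊕ (1# - t) ⊙ b) (λ e → ⊕-cong ≋-refl (⊙-cong refl e))
      (λ r b b′ j → solve 5 (λ r b b′ a t → t :* a :+ (:1 :- t) :* (r :* b :+ (:1 :- r) :* b′) :=
        r :* (t :* a :+ (:1 :- t) :* b) :+ (:1 :- r) :* (t :* a :+ (:1 :- t) :* b′)) refl r (b j) (b′ j) (coord x j) t)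
      (λ {y} s′ → base (t , x , y , 0<t , t<1 , s , s′ , ≈ᴹ-refl) (≋-sym (coord-mix t x y))) cb) ca

  Conv-· : ∀ {S a} ρ → Conv S a → Conv (ρ · S) (ρ ⊙ a)
  Conv-· ρ = Conv-map (ρ ⊙_) (⊙-cong refl)
    (λ t a b j → solve 4 (λ ρ t a b → ρ :* (t :* a :+ (:1 :- t) :* b) := t :* (ρ :* a) :+ (:1 :- t) :* (ρ :* b))
      refl ρ t (a j) (b j))
    (λ {x} s → base (x , s , ≈ᴹ-refl) (≋-sym (coord-* ρ x)))

  -- The hull is built in, so that the construction applies to parameters as well as to solutions.
  coneOver : Subset → Coned
  coneOver S = pointed λ t w → 0# < t × ∃[ z ] (Conv S z × w ≋ t ⊙ z)

  weight-ratio : ∀ {s t} → 0# < s + t → 1# - s * (s + t) ⁻¹ ≈ t * (s + t) ⁻¹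
  weight-ratio {s} {t} 0<r = trans (+-congʳ (sym (⁻¹-inverseʳ (0<⇒≉0 0<r))))
    (solve 3 (λ s t i → (s :+ t) :* i :- s :* i := t :* i) refl s t ((s + t) ⁻¹))

  ratio≤1 : ∀ {s t} → 0# ≤ t → 0# < s + t → s * (s + t) ⁻¹ ≤ 1#
  ratio≤1 0≤t 0<r = 0≤y-x⇒x≤y (≤-respʳ (sym (weight-ratio 0<r)) (*-nonNeg 0≤t (<⇒≤ (0<-⁻¹ 0<r))))

  ratio<1 : ∀ {s t} → 0# < t → 0# < s + t → s * (s + t) ⁻¹ < 1#
  ratio<1 0<t 0<r = 0<y-x⇒x<y (<-respʳ (sym (weight-ratio 0<r)) (0<-* 0<t (0<-⁻¹ 0<r)))

  -- Translates between sums of weighted points and convex mixtures: the ratio is the share of `s`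
  -- in the total weight.
  weighted-mix : ∀ {s t} → 0# < s + t → ∀ (x y : Vect dim) →
                 s ⊙ x ⊕ t ⊙ y ≋ (s + t) ⊙ ((s * (s + t) ⁻¹) ⊙ x ⊕ (1# - s * (s + t) ⁻¹) ⊙ y)
  weighted-mix {s} {t} 0<r x y j = sym (trans (*-congˡ (+-congˡ (*-congʳ (weight-ratio 0<r))))
    (trans (solve 6 (λ r s t i x y → r :* (s :* i :* x :+ t :* i :* y) := (r :* i) :* (s :* x :+ t :* y)) refl
      (s + t) s t ((s + t) ⁻¹) (x j) (y j))
      (trans (*-congʳ (⁻¹-inverseʳ (0<⇒≉0 0<r))) (*-identityˡ _))))

  coneOver-isCone : ∀ S → IsCone (coneOver S)
  coneOver-isCone S = pointed-isCone
    (λ p q (0<t , z , c , e) → <-respʳ p 0<t , z , c , ≋-trans (≋-sym q) (≋-trans e (⊙-cong p ≋-refl)))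
    (λ {t} {t′} (0<t , z , c , g) (0<t′ , z′ , c′ , g′) → let 0<r = 0<-+ˡ 0<t (<⇒≤ 0<t′) in 0<r , _
      , mix (t * (t + t′) ⁻¹) (*-nonNeg (<⇒≤ 0<t) (<⇒≤ (0<-⁻¹ 0<r))) (ratio≤1 (<⇒≤ 0<t′) 0<r) c c′ ≋-refl
      , ≋-trans (⊕-cong g g′) (weighted-mix 0<r z z′))
    (λ 0<s (0<t , z , c , g) → 0<-* 0<s 0<t , z , c , λ j → trans (*-congˡ (g j)) (sym (*-assoc _ _ _)))
    (λ (0<t , _) → inj₁ 0<t)

  coneOver-mono : ∀ {S T} → S ⊆ T → ∀ {t w} → coneOver S t w → coneOver T t w
  coneOver-mono f (inj₁ p)                 = inj₁ p
  coneOver-mono f (inj₂ (0<t , z , c , g)) = inj₂ (0<t , z , Conv-mono f c , g)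

  coneOver-base : ∀ {S v} → S v → coneOver S 1# (coord v)
  coneOver-base s = inj₂ (0<1 , _ , base s ≋-refl , λ j → sym (*-identityˡ _))

  coneOver-convex : ∀ {S v} → IsConvex S → coneOver S 1# (coord v) → S v
  coneOver-convex cS (inj₁ (e , _))           = ⊥-elim (0<⇒≉0 0<1 e)
  coneOver-convex cS (inj₂ (_ , z , c , e)) = Conv-convex cS c (≋-trans e λ j → *-identityˡ _)

  cone-mix : ∀ {K a b} → IsCone K → ∀ t → 0# ≤ t → t ≤ 1# → K 1# a → K 1# b → K 1# (t ⊙ a ⊕ (1# - t) ⊙ b)
  cone-mix {K} {a} {b} cK t 0≤t t≤1 ka kb = resp cK (solve 1 (λ t → t :* :1 :+ (:1 :- t) :* :1 := :1) refl t) ≋-refl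
    (add cK (scale₀ 0≤t ka) (scale₀ (x≤y⇒0≤y-x t≤1) kb))
    where
    scale₀ : ∀ {s x} → 0# ≤ s → K 1# x → K (s * 1#) (s ⊙ x)
    scale₀ 0≤s k with 0≤⇒0≈⊎0< 0≤s
    ... | inj₁ s≈0 = zero-∈′ cK (trans (*-congʳ s≈0) (zeroˡ _)) (λ j → trans (*-congʳ s≈0) (zeroˡ _))
    ... | inj₂ 0<s = scale cK 0<s k

  Conv-below : ∀ {K S} → IsCone K → (∀ {x} → S x → K 1# (coord x)) → ∀ {w} → Conv S w → K 1# w
  Conv-below cK f (base s e)           = resp cK refl (≋-sym e) (f s)
  Conv-below cK f (mix t q r ca cb e) = resp cK refl (≋-sym e)
      (cone-mix cK t q r (Conv-below cK f ca) (Conv-below cK f cb))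

  coneOver-below : ∀ {K S} → IsCone K → (∀ {x} → S x → K 1# (coord x)) → ∀ {t w} → coneOver S t w → K t w
  coneOver-below cK f (inj₁ (e , g))           = zero-∈′ cK e g
  coneOver-below cK f (inj₂ (0<t , z , c , g)) = resp cK (*-identityʳ _) (≋-sym g) (scale cK 0<t (Conv-below cK f c))

  append-⊙ : ∀ {K N} s (f : Vect K) (g : Vect N) → s ⊙ append f g ≋ append (s ⊙ f) (s ⊙ g)
  append-⊙ {zero}  s f g i       = refl
  append-⊙ {suc K} s f g zero    = refl
  append-⊙ {suc K} s f g (suc i) = append-⊙ s (f ∘ suc) g i

  sum-append : ∀ {K N} (f : Vect K) (g : Vect N) → sum (append f g) ≈ sum f + sum g
  sum-append {zero}  f g = sym (+-identityˡ _)
  sum-append {suc K} f g = trans (+-congˡ (sum-append (f ∘ suc) g)) (sym (+-assoc _ _ _))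

  append-nonNeg : ∀ {K N} (f : Vect K) (g : Vect N) → (∀ i → 0# ≤ f i) → (∀ i → 0# ≤ g i) → ∀ i → 0# ≤ append f g i
  append-nonNeg {zero}  f g p q i       = q i
  append-nonNeg {suc K} f g p q zero    = p zero
  append-nonNeg {suc K} f g p q (suc i) = append-nonNeg (f ∘ suc) g (p ∘ suc) q i

  act-append⁺ : ∀ {K N} {f : Vect K} {g : Vect N} {X C u v} → act f X u → act g C v → act (append f g) (append X C)
      (u ⊕ v)
  act-append⁺ {zero} {C = C} a b = act-≋ C (0⊕ a) b
  act-append⁺ {suc K} (y , u , z , a , e) b = y , _ , z , act-append⁺ a b , λ j → trans (+-congʳ (e j)) (+-assoc _ _ _)

  act-append⁻ : ∀ {K N} (f : Vect K) {g : Vect N} {X C w} → act (append f g) (append X C) w →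
                ∃[ u ] ∃[ v ] (act f X u × act g C v × w ≋ u ⊕ v)
  act-append⁻ {zero}  f a = 0v , _ , ≋-refl , a , 0⊕ ≋-refl
  act-append⁻ {suc K} f (y , w , z , a , e) with act-append⁻ (f ∘ suc) a
  ... | u , v , a₁ , a₂ , g = y ⊕ u , v , (y , u , z , a₁ , ≋-refl) , a₂ , λ j → trans (e j)
      (trans (+-congˡ (g j)) (sym (+-assoc _ _ _)))

  module _ {K N} {X : Fin K → Coned} {Z : Fin N → Coned} (f : Vect K → Vect N) where

    map-points⁺ : (∀ s c {u} → act (s ⊙ c) X u → act (s ⊙ f c) Z u) →
                  ∀ {φ t v} → ⟦ φ ⟧ᴾ X t v → ⟦ map (map f) φ ⟧ᴾ Z t v
    map-points⁺ h (M , M∈ , ev) = _ , ∈-map⁺ _ M∈ , go ev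
      where
      go : ∀ {M t v} → Eval X M t v → Eval Z (map f M) t v
      go (nil e g)           = nil e g
      go (cons 0<s a ev e g) = cons 0<s (h _ _ a) (go ev) e g

    map-points⁻ : (∀ s c {u} → act (s ⊙ f c) Z u → act (s ⊙ c) X u) →
                  ∀ {φ t v} → ⟦ map (map f) φ ⟧ᴾ Z t v → ⟦ φ ⟧ᴾ X t v
    map-points⁻ h (_ , M∈ , ev) with ∈-map⁻ _ M∈
    ... | M , M∈′ , ≡-refl = M , M∈′ , go M ev
      where
      go : ∀ M {t v} → Eval Z (map f M) t v → Eval X M t v
      go []      (nil e g)           = nil e g
      go (c ∷ M) (cons 0<s a ev e g) = cons 0<s (h _ c a) (go M ev) e g

  module _ {K N} {X : Fin K → Coned} {C : Fin N → Coned} (cX : Cones X) (cC : Cones C) where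

    private
      cXC = append-cones cX cC

      zeros : ∀ {N} → Vect N
      zeros _ = 0#

    fromLeft⁺ : ∀ {φ : Poly K} {t v} → ⟦ φ ⟧ᴾ X t v → ⟦ fromLeft φ ⟧ᴾ (append X C) t v
    fromLeft⁺ = map-points⁺ (λ c → append c zeros) λ s c a → act-resp cXC (≋-sym (append-⊙ s c zeros))
      (⊕-identityʳ ≋-refl) (act-append⁺ a (act-zero cC (⊙-zeroʳ s ≋-refl)))

    fromLeft⁻ : ∀ {φ : Poly K} {t v} → ⟦ fromLeft φ ⟧ᴾ (append X C) t v → ⟦ φ ⟧ᴾ X t v
    fromLeft⁻ = map-points⁻ (λ c → append c zeros) λ s c a →
      let u , v , a₁ , a₂ , g = act-append⁻ (s ⊙ c) (act-resp cXC (append-⊙ s c zeros) ≋-refl a)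
      in act-≋ X (≋-sym (≋-trans g (⊕-identityʳ (act-vanish cC (⊙-zeroʳ s ≋-refl) a₂)))) a₁

    fromRight⁺ : ∀ {φ : Poly N} {t v} → ⟦ φ ⟧ᴾ C t v → ⟦ fromRight φ ⟧ᴾ (append X C) t v
    fromRight⁺ = map-points⁺ (append zeros) λ s c a → act-resp cXC (≋-sym (append-⊙ s zeros c))
      (⊕-identityˡ ≋-refl) (act-append⁺ (act-zero cX (⊙-zeroʳ s ≋-refl)) a)

    fromRight⁻ : ∀ {φ : Poly N} {t v} → ⟦ fromRight φ ⟧ᴾ (append X C) t v → ⟦ φ ⟧ᴾ C t v
    fromRight⁻ = map-points⁻ (append zeros) λ s c a →
      let u , v , a₁ , a₂ , g = act-append⁻ (s ⊙ zeros) (act-resp cXC (append-⊙ s zeros c) ≋-refl a)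
      in act-≋ C (≋-sym (≋-trans g (⊕-identityˡ (act-vanish cX (⊙-zeroʳ s ≋-refl) a₁)))) a₂

  good-map : ∀ {K N} {f : Vect K → Vect N} {φ} → (∀ {c} → Convex c → Convex (f c)) → All Good φ → All Good
      (map (map f) φ)
  good-map h g = All.map⁺ (All.map (λ (ne , cvs) → nonEmpty-map ne , All.map⁺ (All.map h cvs)) g)

  fromLeft-good : ∀ {K N} {φ : Poly K} → All Good φ → All Good (fromLeft {K} {N} φ)
  fromLeft-good {N = N} = good-map λ {c} (p , e) → append-nonNeg c _ p (λ _ → ≤-refl)
    , trans (sum-append c (λ _ → 0#)) (trans (+-cong e (sum-replicate-zero N)) (+-identityʳ 1#))

  fromRight-good : ∀ {K N} {φ : Poly N} → All Good φ → All Good (fromRight {K} φ)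
  fromRight-good {K} = good-map λ {c} (p , e) → append-nonNeg _ c (λ _ → ≤-refl) p
    , trans (sum-append {K} (λ _ → 0#) c) (trans (+-cong (sum-replicate-zero K) e) (+-identityˡ 1#))

  unit-convex : ∀ {N} (k : Fin N) → Convex (unit k)
  unit-convex {suc N} zero    = (λ { zero → 0≤1 ; (suc _) → ≤-refl }) , trans (+-congˡ (sum-replicate-zero N))
      (+-identityʳ 1#)
  unit-convex {suc N} (suc k) = (λ { zero → ≤-refl ; (suc i) → proj₁ (unit-convex k) i }) , trans (+-identityˡ _)
      (proj₂ (unit-convex k))

  act-unit⁺ : ∀ {N} {Z : Fin N → Coned} → Cones Z → ∀ k {s u} → Z k s u → act (s ⊙ unit k) Z u
  act-unit⁺ cz zero    {s} z = _ , 0v , resp (cz zero) (sym (*-identityʳ s)) ≋-refl z , act-zero (cz ∘ suc)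
      (⊙-zeroʳ s ≋-refl) , ⊕0 ≋-refl
  act-unit⁺ cz (suc k) {s} z = 0v , _ , zero-∈′ (cz zero) (zeroʳ s) ≋-refl , act-unit⁺ (cz ∘ suc) k z , 0⊕ ≋-refl

  act-unit⁻ : ∀ {N} {Z : Fin N → Coned} → Cones Z → ∀ k {s u} → act (s ⊙ unit k) Z u → Z k s u
  act-unit⁻ cz zero    {s} (y , v , z , a , e) = resp (cz zero) (*-identityʳ s)
    (≋-sym (≋-trans e (⊕-identityʳ (act-vanish (cz ∘ suc) (⊙-zeroʳ s ≋-refl) a)))) z
  act-unit⁻ cz (suc k) {s} (y , v , z , a , e) = resp (cz (suc k)) refl
    (≋-sym (≋-trans e (⊕-identityˡ (vanish (cz zero) (zeroʳ s) z)))) (act-unit⁻ (cz ∘ suc) k a)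

  eval-unit⁺ : ∀ {N} {Z : Fin N → Coned} → Cones Z → ∀ k {t u} → 0# < t → Z k t u → Eval Z (unit k ∷ []) t u
  eval-unit⁺ cz k 0<t z = cons 0<t (act-unit⁺ cz k z) (nil refl ≋-refl) (sym (+-identityʳ _)) (⊕0 ≋-refl)

  eval-unit⁻ : ∀ {N} {Z : Fin N → Coned} → Cones Z → ∀ k {t u} → Eval Z (unit k ∷ []) t u → Z k t u
  eval-unit⁻ cz k (cons 0<s a (nil e f) e′ f′) = resp (cz k)
    (sym (trans e′ (trans (+-congˡ e) (+-identityʳ _)))) (≋-sym (≋-trans f′ (⊕-identityʳ f))) (act-unit⁻ cz k a)

  append-↑ˡ : ∀ {K N} (X : Fin K → Coned) (C : Fin N → Coned) i → append X C (i ↑ˡ N) ≡ X i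
  append-↑ˡ X C zero    = ≡-refl
  append-↑ˡ X C (suc i) = append-↑ˡ (X ∘ suc) C i

  flat-convex : ∀ {n p} {c : LinComb ℝ n p} → IsConvexCombination c → Convex (flat c)
  flat-convex {c = c} (p , e) = append-nonNeg _ _ (λ i → p (inj₁ i)) (λ q → p (inj₂ q)) , trans
      (sum-append (λ i → c (inj₁ i)) (λ q → c (inj₂ q))) e

  flat-good : ∀ {n p} {φ : Polynomial ℝ n p} → IsPolynomial φ → All Good (flatPolynomial φ)
  flat-good (g , _) = All.map⁺ (All.map (λ { {c ∷ cs} (cvs , _) → tt , All.map⁺ (All.map flat-convex cvs) }) g)

  symbols-tabulate : ∀ n p → symbols n p ≡ tabulate inj₁ ++ tabulate inj₂ ++ []
  symbols-tabulate n p = cong₂ _++_ (map-tabulate id inj₁) (≡-trans (map-tabulate id inj₂) (≡-sym (++-identityʳ _)))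

  module _ {Ω : Set} (c : Ω → ℝ) (S : Ω → Subset) where

    -- `evalLinComb` over an arbitrary list, for induction along `symbols`, which lists the
    -- variables before the parameters.
    partialSum : List Ω → Subset
    partialSum ωs = ⨁ (map (λ ω → c ω · S ω) (filter (λ ω → 0# <? c ω) ωs))

    partialSum-accept : ∀ {ω} ωs → 0# < c ω → partialSum (ω ∷ ωs) ≡ c ω · S ω ⊞ partialSum ωs
    partialSum-accept ωs 0<c = cong (⨁ ∘ map λ ω → c ω · S ω) (filter-accept (λ ω → 0# <? c ω) {xs = ωs} 0<c)

    partialSum-reject : ∀ {ω} ωs → ¬ (0# < c ω) → partialSum (ω ∷ ωs) ≡ partialSum ωs
    partialSum-reject ωs c≯0 = cong (⨁ ∘ map λ ω → c ω · S ω) (filter-reject (λ ω → 0# <? c ω) {xs = ωs} c≯0)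

    module _ (0≤c : ∀ ω → 0# ≤ c ω) (K : Ω → Coned) (cK : ∀ ω → IsCone (K ω))
        (S⊆K : ∀ ω {x} → S ω x → K ω 1# (coord x)) where

      partialSum-∷⁺ : ∀ ω ωs {v} → partialSum (ω ∷ ωs) v → ∃[ y ] ∃[ v′ ]
          (K ω (c ω) y × partialSum ωs v′ × coord v ≋ y ⊕ coord v′)
      partialSum-∷⁺ ω ωs {v} p with 0≤⇒0≈⊎0< (0≤c ω)
      ... | inj₁ c≈0 = 0v , v , zero-∈′ (cK ω) c≈0 ≋-refl
        , ≡-subst (λ A → A v) (partialSum-reject ωs (<-irrefl (sym c≈0))) p , 0⊕ ≋-refl
      ... | inj₂ 0<c with ≡-subst (λ A → A v) (partialSum-accept ωs 0<c) p
      ... | a , v′ , (x , s , e) , p′ , e′ = c ω ⊙ coord x , v′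
        , resp (cK ω) (*-identityʳ _) ≋-refl (scale (cK ω) 0<c (S⊆K ω s)) , p′
        , ≋-trans (coord-cong e′) (≋-trans (coord-+ a v′) (⊕-cong (≋-trans (coord-cong e) (coord-* (c ω) x)) ≋-refl))

      partialSum-tabulate⁺ : ∀ {N} (f : Fin N → Ω) ωs {v} → partialSum (tabulate f ++ ωs) v →
                             ∃[ u ] ∃[ v′ ] (act (c ∘ f) (K ∘ f) u × partialSum ωs v′ × coord v ≋ u ⊕ coord v′)
      partialSum-tabulate⁺ {zero}  f ωs {v} p = 0v , v , ≋-refl , p , 0⊕ ≋-refl
      partialSum-tabulate⁺ {suc N} f ωs p with partialSum-∷⁺ (f zero) _ p
      ... | y , v₁ , k , p₁ , e with partialSum-tabulate⁺ (f ∘ suc) ωs p₁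
      ... | u , v₂ , a , p₂ , e′ = y ⊕ u , v₂ , (y , u , k , a , ≋-refl) , p₂
        , λ j → trans (e j) (trans (+-congˡ (e′ j)) (sym (+-assoc _ _ _)))

    module _ {s : ℝ} (0<s : 0# < s) where

      partialSum-∷⁻ : ∀ ω ωs {y w} → coneOver (S ω) (s * c ω) y → Conv (partialSum ωs) w → Conv
          (partialSum (ω ∷ ωs)) (s ⁻¹ ⊙ y ⊕ w)
      partialSum-∷⁻ ω ωs k p with 0# <? c ω | k
      ... | yes 0<c | inj₁ (e , f)         = ⊥-elim (0<⇒≉0 (0<-* 0<s 0<c) e)
      ... | yes 0<c | inj₂ (_ , z , cz , e) = ≡-subst (λ A → Conv A _) (≡-sym (partialSum-accept ωs 0<c))
          (Conv-⊞ (Conv-resp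
        (λ j → sym (trans (*-congˡ (e j))
          (trans (solve 4 (λ i s c z → i :* ((s :* c) :* z) := (i :* s) :* (c :* z)) refl (s ⁻¹) s (c ω) (z j))
          (trans (*-congʳ (⁻¹-inverseˡ (0<⇒≉0 0<s))) (*-identityˡ _))))) (Conv-· (c ω) cz)) p)
      ... | no c≯0 | inj₁ (e , f) = ≡-subst (λ A → Conv A _) (≡-sym (partialSum-reject ωs c≯0))
        (Conv-resp (≋-sym (⊕-identityˡ (⊙-zeroʳ _ f))) p)
      ... | no c≯0 | inj₂ (0<sc , _) = ⊥-elim (c≯0 (<-respʳ
        (⁻¹-cancelˡ 0<s _) (0<-* (0<-⁻¹ 0<s) 0<sc)))

      partialSum-tabulate⁻ : ∀ {N} (f : Fin N → Ω) ωs {u w} → act (s ⊙ (c ∘ f)) (coneOver ∘ S ∘ f) u → Conv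
          (partialSum ωs) w →
                             Conv (partialSum (tabulate f ++ ωs)) (s ⁻¹ ⊙ u ⊕ w)
      partialSum-tabulate⁻ {zero}  f ωs e p = Conv-resp (≋-sym (⊕-identityˡ (⊙-zeroʳ _ e))) p
      partialSum-tabulate⁻ {suc N} f ωs (y , u , k , a , e) p = Conv-resp
        (λ j → sym (trans (+-congʳ (trans (*-congˡ (e j)) (distribˡ _ _ _))) (+-assoc _ _ _)))
        (partialSum-∷⁻ (f zero) _ k (partialSum-tabulate⁻ (f ∘ suc) ωs a p))

  module _ {n p : ℕ} (X : Fin n → Subset) (P : Fin p → Subset) where

    module _ {K : Fin n → Coned} {C : Fin p → Coned} (cK : Cones K) (cC : Cones C)
             (X⊆K : ∀ i {x} → X i x → K i 1# (coord x)) (P⊆C : ∀ q {x} → P q x → C q 1# (coord x)) where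

      private
        KC : Symbol n p → Coned
        KC = [ K , C ]′

        cKC : ∀ ω → IsCone (KC ω)
        cKC (inj₁ i) = cK i
        cKC (inj₂ q) = cC q

        ⊆KC : ∀ ω {x} → [ X , P ]′ ω x → KC ω 1# (coord x)
        ⊆KC (inj₁ i) = X⊆K i
        ⊆KC (inj₂ q) = P⊆C q

        cZ = append-cones cK cC

      -- Stated for all cones that contain the sets at weight 1, since it is applied to the least
      -- cones themselves.
      evalLinComb⁺ : ∀ {c v} → IsConvexCombination c → evalLinComb X P c v → act (flat c) (append K C) (coord v)
      evalLinComb⁺ {c} {v} cv r
        with partialSum-tabulate⁺ c [ X , P ]′ (proj₁ cv) KC cKC ⊆KC inj₁ (tabulate inj₂ ++ [])
               (≡-subst (λ ωs → partialSum c [ X , P ]′ ωs v) (symbols-tabulate n p) r)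
      ... | u , v₁ , a , p₁ , e with partialSum-tabulate⁺ c [ X , P ]′ (proj₁ cv) KC cKC ⊆KC inj₂ [] p₁
      ... | u′ , v₂ , a′ , p₂ , e′ = act-resp cZ ≋-refl
        (≋-sym (≋-trans e (⊕-cong ≋-refl (≋-trans e′ (⊕-identityʳ (≋-trans (coord-cong p₂) coord-0))))))
          (act-append⁺ a a′)

      evalMonomial⁺ : ∀ {c cs v} → All IsConvexCombination (c ∷ cs) → evalMonomial X P (c ∷ cs) v → Eval
          (append K C) (map flat (c ∷ cs)) 1# (coord v)
      evalMonomial⁺ {cs = []} (cv ∷ []) p = cons 0<1
          (act-resp cZ (λ ω → sym (*-identityˡ _)) ≋-refl (evalLinComb⁺ cv p)) (nil refl ≋-refl)
        (sym (+-identityʳ 1#)) (⊕0 ≋-refl)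
      evalMonomial⁺ {cs = c′ ∷ cs} (cv ∷ cvs) (t , a , b , 0<t , t<1 , pa , pb , e) = cons 0<t
          (act-scale cZ 0<t (evalLinComb⁺ cv pa))
        (eval-scale cZ (x<y⇒0<y-x t<1) (evalMonomial⁺ cvs pb)) (solve 1 (λ t → :1 := t :+ (:1 :- t) :* :1) refl t)
        (≋-trans (coord-cong e) (coord-mix t a b))

      evalPolynomial⁺ : ∀ {φ v} → IsPolynomial φ → evalPolynomial X P φ v → ⟦ flatPolynomial φ ⟧ᴾ (append K C) 1#
          (coord v)
      evalPolynomial⁺ (g , _) = go g
        where
        go : ∀ {φ v} → All IsMonomial φ → evalPolynomial X P φ v → ⟦ flatPolynomial φ ⟧ᴾ (append K C) 1# (coord v)
        go {(c ∷ cs) ∷ φ} ((cvs , _) ∷ g) (inj₁ p) = _ , here ≡-refl , evalMonomial⁺ cvs p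
        go {_ ∷ φ} (_ ∷ g) (inj₂ p) with go g p
        ... | M , M∈ , ev = M , there M∈ , ev

    private
      Z = append (coneOver ∘ X) (coneOver ∘ P)

      cZ : Cones Z
      cZ = append-cones (coneOver-isCone ∘ X) (coneOver-isCone ∘ P)

    -- The converse only reaches the convex hull, since `Z` consists of cones over hulls. Nothing is
    -- lost, because the result is compared with convex sets.
    evalLinComb⁻ : ∀ {c s u} → 0# < s → act (s ⊙ flat c) Z u → Conv (evalLinComb X P c) (s ⁻¹ ⊙ u)
    evalLinComb⁻ {c} {s} {u} 0<s a with act-append⁻ _ (act-resp cZ (append-⊙ s (c ∘ inj₁) (c ∘ inj₂)) ≋-refl a)
    ... | u₁ , u₂ , a₁ , a₂ , e = Conv-resp
      (λ j → sym (trans (*-congˡ (e j)) (trans (distribˡ _ _ _) (+-congˡ (sym (+-identityʳ _))))))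
      (≡-subst (λ ωs → Conv (partialSum c [ X , P ]′ ωs) _) (≡-sym (symbols-tabulate n p))
        (partialSum-tabulate⁻ c [ X , P ]′ 0<s inj₁ _ a₁
          (partialSum-tabulate⁻ c [ X , P ]′ 0<s inj₂ [] a₂ (base ≈ᴹ-refl (≋-sym coord-0)))))

    evalMonomial⁻ : ∀ c cs {t w} → Eval Z (map flat (c ∷ cs)) t w → coneOver (evalMonomial X P (c ∷ cs)) t w
    evalMonomial⁻ c [] (cons {s = s} 0<s a (nil e f) e′ f′) = inj₂ (<-respʳ (sym t≈s) 0<s , _ , evalLinComb⁻ 0<s a
      , λ j → trans (trans (f′ j) (trans (+-congˡ (f j)) (+-identityʳ _)))
          (sym (trans (*-congʳ t≈s) (⁻¹-cancelʳ 0<s _))))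
      where t≈s = trans e′ (trans (+-congˡ e) (+-identityʳ s))
    evalMonomial⁻ c (c′ ∷ cs) (cons {s = s} {u} {t′} {v′} 0<s a ev e f) with evalMonomial⁻ c′ cs ev
    ... | inj₁ (t′≈0 , _) = ⊥-elim (0<⇒≉0 (eval-cons-positive ev) t′≈0)
    ... | inj₂ (0<t′ , z , cz , g) = inj₂ (<-respʳ (sym e) 0<r , _
      , Conv-⋆ (s * (s + t′) ⁻¹) (0<-* 0<s (0<-⁻¹ 0<r)) (ratio<1 0<t′ 0<r) (evalLinComb⁻ 0<s a) cz
      , ≋-trans f (≋-trans (⊕-cong
            (λ j → sym (⁻¹-cancelʳ 0<s _)) g)
          (≋-trans (weighted-mix 0<r _ z) (⊙-cong (sym e) ≋-refl))))
      where 0<r = 0<-+ˡ 0<s (<⇒≤ 0<t′)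

    evalPolynomial⁻ : ∀ φ {t w} → ⟦ flatPolynomial φ ⟧ᴾ Z t w → coneOver (evalPolynomial X P φ) t w
    evalPolynomial⁻ ((c ∷ cs) ∷ φ) (_ , here ≡-refl , ev) = coneOver-mono inj₁ (evalMonomial⁻ c cs ev)
    evalPolynomial⁻ (_ ∷ φ) (M , there M∈ , ev)           = coneOver-mono inj₂ (evalPolynomial⁻ φ (M , M∈ , ev))

  -- `C` and `π` leave open how the parameters are presented: any finite family of cones in which
  -- each `P q` is a union of monomials will do.
  module Solve {n p N} (I : System ℝ n p) (sys : IsSystem I) (P : Fin p → Subset)
               (C : Fin N → Coned) (cC : Cones C) (π : Fin p → Poly N) (gπ : ∀ q → All Good (π q))
               (P⇒π : ∀ q {v} → P q v → ⟦ π q ⟧ᴾ C 1# (coord v))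
               (π⇒P : ∀ q {v} → ⟦ π q ⟧ᴾ C 1# (coord v) → P q v) where

    private
      KP : Fin p → Coned
      KP = coneOver ∘ P

      cKP : Cones KP
      cKP = coneOver-isCone ∘ P

      module L₁ = LeastCones (leastCones n (λ j → flatPolynomial (I j)) (λ j → flat-good (sys j)) KP cKP)
      module L₂ = LeastCones (leastCones p (λ q → fromRight (π q)) (λ q → fromRight-good (gπ q)) C cC)

      -- With `L₂⊆KP` this identifies the least cones for Y_q ≥ π_q with the cones over the hulls of
      -- the parameters: both are the least cones that contain `P q` at weight 1.
      KP⊆L₂ : ∀ q {t w} → KP q t w → L₂.X q t w
      KP⊆L₂ q = coneOver-below (L₂.isCone q) λ s → L₂.closed q (fromRight⁺ L₂.isCone cC (P⇒π q s))

      L₂⊆KP : ∀ q {t w} → L₂.X q t w → KP q t w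
      L₂⊆KP = L₂.below KP cKP λ q r → go q (fromRight⁻ cKP cC r)
        where
        go : ∀ q {t w} → ⟦ π q ⟧ᴾ C t w → KP q t w
        go q {t} {w} (M , M∈ , ev) = [ at-positive-weight , inj₁ ]′ (eval-positive ev)
          where
          at-positive-weight : 0# < t → KP q t w
          at-positive-weight 0<t = inj₂ (0<t , t ⁻¹ ⊙ w
            , base (π⇒P q (M , M∈ , eval-resp (⁻¹-inverseˡ (0<⇒≉0 0<t)) (≋-sym (coord-lin (t ⁻¹ ⊙ w)))
              (eval-scale cC (0<-⁻¹ 0<t) ev)))
                (≋-sym (coord-lin (t ⁻¹ ⊙ w)))
            , λ j → sym (⁻¹-cancelʳ 0<t _))

      χ : Fin n → Poly (n +ᴺ p)
      χ i = (unit (i ↑ˡ p) ∷ []) ∷ []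

      gχ : ∀ i → All Good (χ i)
      gχ i = (tt , unit-convex (i ↑ˡ p) ∷ []) ∷ []

      ρ : Fin n → Poly p
      ρ i = eliminate n (λ j → flatPolynomial (I j)) (χ i)

      gρ : ∀ i → All Good (ρ i)
      gρ i = L₁.good (χ i) (gχ i)

      eval-least : Fin n → Subset
      eval-least i v = L₁.X i 1# (coord v)

      least-isSolution : IsSolution I P eval-least
      least-isSolution = (λ i → (λ e k → resp (L₁.isCone i) refl (coord-cong e) k)
          , λ {x} {y} t 0≤t t≤1 kx ky → resp (L₁.isCone i) refl (≋-sym (coord-mix t x y))
            (cone-mix (L₁.isCone i) t 0≤t t≤1 kx ky))
        , λ i r → L₁.closed i (evalPolynomial⁺ eval-least P L₁.isCone cKP (λ _ k → k) (λ _ → coneOver-base) (sys i) r)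

    solution-good : ∀ i → All Good (solution I π i)
    solution-good i = L₂.good _ (fromLeft-good (gρ i))

    module _ {X : Fin n → Subset} (smallest : IsSmallestSolution I P X) where

      -- Minimality of `X` enters: the slices of the least cones at weight 1 form a competing
      -- solution.
      solution-complete : ∀ i {v} → X i v → ⟦ solution I π i ⟧ᴾ C 1# (coord v)
      solution-complete i x = L₂.complete _ (fromLeft-good (gρ i)) (fromLeft⁺ L₂.isCone cC
        (widen (L₁.complete (χ i) (gχ i) (_ , here ≡-refl , eval-unit⁺ (append-cones L₁.isCone cKP) (i ↑ˡ p) 0<1
          (≡-subst (λ (K : Coned) → K 1# _) (≡-sym (append-↑ˡ L₁.X KP i))
            (proj₂ smallest eval-least least-isSolution i x))))))
        where
        widen : ∀ {φ : Poly p} {t v} → ⟦ φ ⟧ᴾ KP t v → ⟦ φ ⟧ᴾ L₂.X t v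
        widen (M , M∈ , ev) = M , M∈ , eval-mono KP⊆L₂ ev

      -- Minimality of the cones enters: those over the components of `X` are closed because `X` is
      -- a solution, and a convex set is recovered from its cone.
      solution-sound : ∀ i {v} → ⟦ solution I π i ⟧ᴾ C 1# (coord v) → X i v
      solution-sound i r = coneOver-convex (proj₁ (proj₁ smallest) i)
        (L₁.below (coneOver ∘ X) (coneOver-isCone ∘ X)
          (λ j r → coneOver-mono (proj₂ (proj₁ smallest) j) (evalPolynomial⁻ X P (I j) r)) i
          (component (L₁.sound (χ i) (gχ i) (narrow (fromLeft⁻ L₂.isCone cC (L₂.sound _ (fromLeft-good (gρ i)) r))))))
        where
        narrow : ∀ {φ : Poly p} {t v} → ⟦ φ ⟧ᴾ L₂.X t v → ⟦ φ ⟧ᴾ KP t v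
        narrow (M , M∈ , ev) = M , M∈ , eval-mono L₂⊆KP ev
        component : ∀ {t v} → ⟦ χ i ⟧ᴾ (append L₁.X KP) t v → L₁.X i t v
        component (_ , here ≡-refl , ev) = ≡-subst (λ (K : Coned) → K _ _) (append-↑ˡ L₁.X KP i)
          (eval-unit⁻ (append-cones L₁.isCone cKP) (i ↑ˡ p) ev)

-- Fourier-Motzkin elimination on homogeneous systems.

module FourierMotzkin {A : Set} (arith : Arithmetic A) where
  open import Data.Fin.Base using (zero; suc)
  open import Data.Nat.Base using (zero; suc)
  open Elimination arith using (unit)
  open Arithmetic arith renaming (zero to #0; one to #1)

  -- The homogeneous inequality 0 ≤ bound · x + free · z (or 0 < …), in which x is to be eliminated.
  record Constraint (k m : ℕ) : Set where
    constructor constraint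
    field
      bound  : Fin k → A
      free   : Fin m → A
      strict : Bool
  open Constraint public

  Sys : ℕ → ℕ → Set
  Sys k m = List (Constraint k m)

  positive? negative? vanishing? : ∀ {k m} → Constraint (suc k) m → Bool
  positive?  c = notᵇ (leq (bound c zero) #0)
  negative?  c = notᵇ (leq #0 (bound c zero))
  vanishing? c = leq (bound c zero) #0 ∧ leq #0 (bound c zero)

  -- `c` bounds the unknown from below and `e` from above, so both multipliers are positive, and
  -- they make the unknown cancel.
  combine : ∀ {k m} → Constraint (suc k) m → Constraint (suc k) m → Constraint k m
  combine c e = constraint (λ i → weighted (bound c (suc i)) (bound e (suc i)))
      (λ i → weighted (free c i) (free e i)) (strict c ∨ strict e)
    where
    weighted : A → A → A
    weighted x y = add (mul (bound c zero) y) (mul (neg (bound e zero)) x)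

  forget : ∀ {k m} → Constraint (suc k) m → Constraint k m
  forget c = constraint (bound c ∘ suc) (free c) (strict c)

  project : ∀ {k m} → Sys (suc k) m → Sys k m
  project S = map forget (filterᵇ vanishing? S) ++ cartesianProductWith combine (filterᵇ positive? S)
      (filterᵇ negative? S)

  projectAll : ∀ k {m} → Sys k m → Sys 0 m
  projectAll zero    S = S
  projectAll (suc k) S = projectAll k (project S)

  -- From here on the unknowns are (t , u) with u of length d.
  module _ {d : ℕ} where

    Region : Set
    Region = Sys 0 (suc d)

    linear : Bool → (Fin (suc d) → A) → Constraint 0 (suc d)
    linear s a = constraint (λ ()) a s

    -- The unknowns y with y in S and z - y in T.
    sumSystem : Region → Region → Sys (suc d) (suc d)
    sumSystem S T =
      map (λ c → constraint (free c) (λ _ → #0) (strict c)) S ++ map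
          (λ c → constraint (neg ∘ free c) (free c) (strict c)) T

    opaque
      sumRegion : Region → Region → Region
      sumRegion S T = projectAll (suc d) (sumSystem S T)

    -- The unknowns v with (t , v) in S and (t , u - v) in T.
    fibreSystem : Region → Region → Sys d (suc d)
    fibreSystem S T =
      map (λ c → constraint (free c ∘ suc) (free c zero ∷ᶠ λ _ → #0) (strict c)) S
        ++ map (λ c → constraint (neg ∘ free c ∘ suc) (free c) (strict c)) T

    opaque
      fibreSum : Region → Region → Region
      fibreSum S T = projectAll d (fibreSystem S T)

    -- Multiplies by `λ₀` the set described at weight 1: (t, u) qualifies if (λ₀ t, u) lies in the
    -- given region.
    scaleWeight : A → Region → Region
    scaleWeight λ₀ = map λ c → linear (strict c) (mul (free c zero) λ₀ ∷ᶠ (free c ∘ suc))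

    ray : (Fin d → A) → Region
    ray w = linear false (unit zero)
      ∷ tabulate (λ j → linear false (neg (w j) ∷ᶠ unit j))
      ++ tabulate (λ j → linear false (w j ∷ᶠ (neg ∘ unit j)))

    -- Only the vector is forced to be 0, the weight stays free; this is the neutral element for
    -- `fibreSum`.
    fibreZero : Region
    fibreZero = tabulate (λ j → linear false (unit (suc j))) ++ tabulate (λ j → linear false (neg ∘ unit (suc j)))

    origin : Region
    origin = linear false (unit zero) ∷ linear false (neg ∘ unit zero) ∷ fibreZero

    -- Symbols of coefficient 0 must be skipped: at weight 0 a region describes directions of
    -- recession, and it misses the apex when some inequality is strict.
    actRegion : ∀ {N} → (Fin N → A) → (Fin N → Region) → Region
    actRegion {zero}  c S = fibreZero
    actRegion {suc N} c S = if leq (c zero) #0 then rest else fibreSum (scaleWeight (c zero) (S zero)) rest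
      where rest = actRegion (c ∘ suc) (S ∘ suc)

    -- Positivity of the weight is imposed on each factor separately, since in a positive join no
    -- factor may be omitted.
    evalRegion : ∀ {N} → List (Fin N → A) → (Fin N → Region) → Region
    evalRegion []      S = origin
    evalRegion (c ∷ M) S = sumRegion (linear true (unit zero) ∷ actRegion c S) (evalRegion M S)

-- Correctness of Fourier-Motzkin elimination.

module FourierMotzkinCorrect (R : Reals) where
  open import Data.Fin.Base using (zero; suc)
  open import Data.Nat.Base using (zero; suc)
  open OrderedField R
  open Reals R hiding (zero)
  open Vectors R
  open FourierMotzkin (arithmetic R)
  open SemiringSum semiring using (sum-cong-≋; ∑-distrib-+; *-distribˡ-sum)

  Cmp : Bool → ℝ → ℝ → Set
  Cmp true  = _<_
  Cmp false = _≤_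

  cmp⇒≤ : ∀ s {x y} → Cmp s x y → x ≤ y
  cmp⇒≤ true  = <⇒≤
  cmp⇒≤ false = id

  <⇒cmp : ∀ s {x y} → x < y → Cmp s x y
  <⇒cmp true  = id
  <⇒cmp false = <⇒≤

  cmp-respʳ : ∀ s {x y z} → y ≈ z → Cmp s x y → Cmp s x z
  cmp-respʳ true  = <-respʳ
  cmp-respʳ false = ≤-respʳ

  cmp-+ : ∀ s s′ {x y} → Cmp s 0# x → Cmp s′ 0# y → Cmp (s ∨ s′) 0# (x + y)
  cmp-+ true  s′    p q = 0<-+ˡ p (cmp⇒≤ s′ q)
  cmp-+ false true  p q = 0<-+ʳ p q
  cmp-+ false false p q = 0≤-+ p q

  cmp-* : ∀ s {k x} → 0# < k → Cmp s 0# x → Cmp s 0# (k * x)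
  cmp-* true  0<k p = 0<-* 0<k p
  cmp-* false 0<k p = *-nonNeg (<⇒≤ 0<k) p

  cmp-*⁻ : ∀ s {k x} → 0# < k → Cmp s 0# (k * x) → Cmp s 0# x
  cmp-*⁻ s 0<k p = cmp-respʳ s (⁻¹-cancelˡ 0<k _)
    (cmp-* s (0<-⁻¹ 0<k) p)

  cmp⇒0- : ∀ s {x y} → Cmp s x y → Cmp s 0# (y - x)
  cmp⇒0- true  = x<y⇒0<y-x
  cmp⇒0- false = x≤y⇒0≤y-x

  0-⇒cmp : ∀ s {x y} → Cmp s 0# (y - x) → Cmp s x y
  0-⇒cmp true  = 0<y-x⇒x<y
  0-⇒cmp false = 0≤y-x⇒x≤y

  half : ℝ
  half = (1# + 1#) ⁻¹

  0<half : 0# < half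
  0<half = 0<-⁻¹ (0<-+ˡ 0<1 0≤1)

  half+half : half + half ≈ 1#
  half+half = trans (solve 1 (λ h → h :+ h := h :* (:1 :+ :1)) refl half) (⁻¹-inverseˡ (0<⇒≉0 (0<-+ˡ 0<1 0≤1)))

  between-strict : ∀ s s′ {l u} → l < u → ∃[ x ] (Cmp s l x × Cmp s′ x u)
  between-strict s s′ {l} {u} l<u = half * l + half * u
    , <⇒cmp s (0<y-x⇒x<y (<-respʳ (trans
      (solve 3 (λ h l u → h :* (u :- l) := h :* l :+ h :* u :- (h :+ h) :* l) refl half l u)
          (+-congˡ (-‿cong (trans (*-congʳ half+half) (*-identityˡ l))))) 0<gap))
    , <⇒cmp s′ (0<y-x⇒x<y (<-respʳ
      (trans (solve 3 (λ h l u → h :* (u :- l) := (h :+ h) :* u :- (h :* l :+ h :* u)) refl half l u)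
          (+-congʳ (trans (*-congʳ half+half) (*-identityˡ u)))) 0<gap))
    where 0<gap = 0<-* 0<half (x<y⇒0<y-x l<u)

  between : ∀ s s′ {l u} → Cmp (s ∨ s′) l u → ∃[ x ] (Cmp s l x × Cmp s′ x u)
  between false false {l} l≤u = l , ≤-refl , l≤u
  between false true  l<u     = between-strict false true l<u
  between true  s′    l<u     = between-strict true s′ l<u

  Bound : Set
  Bound = ℝ × Bool

  Below Above : Bound → ℝ → Set
  Below (b , s) x = Cmp s b x
  Above (b , s) x = Cmp s x b

  -- The larger bound is the stronger one, and among equal bounds a strict one.
  stronger-lower : ∀ b c → (∀ x → Below b x → Below c x) ⊎ (∀ x → Below c x → Below b x)
  stronger-lower (b , s) (c , s′) with c ≤? b | b ≤? c
  ... | no c≰b  | _       = inj₂ λ x p → <⇒cmp s (<-≤-trans (≰⇒> c≰b) (cmp⇒≤ s′ p))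
  ... | yes _   | no b≰c  = inj₁ λ x p → <⇒cmp s′ (<-≤-trans (≰⇒> b≰c) (cmp⇒≤ s p))
  ... | yes c≤b | yes b≤c = equal s
    where
    equal : ∀ s → (∀ x → Below (b , s) x → Below (c , s′) x) ⊎ (∀ x → Below (c , s′) x → Below (b , s) x)
    equal true  = inj₁ λ x p → <⇒cmp s′ (≤-<-trans c≤b p)
    equal false = inj₂ λ x p → ≤-trans b≤c (cmp⇒≤ s′ p)

  stronger-upper : ∀ b c → (∀ x → Above b x → Above c x) ⊎ (∀ x → Above c x → Above b x)
  stronger-upper (b , s) (c , s′) with b ≤? c | c ≤? b
  ... | no b≰c  | _       = inj₂ λ x p → <⇒cmp s (≤-<-trans (cmp⇒≤ s′ p) (≰⇒> b≰c))
  ... | yes _   | no c≰b  = inj₁ λ x p → <⇒cmp s′ (≤-<-trans (cmp⇒≤ s p) (≰⇒> c≰b))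
  ... | yes b≤c | yes c≤b = equal s
    where
    equal : ∀ s → (∀ x → Above (b , s) x → Above (c , s′) x) ⊎ (∀ x → Above (c , s′) x → Above (b , s) x)
    equal true  = inj₁ λ x p → <⇒cmp s′ (<-≤-trans p b≤c)
    equal false = inj₂ λ x p → ≤-trans (cmp⇒≤ s′ p) c≤b

  strongest : ∀ {B : Set} (H : B → ℝ → Set) → (∀ b c → (∀ x → H b x → H c x) ⊎ (∀ x → H c x → H b x)) →
              ∀ b bs → ∃[ c ] (c ∈ b ∷ bs × (∀ x → H c x → All (λ b → H b x) (b ∷ bs)))
  strongest H cmp b []       = b , here ≡-refl , λ x h → h ∷ []
  strongest H cmp b (b′ ∷ bs) with strongest H cmp b′ bs
  ... | c , c∈ , all with cmp b c
  ... | inj₁ f = b , here ≡-refl , λ x h → h ∷ all x (f x h)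
  ... | inj₂ f = c , there c∈ , λ x h → f x h ∷ all x h

  -- On each side the strongest bound implies the others, so the compatibility of one pair suffices.
  -- Where one side has no bounds, moving by 1 beyond the strongest bound of the other satisfies all
  -- of them strictly.
  separate : ∀ (L U : List Bound) → (∀ {l u} → l ∈ L → u ∈ U → Cmp (proj₂ l ∨ proj₂ u) (proj₁ l) (proj₁ u)) →
             ∃[ x ] (All (λ l → Below l x) L × All (λ u → Above u x) U)
  separate []      []      f = 0# , [] , []
  separate (l ∷ L) []      f with strongest Below stronger-lower l L
  ... | (b , s) , _ , all = b + 1# , all _
      (<⇒cmp s (0<y-x⇒x<y (<-respʳ (solve 2 (λ b o → o := b :+ o :- b) refl b 1#) 0<1))) , []
  separate []      (u ∷ U) f with strongest Above stronger-upper u U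
  ... | (b , s) , _ , all = b - 1# , [] , all _
      (<⇒cmp s (0<y-x⇒x<y (<-respʳ (solve 2 (λ b o → o := b :- (b :- o)) refl b 1#) 0<1)))
  separate (l ∷ L) (u ∷ U) f with strongest Below stronger-lower l L | strongest Above stronger-upper u U
  ... | (b , s) , b∈ , all | (b′ , s′) , b′∈ , all′ with between s s′ (f b∈ b′∈)
  ... | x , p , q = x , all x p , all′ x q

  dot : ∀ {k} → Vect k → Vect k → ℝ
  dot a x = sum (λ i → a i * x i)

  dot-cong : ∀ {k} {a b x y : Vect k} → a ≋ b → x ≋ y → dot a x ≈ dot b y
  dot-cong p q = sum-cong-≋ λ i → *-cong (p i) (q i)

  dot-comm : ∀ {k} (a x : Vect k) → dot a x ≈ dot x a
  dot-comm a x = sum-cong-≋ λ i → *-comm (a i) (x i)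

  dot-⊕ʳ : ∀ {k} (a x y : Vect k) → dot a (x ⊕ y) ≈ dot a x + dot a y
  dot-⊕ʳ a x y = trans (sum-cong-≋ λ i → distribˡ (a i) (x i) (y i)) (∑-distrib-+ (λ i → a i * x i) (λ i → a i * y i))

  dot-⊙ʳ : ∀ {k} s (a x : Vect k) → dot a (s ⊙ x) ≈ s * dot a x
  dot-⊙ʳ s a x = trans (sum-cong-≋ λ i → solve 3 (λ s a x → a :* (s :* x) := s :* (a :* x)) refl s (a i) (x i))
    (sym (*-distribˡ-sum s (λ i → a i * x i)))

  dot-⊕ˡ : ∀ {k} (a b x : Vect k) → dot (a ⊕ b) x ≈ dot a x + dot b x
  dot-⊕ˡ a b x = trans (dot-comm (a ⊕ b) x) (trans (dot-⊕ʳ x a b) (+-cong (dot-comm x a) (dot-comm x b)))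

  dot-⊙ˡ : ∀ {k} s (a x : Vect k) → dot (s ⊙ a) x ≈ s * dot a x
  dot-⊙ˡ s a x = trans (dot-comm (s ⊙ a) x) (trans (dot-⊙ʳ s x a) (*-congˡ (dot-comm x a)))

  dot-neg : ∀ {k} (a x : Vect k) → dot (-_ ∘ a) x ≈ - dot a x
  dot-neg a x = trans (dot-cong {a = -_ ∘ a} {(- 1#) ⊙ a} {x}
      (λ i → solve 1 (λ a → :- a := :- :1 :* a) refl (a i)) ≋-refl)
    (trans (dot-⊙ˡ (- 1#) a x) (solve 1 (λ d → :- :1 :* d := :- d) refl (dot a x)))

  dot-zeroˡ : ∀ {k} (x : Vect k) → dot (λ _ → 0#) x ≈ 0#
  dot-zeroˡ x = trans (dot-cong {a = λ _ → 0#} {0# ⊙ x} {x} (λ i → sym (zeroˡ (x i))) ≋-refl)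
      (trans (dot-⊙ˡ 0# x x) (zeroˡ _))

  value : ∀ {k m} → Constraint k m → Vect k → Vect m → ℝ
  value c x z = dot (bound c) x + dot (free c) z

  Holds : ∀ {k m} → Vect k → Vect m → Constraint k m → Set
  Holds x z c = Cmp (strict c) 0# (value c x z)

  Sat : ∀ {k m} → Sys k m → Vect k → Vect m → Set
  Sat S x z = All (Holds x z) S

  positive⁻ : ∀ {k m} (c : Constraint (suc k) m) → T (positive? c) → 0# < bound c zero
  positive⁻ c p with bound c zero ≤? 0#
  ... | no q = ≰⇒> q

  negative⁻ : ∀ {k m} (c : Constraint (suc k) m) → T (negative? c) → bound c zero < 0#
  negative⁻ c p with 0# ≤? bound c zero
  ... | no q = ≰⇒> q

  vanishing⁻ : ∀ {k m} (c : Constraint (suc k) m) → T (vanishing? c) → bound c zero ≈ 0#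
  vanishing⁻ c p with bound c zero ≤? 0# | 0# ≤? bound c zero
  ... | yes q | yes r = ≤-antisym q r

  trichotomy : ∀ {k m} (c : Constraint (suc k) m) → T (vanishing? c) ⊎ T (positive? c) ⊎ T (negative? c)
  trichotomy c with bound c zero ≤? 0# | 0# ≤? bound c zero
  ... | yes q | yes r = inj₁ tt
  ... | yes q | no r  = inj₂ (inj₂ tt)
  ... | no q  | _     = inj₂ (inj₁ tt)

  module _ {k m} (x : Vect k) (z : Vect m) where

    remainder : Constraint (suc k) m → ℝ
    remainder c = value (forget c) x z

    value-∷ : ∀ c x₀ → value c (x₀ ∷ᶠ x) z ≈ bound c zero * x₀ + remainder c
    value-∷ c x₀ = +-assoc _ _ _

    value-combine : ∀ c e → value (combine c e) x z ≈ bound c zero * remainder e + - bound e zero * remainder c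
    value-combine c e = trans (+-cong (weighted (bound c ∘ suc) (bound e ∘ suc) x) (weighted (free c) (free e) z))
      (solve 6 (λ p q a b c e → (p :* a :+ q :* b) :+ (p :* c :+ q :* e) := p :* (a :+ c) :+ q :* (b :+ e)) refl
        (bound c zero) (- bound e zero) (dot (bound e ∘ suc) x) (dot (bound c ∘ suc) x) (dot (free e) z)
          (dot (free c) z))
      where
      weighted : ∀ {k} (f g y : Vect k) → dot
          (bound c zero ⊙ g ⊕ (- bound e zero) ⊙ f) y ≈ bound c zero * dot g y + - bound e zero * dot f y
      weighted f g y = trans (dot-⊕ˡ (bound c zero ⊙ g) ((- bound e zero) ⊙ f) y) (+-cong (dot-⊙ˡ _ g y) (dot-⊙ˡ _ f y))

    project⁺ : ∀ S {x₀} → Sat S (x₀ ∷ᶠ x) z → Sat (project S) x z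
    project⁺ S {x₀} sat = All.++⁺
      (All.map⁺ (All.tabulate λ {c} c∈ → vanishing c (∈-filter⁻ (T? ∘ vanishing?) {xs = S} c∈)))
      (All.tabulate λ e∈ → pair (∈-cartesianProductWith⁻ combine (filterᵇ positive? S) (filterᵇ negative? S) e∈))
      where
      vanishing : ∀ c → c ∈ S × T (vanishing? c) → Holds x z (forget c)
      vanishing c (c∈ , p) = cmp-respʳ (strict c) (trans (value-∷ c x₀)
        (trans (+-congʳ (trans (*-congʳ (vanishing⁻ c p)) (zeroˡ _))) (+-identityˡ _))) (All.lookup sat c∈)

      pair : ∀ {f} → ∃[ c ] ∃[ e ] (c ∈ filterᵇ positive? S × e ∈ filterᵇ negative? S × f ≡ combine c e) → Holds x z f
      pair (c , e , c∈ , e∈ , ≡-refl) with ∈-filter⁻ (T? ∘ positive?) {xs = S} c∈ | ∈-filter⁻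
          (T? ∘ negative?) {xs = S} e∈
      ... | c∈S , p | e∈S , q = cmp-respʳ (strict c ∨ strict e)
        (trans (+-cong (*-congˡ (value-∷ c x₀)) (*-congˡ (value-∷ e x₀))) (trans
          (solve 5 (λ p q x r s → (:- q) :* (p :* x :+ r) :+ p :* (q :* x :+ s) := p :* s :+ (:- q) :* r) refl
            (bound c zero) (bound e zero) x₀ (remainder c) (remainder e)) (sym (value-combine c e))))
        (cmp-+ (strict c) (strict e) (cmp-* (strict c) (0<-x (negative⁻ e q)) (All.lookup sat c∈S))
          (cmp-* (strict e) (positive⁻ c p) (All.lookup sat e∈S)))

    -- The value of the eliminated unknown at which the constraint becomes an equality: a lower
    -- bound if its coefficient is positive, an upper bound if it is negative.
    root : Constraint (suc k) m → Bound
    root c = - remainder c * bound c zero ⁻¹ , strict c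

    root-factor : ∀ c x₀ → ¬ (bound c zero ≈ 0#) → bound c zero * (x₀ - proj₁ (root c)) ≈ value c (x₀ ∷ᶠ x) z
    root-factor c x₀ b≉0 = trans (solve 4 (λ b x r i → b :* (x :- (:- r) :* i) := b :* x :+ (b :* i) :* r) refl
        (bound c zero) x₀ (remainder c) (bound c zero ⁻¹))
      (trans (+-congˡ (trans (*-congʳ (⁻¹-inverseʳ b≉0)) (*-identityˡ _))) (sym (value-∷ c x₀)))

    -- Up to a positive factor, `combine c e` says that the root of `c` lies below the root of `e`;
    -- hence `separate` finds a common value.
    project⁻ : ∀ S → Sat (project S) x z → ∃[ x₀ ] Sat S (x₀ ∷ᶠ x) z
    project⁻ S sat = x₀ , All.tabulate λ {c} c∈ → holds c∈ (trichotomy c)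
      where
      vanishingHold : All (Holds x z) (map forget (filterᵇ vanishing? S))
      vanishingHold = proj₁ (All.++⁻ (map forget (filterᵇ vanishing? S)) sat)
      pairsHold : All (Holds x z) (cartesianProductWith combine (filterᵇ positive? S) (filterᵇ negative? S))
      pairsHold = proj₂ (All.++⁻ (map forget (filterᵇ vanishing? S)) sat)

      compatible : ∀ {l u} → l ∈ map root (filterᵇ positive? S) → u ∈ map root (filterᵇ negative? S) →
                   Cmp (proj₂ l ∨ proj₂ u) (proj₁ l) (proj₁ u)
      compatible l∈ u∈ with ∈-map⁻ root l∈ | ∈-map⁻ root u∈
      ... | c , c∈ , ≡-refl | e , e∈ , ≡-refl with ∈-filter⁻ (T? ∘ positive?) {xs = S} c∈ | ∈-filter⁻
          (T? ∘ negative?) {xs = S} e∈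
      ... | _ , p | _ , q = 0-⇒cmp (strict c ∨ strict e)
          (cmp-*⁻ (strict c ∨ strict e) (0<-* (positive⁻ c p) (0<-x (negative⁻ e q)))
        (cmp-respʳ (strict c ∨ strict e) (trans (value-combine c e) (sym (trans
            (solve 6 (λ b b′ r r′ i i′ → (b :* (:- b′)) :* ((:- r′) :* i′ :- (:- r) :* i) := (b′ :* i′) :*
              (b :* r′) :+ (b :* i) :* ((:- b′) :* r)) refl
              (bound c zero) (bound e zero) (remainder c) (remainder e) (bound c zero ⁻¹) (bound e zero ⁻¹))
            (+-cong (trans (*-congʳ (⁻¹-inverseʳ (proj₂ (negative⁻ e q)))) (*-identityˡ _))
              (trans (*-congʳ (⁻¹-inverseʳ (0<⇒≉0 (positive⁻ c p)))) (*-identityˡ _))))))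
          (All.lookup pairsHold (∈-cartesianProductWith⁺ combine c∈ e∈))))

      sep = separate (map root (filterᵇ positive? S)) (map root (filterᵇ negative? S)) compatible
      x₀ = proj₁ sep

      holds : ∀ {c} → c ∈ S → T (vanishing? c) ⊎ T (positive? c) ⊎ T (negative? c) → Holds (x₀ ∷ᶠ x) z c
      holds {c} c∈ (inj₁ p) = cmp-respʳ (strict c) (sym (trans (value-∷ c x₀)
        (trans (+-congʳ (trans (*-congʳ (vanishing⁻ c p)) (zeroˡ _))) (+-identityˡ _))))
        (All.lookup vanishingHold (∈-map⁺ forget (∈-filter⁺ (T? ∘ vanishing?) c∈ p)))
      holds {c} c∈ (inj₂ (inj₁ p)) = cmp-respʳ (strict c) (root-factor c x₀ (0<⇒≉0 (positive⁻ c p)))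
        (cmp-* (strict c) (positive⁻ c p) (cmp⇒0- (strict c)
          (All.lookup (proj₁ (proj₂ sep)) (∈-map⁺ root (∈-filter⁺ (T? ∘ positive?) c∈ p)))))
      holds {c} c∈ (inj₂ (inj₂ p)) = cmp-respʳ (strict c) (trans
          (solve 3 (λ b x r → (:- b) :* (r :- x) := b :* (x :- r)) refl (bound c zero) x₀ (proj₁ (root c)))
          (root-factor c x₀ (proj₂ (negative⁻ c p))))
        (cmp-* (strict c) (0<-x (negative⁻ c p)) (cmp⇒0- (strict c)
          (All.lookup (proj₂ (proj₂ sep)) (∈-map⁺ root (∈-filter⁺ (T? ∘ negative?) c∈ p)))))

  holds-resp : ∀ {k m} {x x′ : Vect k} {z z′ : Vect m} → x ≋ x′ → z ≋ z′ → ∀ {c} → Holds x z c → Holds x′ z′ c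
  holds-resp p q {c} = cmp-respʳ (strict c) (+-cong (dot-cong ≋-refl p) (dot-cong ≋-refl q))

  sat-resp : ∀ {k m} {x x′ : Vect k} {z z′ : Vect m} → x ≋ x′ → z ≋ z′ → ∀ {S : Sys k m} → Sat S x z → Sat S x′ z′
  sat-resp p q = All.map λ {c} → holds-resp p q {c}

  projectAll⁺ : ∀ k {m} (S : Sys k m) x z → Sat S x z → Sat (projectAll k S) (λ ()) z
  projectAll⁺ zero    S x z sat = sat-resp {x = x} {λ ()} (λ ()) ≋-refl sat
  projectAll⁺ (suc k) S x z sat = projectAll⁺ k (project S) (x ∘ suc) z
    (project⁺ (x ∘ suc) z S (sat-resp {x = x} {x zero ∷ᶠ (x ∘ suc)} (λ { zero → refl ; (suc i) → refl }) ≋-refl sat))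

  projectAll⁻ : ∀ k {m} (S : Sys k m) z → Sat (projectAll k S) (λ ()) z → ∃[ x ] Sat S x z
  projectAll⁻ zero    S z sat = (λ ()) , sat
  projectAll⁻ (suc k) S z sat with projectAll⁻ k (project S) z sat
  ... | x , sat′ with project⁻ x z S sat′
  ... | x₀ , sat″ = x₀ ∷ᶠ x , sat″

-- Polyhedral cones and monomials over them.

module Regions (R : Reals) (d : ℕ) where
  open import Data.Fin.Base using (zero; suc)
  open import Data.Nat.Base using (zero; suc)
  open OrderedField R
  open Reals R hiding (zero)
  open Vectors R
  open Cones R d
  open IsCone
  open Elimination (arithmetic R) using (unit)
  open FourierMotzkin (arithmetic R)
  open FourierMotzkinCorrect R

  In : Region {d} → Vect (suc d) → Set
  In S z = Sat S (λ ()) z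

  in-resp : ∀ {S z z′} → z ≋ z′ → In S z → In S z′
  in-resp p = sat-resp {x = λ ()} {λ ()} (λ ()) p

  private
    cmp-≈ : ∀ s {x y} → x ≈ y → (Cmp s 0# x → Cmp s 0# y) × (Cmp s 0# y → Cmp s 0# x)
    cmp-≈ s p = cmp-respʳ s p , cmp-respʳ s (sym p)

    map-holds : ∀ {k} {x : Vect k} {z y : Vect (suc d)} (f : Constraint 0 (suc d) → Constraint k (suc d)) →
                (∀ c → (Holds (λ ()) y c → Holds x z (f c)) × (Holds x z (f c) → Holds (λ ()) y c)) →
                ∀ S → (In S y → Sat (map f S) x z) × (Sat (map f S) x z → In S y)
    map-holds f h S = (λ sat → All.map⁺ (All.map (λ {c} → proj₁ (h c)) sat))
        , (λ sat → All.map (λ {c} → proj₂ (h c)) (All.map⁻ sat))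

    dot-difference : ∀ {k} (a : Vect k) {x y z} → z ≋ x ⊕ y → dot (-_ ∘ a) x + dot a z ≈ dot a y
    dot-difference a {x} {y} e = trans (+-cong (dot-neg a x) (trans (dot-cong {b = a} ≋-refl e) (dot-⊕ʳ a x y)))
      (solve 2 (λ x y → :- x :+ (x :+ y) := y) refl (dot a x) (dot a y))

    difference : ∀ {k} (x z : Vect k) → z ≋ x ⊕ (λ i → z i - x i)
    difference x z i = solve 2 (λ x z → z := x :+ (z :- x)) refl (x i) (z i)

    module Sum (y z′ z : Vect (suc d)) (e : z ≋ y ⊕ z′) where
      left = map-holds {x = y} {z} {y} (λ c → constraint (free c) (λ _ → 0#) (strict c)) λ c → cmp-≈ (strict c)
        (trans (+-comm _ _) (+-congʳ′ c))
        where
        +-congʳ′ : ∀ (c : Constraint 0 (suc d)) → dot (free c) y + 0# ≈ dot (free c) y + dot (λ _ → 0#) z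
        +-congʳ′ c = +-congˡ (sym (dot-zeroˡ z))
      right = map-holds {x = y} {z} {z′} (λ c → constraint (-_ ∘ free c) (free c) (strict c)) λ c → cmp-≈ (strict c)
        (trans (+-identityˡ _) (sym (dot-difference (free c) e)))

    module Fibre (y z′ z : Vect (suc d)) (e : y zero ≈ z zero) (e′ : z′ zero ≈ z zero)
        (f : z ∘ suc ≋ (y ⊕ z′) ∘ suc) where
      left = map-holds {x = y ∘ suc} {z} {y} (λ c → constraint (free c ∘ suc) (free c zero ∷ᶠ λ _ → 0#) (strict c))
          λ c → cmp-≈ (strict c)
        (trans (+-identityˡ _) (trans (+-comm _ _)
          (+-congˡ (trans (*-congˡ e) (sym (trans (+-congˡ (dot-zeroˡ (z ∘ suc))) (+-identityʳ _)))))))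
      right = map-holds {x = y ∘ suc} {z} {z′} (λ c → constraint (-_ ∘ free c ∘ suc) (free c) (strict c)) λ c
          → cmp-≈ (strict c)
        (trans (+-identityˡ _) (sym (trans (solve 3 (λ n h r → n :+ (h :+ r) := h :+ (n :+ r)) refl _ _ _)
          (+-cong (*-congˡ (sym e′)) (dot-difference (free c ∘ suc) f)))))

  opaque
    unfolding sumRegion

    sumRegion⁺ : ∀ S T y z′ z → In S y → In T z′ → z ≋ y ⊕ z′ → In (sumRegion S T) z
    sumRegion⁺ S T y z′ z p q e = projectAll⁺ (suc d) (sumSystem S T) y z
        (All.++⁺ (proj₁ (left S) p) (proj₁ (right T) q))
      where open Sum y z′ z e

    sumRegion⁻ : ∀ S T z → In (sumRegion S T) z → ∃[ y ] ∃[ z′ ] (In S y × In T z′ × z ≋ y ⊕ z′)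
    sumRegion⁻ S T z p with projectAll⁻ (suc d) (sumSystem S T) z p
    ... | y , sat = y , _ , proj₂ (left S) (proj₁ (All.++⁻ (map _ S) sat)) , proj₂ (right T)
        (proj₂ (All.++⁻ (map _ S) sat)) , difference y z
      where open Sum y _ z (difference y z)

  opaque
    unfolding fibreSum

    fibreSum⁺ : ∀ S T y z′ z → In S y → In T z′ → y zero ≈ z zero → z′ zero ≈ z zero → z ∘ suc ≋ (y ⊕ z′) ∘ suc → In
        (fibreSum S T) z
    fibreSum⁺ S T y z′ z p q e e′ f = projectAll⁺ d (fibreSystem S T) (y ∘ suc) z
        (All.++⁺ (proj₁ (left S) p) (proj₁ (right T) q))
      where open Fibre y z′ z e e′ f

    fibreSum⁻ : ∀ S T z → In (fibreSum S T) z →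
                ∃[ u ] ∃[ v ] (In S (z zero ∷ᶠ u) × In T (z zero ∷ᶠ v) × z ∘ suc ≋ u ⊕ v)
    fibreSum⁻ S T z p with projectAll⁻ d (fibreSystem S T) z p
    ... | u , sat = u , _ , proj₂ (left S) (proj₁ (All.++⁻ (map _ S) sat)) , proj₂ (right T)
        (proj₂ (All.++⁻ (map _ S) sat)) , difference u (z ∘ suc)
      where open Fibre (z zero ∷ᶠ u) (z zero ∷ᶠ _) z refl refl (difference u (z ∘ suc))

  dot-unit : ∀ {k} (i : Fin k) (z : Vect k) → dot (unit i) z ≈ z i
  dot-unit {suc k} zero    z = trans (+-cong (*-identityˡ _) (dot-zeroˡ (z ∘ suc))) (+-identityʳ _)
  dot-unit {suc k} (suc i) z = trans (+-cong (zeroˡ _) (dot-unit i (z ∘ suc))) (+-identityˡ _)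

  private
    pin⁺ : ∀ {k} {f : Fin k → Vect (suc d)} z → (∀ j → dot (f j) z ≈ 0#) → In (tabulate λ j → linear false (f j)) z
    pin⁺ z p = All.tabulate⁺ λ j → ≤-reflexive (sym (trans (+-identityˡ _) (p j)))

    pin⁻ : ∀ {k} {f g : Fin k → Vect (suc d)} z w → (∀ j → dot (f j) z ≈ w j) → (∀ j → dot (g j) z ≈ - w j) →
           In ((tabulate λ j → linear false (f j)) ++ (tabulate λ j → linear false (g j))) z → w ≋ 0v
    pin⁻ {f = f} z w p q sat j = ≤-antisym
      (0≤y-x⇒x≤y (≤-respʳ (trans (+-identityˡ _) (trans (q j) (sym (+-identityˡ _))))
        (All.tabulate⁻ (proj₂ (All.++⁻ (tabulate (λ j → linear false (f j))) sat)) j)))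
      (≤-respʳ (trans (+-identityˡ _) (p j))
        (All.tabulate⁻ (proj₁ (All.++⁻ (tabulate (λ j → linear false (f j))) sat)) j))

  fibreZero⁺ : ∀ (z : Vect (suc d)) → z ∘ suc ≋ 0v → In fibreZero z
  fibreZero⁺ z p = All.++⁺ (pin⁺ z λ j → trans (dot-unit (suc j) z) (p j))
    (pin⁺ z λ j → trans (dot-neg (unit (suc j)) z)
      (trans (-‿cong (trans (dot-unit (suc j) z) (p j))) (solve 0 (:- :0 := :0) refl)))

  fibreZero⁻ : ∀ (z : Vect (suc d)) → In fibreZero z → z ∘ suc ≋ 0v
  fibreZero⁻ z = pin⁻ z (z ∘ suc) (λ j → dot-unit (suc j) z)
      (λ j → trans (dot-neg (unit (suc j)) z) (-‿cong (dot-unit (suc j) z)))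

  origin⁺ : ∀ (z : Vect (suc d)) → z ≋ 0v → In origin z
  origin⁺ z p = ≤-reflexive (sym (trans (+-identityˡ _) (trans (dot-unit zero z) (p zero))))
    ∷ ≤-reflexive (sym (trans (+-identityˡ _) (trans (dot-neg (unit zero) z)
        (trans (-‿cong (trans (dot-unit zero z) (p zero))) (solve 0 (:- :0 := :0) refl)))))
    ∷ fibreZero⁺ z (p ∘ suc)

  origin⁻ : ∀ (z : Vect (suc d)) → In origin z → z ≋ 0v
  origin⁻ z (p ∷ q ∷ sat) zero    = ≤-antisym
    (0≤y-x⇒x≤y (≤-respʳ (trans (+-identityˡ _)
      (trans (dot-neg (unit zero) z) (trans (-‿cong (dot-unit zero z)) (sym (+-identityˡ _))))) q))
    (≤-respʳ (trans (+-identityˡ _) (dot-unit zero z)) p)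
  origin⁻ z (p ∷ q ∷ sat) (suc j) = fibreZero⁻ z sat j

  weight⁺ : ∀ s (z : Vect (suc d)) → Cmp s 0# (z zero) → Holds (λ ()) z (linear s (unit zero))
  weight⁺ s z = cmp-respʳ s (sym (trans (+-identityˡ _) (dot-unit zero z)))

  weight⁻ : ∀ s (z : Vect (suc d)) → Holds (λ ()) z (linear s (unit zero)) → Cmp s 0# (z zero)
  weight⁻ s z = cmp-respʳ s (trans (+-identityˡ _) (dot-unit zero z))

  ray⁺ : ∀ w (z : Vect (suc d)) → 0# ≤ z zero → z ∘ suc ≋ z zero ⊙ w → In (ray w) z
  ray⁺ w z p e = weight⁺ false z p ∷ All.++⁺
    (pin⁺ z λ j → trans (+-congˡ (trans (dot-unit j (z ∘ suc)) (e j)))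
      (solve 2 (λ w t → (:- w) :* t :+ t :* w := :0) refl (w j) (z zero)))
    (pin⁺ z λ j → trans (+-congˡ (trans (dot-neg (unit j) (z ∘ suc)) (-‿cong (trans (dot-unit j (z ∘ suc)) (e j)))))
      (solve 2 (λ w t → w :* t :+ :- (t :* w) := :0) refl (w j) (z zero)))

  ray⁻ : ∀ w (z : Vect (suc d)) → In (ray w) z → 0# ≤ z zero × z ∘ suc ≋ z zero ⊙ w
  ray⁻ w z (p ∷ sat) = weight⁻ false z p , λ j → trans
      (solve 3 (λ w t u → u := (:- w) :* t :+ u :+ t :* w) refl (w j) (z zero) (z (suc j)))
    (trans (+-congʳ (pin⁻ z (λ j → - w j * z zero + z (suc j)) (λ j → +-congˡ (dot-unit j (z ∘ suc)))
        (λ j → trans (+-congˡ (trans (dot-neg (unit j) (z ∘ suc)) (-‿cong (dot-unit j (z ∘ suc)))))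
          (solve 3 (λ w t u → w :* t :+ :- u := :- ((:- w) :* t :+ u)) refl (w j) (z zero) (z (suc j)))) sat j))
      (+-identityˡ _))

  scaleWeight-spec : ∀ a S (z : Vect (suc d)) →
    (In S (a * z zero ∷ᶠ (z ∘ suc)) → In (scaleWeight a S) z) ×
      (In (scaleWeight a S) z → In S (a * z zero ∷ᶠ (z ∘ suc)))
  scaleWeight-spec a S z = map-holds {x = λ ()} {z} {a * z zero ∷ᶠ (z ∘ suc)}
      (λ c → linear (strict c) (free c zero * a ∷ᶠ (free c ∘ suc)))
    (λ c → cmp-≈ (strict c) (+-congˡ (+-congʳ (sym (*-assoc _ _ _))))) S

  -- Regions and cones are compared at positive weights only, where both mean the same; the
  -- recursion multiplies weights by positive coefficients and so never leaves this range.
  actRegion⁻ : ∀ {N} {K : Fin N → Coned} → Cones K → (S : Fin N → Region {d}) →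
               (∀ i z → 0# < z zero → In (S i) z → K i (z zero) (z ∘ suc)) →
               ∀ c → (∀ i → 0# ≤ c i) → ∀ z → 0# < z zero → In (actRegion c S) z → act (z zero ⊙ c) K (z ∘ suc)
  actRegion⁻ {zero}  cK S f c 0≤c z 0<t p = fibreZero⁻ z p
  actRegion⁻ {suc N} cK S f c 0≤c z 0<t p with c zero ≤? 0#
  ... | yes c≤0 = 0v , _ , zero-∈′ (cK zero) (trans (*-congˡ (≤-antisym c≤0 (0≤c zero))) (zeroʳ _)) ≋-refl
    , actRegion⁻ (cK ∘ suc) (S ∘ suc) (f ∘ suc) (c ∘ suc) (0≤c ∘ suc) z 0<t p , 0⊕ ≋-refl
  ... | no c≰0 with fibreSum⁻ (scaleWeight (c zero) (S zero)) _ z p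
  ... | u , v , q , r , e = u , v
    , resp (cK zero) (*-comm _ _) ≋-refl (f zero (c zero * z zero ∷ᶠ u) (0<-* (≰⇒> c≰0) 0<t)
      (proj₂ (scaleWeight-spec (c zero) (S zero) (z zero ∷ᶠ u)) q))
    , actRegion⁻ (cK ∘ suc) (S ∘ suc) (f ∘ suc) (c ∘ suc) (0≤c ∘ suc) (z zero ∷ᶠ v) 0<t r , e

  actRegion⁺ : ∀ {N} {K : Fin N → Coned} → Cones K → (S : Fin N → Region {d}) →
               (∀ i z → 0# < z zero → K i (z zero) (z ∘ suc) → In (S i) z) →
               ∀ c → (∀ i → 0# ≤ c i) → ∀ z → 0# < z zero → act (z zero ⊙ c) K (z ∘ suc) → In (actRegion c S) z
  actRegion⁺ {zero}  cK S f c 0≤c z 0<t p = fibreZero⁺ z p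
  actRegion⁺ {suc N} cK S f c 0≤c z 0<t (y , v , k , a , e) with c zero ≤? 0#
  ... | yes c≤0 = in-resp {z = z zero ∷ᶠ v} {z}
    (∷-≋ refl (≋-sym (≋-trans e (⊕-identityˡ
      (vanish (cK zero) (trans (*-congˡ (≤-antisym c≤0 (0≤c zero))) (zeroʳ _)) k)))))
    (actRegion⁺ (cK ∘ suc) (S ∘ suc) (f ∘ suc) (c ∘ suc) (0≤c ∘ suc) (z zero ∷ᶠ v) 0<t a)
  ... | no c≰0 = fibreSum⁺ (scaleWeight (c zero) (S zero)) (actRegion (c ∘ suc) (S ∘ suc)) (z zero ∷ᶠ y) (z zero ∷ᶠ v) z
    (proj₁ (scaleWeight-spec (c zero) (S zero) (z zero ∷ᶠ y))
      (f zero (c zero * z zero ∷ᶠ y) (0<-* (≰⇒> c≰0) 0<t) (resp (cK zero) (*-comm _ _) ≋-refl k)))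
    (actRegion⁺ (cK ∘ suc) (S ∘ suc) (f ∘ suc) (c ∘ suc) (0≤c ∘ suc) (z zero ∷ᶠ v) 0<t a) refl refl e

  module _ {N} {K : Fin N → Coned} (cK : Cones K) (S : Fin N → Region {d})
           (S⇒K : ∀ i z → 0# < z zero → In (S i) z → K i (z zero) (z ∘ suc))
           (K⇒S : ∀ i z → 0# < z zero → K i (z zero) (z ∘ suc) → In (S i) z) where
    evalRegion⁻ : ∀ {M} → All (λ c → ∀ i → 0# ≤ c i) M → ∀ z → In (evalRegion M S) z → Eval K M (z zero) (z ∘ suc)
    evalRegion⁻ []           z p = nil (origin⁻ z p zero) (origin⁻ z p ∘ suc)
    evalRegion⁻ {c ∷ M} (0≤c ∷ 0≤cs) z p with sumRegion⁻ (linear true (unit zero) ∷ actRegion c S) (evalRegion M S) z p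
    ... | y , z′ , (q ∷ r) , r′ , e = cons (weight⁻ true y q) (actRegion⁻ cK S S⇒K _ 0≤c y (weight⁻ true y q) r)
      (evalRegion⁻ 0≤cs z′ r′) (e zero) (e ∘ suc)

    evalRegion⁺ : ∀ {M} → All (λ c → ∀ i → 0# ≤ c i) M → ∀ z → Eval K M (z zero) (z ∘ suc) → In (evalRegion M S) z
    evalRegion⁺ [] z (nil e f) = origin⁺ z (∷-≋ e f)
    evalRegion⁺ {c ∷ M} (0≤c ∷ 0≤cs) z (cons {s = s} {u} {t′} {v′} 0<s a ev e f) = sumRegion⁺
        (linear true (unit zero) ∷ actRegion c S) (evalRegion M S) (s ∷ᶠ u) (t′ ∷ᶠ v′) z
      (weight⁺ true (s ∷ᶠ u) 0<s ∷ actRegion⁺ cK S K⇒S _ 0≤c (s ∷ᶠ u) 0<s a) (evalRegion⁺ 0≤cs (t′ ∷ᶠ v′) ev) (∷-≋ e f)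

-- Descriptions by quantifier-free formulas.

module Descriptions {A : Set} (arith : Arithmetic A) where
  open import Data.Fin.Base using (zero; suc)
  open import Data.Nat.Base using (zero; suc)
  open Arithmetic arith renaming (zero to #0; one to #1)
  open Elimination arith
  open FourierMotzkin arith

  comparison : Bool → Comparison
  comparison true  = lt
  comparison false = le

  module _ {d : ℕ} where

    -- b t - a · x and its negation
    below above : (Fin d → A) → A → Fin (suc d) → A
    below a b = b ∷ᶠ (neg ∘ a)
    above a b = neg b ∷ᶠ a

    -- The disjunctive normal form of F, respectively of its negation.
    dnf : Bool → Formula A d → List (Region {d})
    dnf true  (atom eq a b) = (linear false (below a b) ∷ linear false (above a b) ∷ []) ∷ []
    dnf false (atom eq a b) = (linear true (below a b) ∷ []) ∷ (linear true (above a b) ∷ []) ∷ []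
    dnf true  (atom le a b) = (linear false (below a b) ∷ []) ∷ []
    dnf false (atom le a b) = (linear true (above a b) ∷ []) ∷ []
    dnf true  (atom lt a b) = (linear true (below a b) ∷ []) ∷ []
    dnf false (atom lt a b) = (linear false (above a b) ∷ []) ∷ []
    dnf true  tt            = [] ∷ []
    dnf false tt            = []
    dnf true  ff            = []
    dnf false ff            = [] ∷ []
    dnf true  (F and G)     = cartesianProductWith _++_ (dnf true F) (dnf true G)
    dnf false (F and G)     = dnf false F ++ dnf false G
    dnf true  (F or G)      = dnf true F ++ dnf true G
    dnf false (F or G)      = cartesianProductWith _++_ (dnf false F) (dnf false G)
    dnf true  (not F)       = dnf false F
    dnf false (not F)       = dnf true F

    -- All cells of all parameters become symbols of one alphabet; the tag tells `generators` which
    -- of them make up a given parameter.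
    cells : ∀ {p} → (Fin p → Formula A d) → List (Fin p × Region {d})
    cells {p} description = concatMap (λ q → map (q ,_) (dnf true (description q))) (allFin p)

    generators : ∀ {p} (cs : List (Fin p × Region {d})) → Fin p → Poly (length cs)
    generators cs q = map (λ k → unit k ∷ []) (filter (λ k → proj₁ (lookup cs k) ≟ᶠ q) (allFin (length cs)))

    -- The slice at weight 1, with the linear part moved to the left of the comparison and its sign
    -- changed accordingly.
    regionFormula : Region {d} → Formula A d
    regionFormula = foldr (λ c F → atom (comparison (strict c)) (neg ∘ free c ∘ suc) (free c zero) and F) tt

    polyFormula : ∀ {N} → (Fin N → Region {d}) → Poly N → Formula A d
    polyFormula S = foldr (λ M F → regionFormula (evalRegion M S) or F) ff

    describe : ∀ {n p} → System A n p → (Fin p → Formula A d) → Fin n → Formula A d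
    describe I description i = polyFormula (proj₂ ∘ lookup cs) (solution I (generators cs) i)
      where cs = cells description

-- Correctness of the descriptions.

module DescriptionsCorrect (R : Reals) (𝕍 : FiniteDimensional R) (dec : ∀ (P : Set) → Dec P) where
  open import Data.Fin.Base using (zero; suc)
  open import Data.Nat.Base using (zero; suc)
  open OrderedField R
  open Reals R hiding (zero)
  open FiniteDimensional 𝕍 using (V; dim; coord)
  open Vectors R
  open Cones R dim
  open IsCone
  open Elimination (arithmetic R)
  open LeastSolution R dec dim using (Good; ⟦_⟧ᴾ)
  open FourierMotzkin (arithmetic R)
  open FourierMotzkinCorrect R
  open Regions R dim
  open Descriptions (arithmetic R)
  open Reduction R 𝕍 dec
  open Semantics R 𝕍 hiding (eval-mono)

  at : V → Vect (suc dim)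
  at v = 1# ∷ᶠ coord v

  module _ (v : V) (a : Vect dim) (b : ℝ) where

    private
      a·v = dot a (coord v)

    below-value : 0# + dot (below a b) (at v) ≈ b - a·v
    below-value = trans (+-identityˡ _) (+-cong (*-identityʳ b) (dot-neg a (coord v)))

    above-value : 0# + dot (above a b) (at v) ≈ a·v - b
    above-value = trans (+-identityˡ _) (trans (+-congʳ (*-identityʳ _)) (+-comm _ _))

    below⁺ : ∀ s → Cmp s a·v b → Holds (λ ()) (at v) (linear s (below a b))
    below⁺ s p = cmp-respʳ s (sym below-value) (cmp⇒0- s p)

    below⁻ : ∀ s → Holds (λ ()) (at v) (linear s (below a b)) → Cmp s a·v b
    below⁻ s p = 0-⇒cmp s (cmp-respʳ s below-value p)

    above⁺ : ∀ s → Cmp s b a·v → Holds (λ ()) (at v) (linear s (above a b))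
    above⁺ s p = cmp-respʳ s (sym above-value) (cmp⇒0- s p)

    above⁻ : ∀ s → Holds (λ ()) (at v) (linear s (above a b)) → Cmp s b a·v
    above⁻ s p = 0-⇒cmp s (cmp-respʳ s above-value p)

  Truth : Bool → Set → Set
  Truth true  P = P
  Truth false P = ¬ P

  SomeIn : List (Region {dim}) → V → Set
  SomeIn Ss v = Any (λ S → In S (at v)) Ss

  module _ (v : V) where

    dnf⁺ : ∀ s F → Truth s (⟦ F ⟧ v) → SomeIn (dnf s F) v
    dnf⁺ true (atom eq a b) p = here
        (below⁺ v a b false (≤-reflexive p) ∷ above⁺ v a b false (≤-reflexive (sym p)) ∷ [])
    dnf⁺ false (atom eq a b) p with ≤-total (dot a (coord v)) b
    ... | inj₁ q = here (below⁺ v a b true (≤∧≉⇒< q p) ∷ [])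
    ... | inj₂ q = there (here (above⁺ v a b true (≤∧≉⇒< q (p ∘ sym)) ∷ []))
    dnf⁺ true  (atom le a b) p = here (below⁺ v a b false p ∷ [])
    dnf⁺ false (atom le a b) p = here (above⁺ v a b true (≰⇒> p) ∷ [])
    dnf⁺ true  (atom lt a b) p = here (below⁺ v a b true p ∷ [])
    dnf⁺ false (atom lt a b) p with b ≤? dot a (coord v)
    ... | yes q = here (above⁺ v a b false q ∷ [])
    ... | no q  = ⊥-elim (p (≰⇒> q))
    dnf⁺ true  tt p = here []
    dnf⁺ false tt p = ⊥-elim (p tt)
    dnf⁺ false ff p = here []
    dnf⁺ true  (F and G) (p , q) = Any.cartesianProductWith⁺ _++_ All.++⁺ (dnf⁺ true F p) (dnf⁺ true G q)
    dnf⁺ false (F and G) p with dec (⟦ F ⟧ v)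
    ... | yes f = Any.++⁺ʳ (dnf false F) (dnf⁺ false G λ g → p (f , g))
    ... | no ¬f = Any.++⁺ˡ (dnf⁺ false F ¬f)
    dnf⁺ true  (F or G) (inj₁ p) = Any.++⁺ˡ (dnf⁺ true F p)
    dnf⁺ true  (F or G) (inj₂ q) = Any.++⁺ʳ (dnf true F) (dnf⁺ true G q)
    dnf⁺ false (F or G) p = Any.cartesianProductWith⁺ _++_ All.++⁺ (dnf⁺ false F (p ∘ inj₁)) (dnf⁺ false G (p ∘ inj₂))
    dnf⁺ true  (not F) p = dnf⁺ false F p
    dnf⁺ false (not F) p with dec (⟦ F ⟧ v)
    ... | yes f = dnf⁺ true F f
    ... | no ¬f = ⊥-elim (p ¬f)

    dnf⁻ : ∀ s F → SomeIn (dnf s F) v → Truth s (⟦ F ⟧ v)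
    dnf⁻ true  (atom eq a b) (here (p ∷ q ∷ [])) = ≤-antisym (below⁻ v a b false p) (above⁻ v a b false q)
    dnf⁻ false (atom eq a b) (here (p ∷ [])) e = proj₂ (below⁻ v a b true p) e
    dnf⁻ false (atom eq a b) (there (here (p ∷ []))) e = proj₂ (above⁻ v a b true p) (sym e)
    dnf⁻ true  (atom le a b) (here (p ∷ [])) = below⁻ v a b false p
    dnf⁻ false (atom le a b) (here (p ∷ [])) q = <⇒≱ (above⁻ v a b true p) q
    dnf⁻ true  (atom lt a b) (here (p ∷ [])) = below⁻ v a b true p
    dnf⁻ false (atom lt a b) (here (p ∷ [])) q = <⇒≱ q (above⁻ v a b false p)
    dnf⁻ true  tt _ = tt
    dnf⁻ false ff _ = id
    dnf⁻ true  (F and G) p with Any.cartesianProductWith⁻ _++_ (λ {S} → All.++⁻ S) (dnf true F) (dnf true G) p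
    ... | f , g = dnf⁻ true F f , dnf⁻ true G g
    dnf⁻ false (F and G) p (f , g) with Any.++⁻ (dnf false F) p
    ... | inj₁ q = dnf⁻ false F q f
    ... | inj₂ q = dnf⁻ false G q g
    dnf⁻ true  (F or G) p with Any.++⁻ (dnf true F) p
    ... | inj₁ q = inj₁ (dnf⁻ true F q)
    ... | inj₂ q = inj₂ (dnf⁻ true G q)
    dnf⁻ false (F or G) p h with Any.cartesianProductWith⁻ _++_ (λ {S} → All.++⁻ S) (dnf false F) (dnf false G) p
    dnf⁻ false (F or G) p (inj₁ h) | f , g = dnf⁻ false F f h
    dnf⁻ false (F or G) p (inj₂ h) | f , g = dnf⁻ false G g h
    dnf⁻ true  (not F) p = dnf⁻ false F p
    dnf⁻ false (not F) p h = h (dnf⁻ true F p)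

    private
      constraint-value : ∀ (a : Vect (suc dim)) → 0# + dot a (at v) ≈ a zero - dot (-_ ∘ a ∘ suc) (coord v)
      constraint-value a = trans (+-identityˡ _) (+-cong (*-identityʳ (a zero)) (trans
        (solve 1 (λ x → x := :- :- x) refl (dot (a ∘ suc) (coord v))) (-‿cong (sym (dot-neg (a ∘ suc) (coord v))))))

      comparison⁺ : ∀ s {x y} → Cmp s x y → compare (comparison s) x y
      comparison⁺ true  p = p
      comparison⁺ false p = p

      comparison⁻ : ∀ s {x y} → compare (comparison s) x y → Cmp s x y
      comparison⁻ true  p = p
      comparison⁻ false p = p

    regionFormula⁺ : ∀ S → In S (at v) → ⟦ regionFormula S ⟧ v
    regionFormula⁺ []      _        = tt
    regionFormula⁺ (c ∷ S) (p ∷ ps) =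
      comparison⁺ (strict c) (0-⇒cmp (strict c) (cmp-respʳ (strict c) (constraint-value (free c)) p))
          , regionFormula⁺ S ps

    regionFormula⁻ : ∀ S → ⟦ regionFormula S ⟧ v → In S (at v)
    regionFormula⁻ []      _        = []
    regionFormula⁻ (c ∷ S) (p , ps) =
      cmp-respʳ (strict c) (sym (constraint-value (free c)))
          (cmp⇒0- (strict c) (comparison⁻ (strict c) p)) ∷ regionFormula⁻ S ps

  -- `IsCone` requires the apex alone at weight 0, whatever the region contains there.
  cellCone : Region {dim} → Coned
  cellCone S = pointed λ t w → 0# < t × In S (t ∷ᶠ w)

  module _ {S : Region {dim}} where

    private
      cmp-self : ∀ s {x y} → Cmp s 0# x → Cmp s 0# y → Cmp s 0# (x + y)
      cmp-self true  p q = cmp-+ true true p q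
      cmp-self false p q = cmp-+ false false p q

      in-add : ∀ y z → In S y → In S z → In S (y ⊕ z)
      in-add y z p q = All.zipWith (λ {c} (h , h′) → cmp-respʳ (strict c)
        (sym (trans (+-congˡ (dot-⊕ʳ (free c) y z))
          (solve 2 (λ x y → :0 :+ (x :+ y) := :0 :+ x :+ (:0 :+ y)) refl _ _)))
        (cmp-self (strict c) h h′)) (p , q)

      in-scale : ∀ s z → 0# < s → In S z → In S (s ⊙ z)
      in-scale s z 0<s = All.map λ {c} h → cmp-respʳ (strict c)
        (trans (solve 2 (λ s x → s :* (:0 :+ x) := :0 :+ s :* x) refl s _) (+-congˡ (sym (dot-⊙ʳ s (free c) z))))
        (cmp-* (strict c) 0<s h)

      in-∷-resp : ∀ z z′ → z zero ≈ z′ zero → z ∘ suc ≋ z′ ∘ suc → In S z → In S z′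
      in-∷-resp z z′ p q = in-resp {z = z} {z′} (∷-≋ p q)

    cellCone-isCone : IsCone (cellCone S)
    cellCone-isCone = pointed-isCone
      (λ {t} {t′} {u} {u′} p q (0<t , i) → <-respʳ p 0<t , in-∷-resp (t ∷ᶠ u) (t′ ∷ᶠ u′) p q i)
      (λ {t} {t′} {u} {u′} (0<t , i) (0<t′ , i′) → 0<-+ˡ 0<t (<⇒≤ 0<t′)
        , in-∷-resp ((t ∷ᶠ u) ⊕ (t′ ∷ᶠ u′)) ((t + t′) ∷ᶠ (u ⊕ u′)) refl ≋-refl (in-add (t ∷ᶠ u) (t′ ∷ᶠ u′) i i′))
      (λ {s} {t} {u} 0<s (0<t , i) → 0<-* 0<s 0<t
        , in-∷-resp (s ⊙ (t ∷ᶠ u)) ((s * t) ∷ᶠ (s ⊙ u)) refl ≋-refl (in-scale s (t ∷ᶠ u) 0<s i))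
      (λ (0<t , _) → inj₁ 0<t)

    cellCone⁺ : ∀ z → 0# < z zero → In S z → cellCone S (z zero) (z ∘ suc)
    cellCone⁺ z 0<t i = inj₂ (0<t , in-∷-resp z (z zero ∷ᶠ (z ∘ suc)) refl ≋-refl i)

    cellCone⁻ : ∀ z → 0# < z zero → cellCone S (z zero) (z ∘ suc) → In S z
    cellCone⁻ z 0<t (inj₁ (e , _)) = ⊥-elim (0<⇒≉0 0<t e)
    cellCone⁻ z 0<t (inj₂ (_ , i)) = in-∷-resp (z zero ∷ᶠ (z ∘ suc)) z refl ≋-refl i

  module _ {p} (cs : List (Fin p × Region {dim})) where

    cellCones : Fin (length cs) → Coned
    cellCones k = cellCone (proj₂ (lookup cs k))

    cellCones-areCones : Cones cellCones
    cellCones-areCones k = cellCone-isCone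

    generators-good : ∀ q → All Good (generators cs q)
    generators-good q = All.map⁺ (All.tabulate λ {k} _ → tt , unit-convex k ∷ [])

    generators⁺ : ∀ {q S} → (q , S) ∈ cs → ∀ {v} → In S (at v) → ⟦ generators cs q ⟧ᴾ cellCones 1# (coord v)
    generators⁺ {q} {S} qS∈ {v} i = unit k ∷ [] , ∈-map⁺ _
        (∈-filter⁺ (λ k → proj₁ (lookup cs k) ≟ᶠ q) (∈-allFin k) (proj₁ found))
      , eval-unit⁺ cellCones-areCones k 0<1 (inj₂ (0<1 , proj₂ found))
      where
      k = index qS∈
      transfer : ∀ {e} → (q , S) ≡ e → proj₁ e ≡ q × In (proj₂ e) (at v)
      transfer ≡-refl = ≡-refl , i
      found = transfer (Any.lookup-index qS∈)

    generators⁻ : ∀ {q v} → ⟦ generators cs q ⟧ᴾ cellCones 1# (coord v) → ∃[ S ] ((q , S) ∈ cs × In S (at v))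
    generators⁻ {q} {v} (M , M∈ , ev) with ∈-map⁻ _ M∈
    ... | k , k∈ , ≡-refl with ∈-filter⁻ (λ k → proj₁ (lookup cs k) ≟ᶠ q) {xs = allFin (length cs)} k∈
    ... | _ , ≡-refl = proj₂ (lookup cs k) , ∈-lookup k
      , cellCone⁻ (at v) 0<1 (eval-unit⁻ cellCones-areCones k ev)

    polyFormula⁺ : ∀ {φ : Poly (length cs)} {v} → All Good φ → ⟦ φ ⟧ᴾ cellCones 1# (coord v) → ⟦ polyFormula
        (proj₂ ∘ lookup cs) φ ⟧ v
    polyFormula⁺ {M ∷ φ} {v} ((_ , cvs) ∷ g) (_ , here ≡-refl , ev) = inj₁ (regionFormula⁺ v _
      (evalRegion⁺ cellCones-areCones (proj₂ ∘ lookup cs) (λ k → cellCone⁺) (λ k → cellCone⁻) (All.map proj₁ cvs)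
        (at v) ev))
    polyFormula⁺ (_ ∷ g) (M , there M∈ , ev) = inj₂ (polyFormula⁺ g (M , M∈ , ev))

    polyFormula⁻ : ∀ {φ : Poly (length cs)} {v} → All Good φ → ⟦ polyFormula (proj₂ ∘ lookup cs) φ ⟧ v
        → ⟦ φ ⟧ᴾ cellCones 1# (coord v)
    polyFormula⁻ {M ∷ φ} {v} ((_ , cvs) ∷ g) (inj₁ p) = M , here ≡-refl
      , evalRegion⁻ cellCones-areCones (proj₂ ∘ lookup cs) (λ k → cellCone⁺) (λ k → cellCone⁻) (All.map proj₁ cvs)
        (at v) (regionFormula⁻ v _ p)
    polyFormula⁻ (_ ∷ g) (inj₂ p) with polyFormula⁻ g p
    ... | M , M∈ , ev = M , there M∈ , ev

  cells⁺ : ∀ {p} (description : Fin p → Formula ℝ dim) {q v} → ⟦ description q ⟧ v → ∃[ S ]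
      ((q , S) ∈ cells description × In S (at v))
  cells⁺ description {q} {v} h with find (dnf⁺ v true (description q) h)
  ... | S , S∈ , i = S , ∈-concatMap⁺ (λ q → map (q ,_) (dnf true (description q)))
      (lose (∈-allFin q) (∈-map⁺ (q ,_) S∈)) , i

  cells⁻ : ∀ {p} (description : Fin p → Formula ℝ dim) {q v S} → (q , S) ∈ cells description → In S (at v)
      → ⟦ description q ⟧ v
  cells⁻ {p} description {v = v} qS∈ i with find
      (∈-concatMap⁻ (λ q → map (q ,_) (dnf true (description q))) {xs = allFin p} qS∈)
  ... | q′ , _ , qS∈′ with ∈-map⁻ (q′ ,_) qS∈′
  ... | S , S∈ , ≡-refl = dnf⁻ v true (description q′) (lose S∈ i)

  -- The instance of `Solve` whose generators are the cells of all parameters; the normal form of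
  -- the descriptions shows that they make up the sets `P q`.
  describe-correct : ∀ {n p} (I : System ℝ n p) → IsSystem I → (P : Fin p → Subset) →
    (description : Fin p → Formula ℝ dim) → (∀ q → P q ≐ ⟦ description q ⟧) →
    (X : Fin n → Subset) → IsSmallestSolution I P X → ∀ i → X i ≐ ⟦ describe I description i ⟧
  describe-correct I sys P description P≐ X smallest i =
      (λ x → polyFormula⁺ cs (S.solution-good i) (S.solution-complete smallest i x))
    , (λ f → S.solution-sound smallest i (polyFormula⁻ cs (S.solution-good i) f))
    where
    cs = cells description

    P⇒generators : ∀ q {v} → P q v → ⟦ generators cs q ⟧ᴾ (cellCones cs) 1# (coord v)
    P⇒generators q p with cells⁺ description (proj₁ (P≐ q) p)
    ... | S , S∈ , i = generators⁺ cs S∈ i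

    generators⇒P : ∀ q {v} → ⟦ generators cs q ⟧ᴾ (cellCones cs) 1# (coord v) → P q v
    generators⇒P q r with generators⁻ cs r
    ... | S , S∈ , i = proj₂ (P≐ q) (cells⁻ description S∈ i)

    module S = Solve I sys P (cellCones cs) (cellCones-areCones cs) (generators cs)
        (generators-good cs) P⇒generators generators⇒P

-- Combinations of finitely many vectors.

module Combinations (R : Reals) (k : ℕ) where
  open import Data.Fin.Base using (zero; suc)
  open import Data.Nat.Base using (zero; suc)
  open OrderedField R
  open Reals R hiding (zero)
  open Vectors R

  -- The condition on the coefficients is a parameter: non-negative ones give the closed cone
  -- spanned by the vectors, positive ones its relative interior.
  data Comb (W : ℝ → Set) : List (Vect k) → Vect k → Set where
    nil  : ∀ {y} → y ≋ 0v → Comb W [] y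
    cons : ∀ {u us s y y′} → W s → Comb W us y′ → y ≋ s ⊙ u ⊕ y′ → Comb W (u ∷ us) y

  comb-resp : ∀ {W us y z} → y ≋ z → Comb W us y → Comb W us z
  comb-resp p (nil e)      = nil (≋-trans (≋-sym p) e)
  comb-resp p (cons w c e) = cons w c (≋-trans (≋-sym p) e)

  comb-map : ∀ {W W′ : ℝ → Set} {us y} → (∀ {s} → W s → W′ s) → Comb W us y → Comb W′ us y
  comb-map f (nil e)      = nil e
  comb-map f (cons w c e) = cons (f w) (comb-map f c) e

  comb-+ : ∀ {W W′ W″ : ℝ → Set} {us y z} → (∀ {s t} → W s → W′ t → W″ (s + t)) → Comb W us y → Comb W′ us z
      → Comb W″ us (y ⊕ z)
  comb-+ f (nil e) (nil e′) = nil (≋-trans (⊕-identityˡ e) e′)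
  comb-+ f (cons {u = u} {s = s} {y′ = y} w c e) (cons {s = s′} {y′ = y′} w′ c′ e′) = cons (f w w′) (comb-+ f c c′)
    λ j → trans (+-cong (e j) (e′ j)) (solve 5
        (λ s t u y z → (s :* u :+ y) :+ (t :* u :+ z) := (s :+ t) :* u :+ (y :+ z)) refl s s′ (u j) (y j) (y′ j))

  comb-* : ∀ {W W′ : ℝ → Set} {us y} t → (∀ {s} → W s → W′ (t * s)) → Comb W us y → Comb W′ us (t ⊙ y)
  comb-* t f (nil e)      = nil (⊙-zeroʳ t e)
  comb-* t f (cons {u = u} {s = s} {y′ = y} w c e) = cons (f w) (comb-* t f c)
    λ j → trans (*-congˡ (e j)) (solve 4 (λ t s u y → t :* (s :* u :+ y) := (t :* s) :* u :+ t :* y) refl t s (u j)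
        (y j))

  comb-zero : ∀ us → Comb (0# ≤_) us 0v
  comb-zero []       = nil ≋-refl
  comb-zero (u ∷ us) = cons ≤-refl (comb-zero us) λ j → solve 1 (λ u → :0 := :0 :* u :+ :0) refl (u j)

  comb-member : ∀ {us u s} → 0# ≤ s → Any (u ≋_) us → Comb (0# ≤_) us (s ⊙ u)
  comb-member {us = _ ∷ us} 0≤s (here p) = cons 0≤s (comb-zero us) λ j → trans (*-congˡ (p j)) (sym (+-identityʳ _))
  comb-member {u = u} {s} 0≤s (there p) = cons ≤-refl (comb-member 0≤s p) λ j → sym
      (trans (+-congʳ (zeroˡ _)) (+-identityˡ _))

-- Relative interiors of polytopes.

module RelativeInterior (R : Reals) (𝕍 : FiniteDimensional R) where
  open import Data.Fin.Base using (zero; suc)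
  open import Data.Nat.Base using (zero; suc)
  open OrderedField R
  open Reals R hiding (zero)
  open FiniteDimensional 𝕍 hiding (*ₗ-congˡ)
  open Vectors R
  open FourierMotzkin (arithmetic R)
  open FourierMotzkinCorrect R
  open Regions R dim
  open Coordinates R 𝕍
  open Combinations R (suc dim)
  open Semantics R 𝕍
  open Membership ≈ᴹ-setoid using () renaming (_∈_ to _∈ᴹ_)

  at : V → Vect (suc dim)
  at v = 1# ∷ᶠ coord v

  hull : List V → Subset
  hull vs = convexHull (_∈ᴹ vs)

  -- The combinations of vs, with the total weight as the coordinate 0
  Hull⁺ Hull⁰ : List V → Vect (suc dim) → Set
  Hull⁺ vs = Comb (0# <_) (map at vs)
  Hull⁰ vs = Comb (0# ≤_) (map at vs)

  private
    weightedSum : ∀ {k} → (Fin k → ℝ) → (Fin k → V) → Vect (suc dim)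
    weightedSum t x = sum t ∷ᶠ coord (sumᴹ λ i → t i *ₗ x i)

    coord-sum-∷ : ∀ {k} (t : Fin (suc k) → ℝ) (x : Fin (suc k) → V) →
                  weightedSum t x ≋ t zero ⊙ at (x zero) ⊕ weightedSum (t ∘ suc) (x ∘ suc)
    coord-sum-∷ t x = ∷-≋ (+-congʳ (sym (*-identityʳ _))) (≋-trans (coord-+ _ _) (⊕-cong (coord-* _ _) ≋-refl))

    at-sum : ∀ {k} (t : Fin k → ℝ) (x : Fin k → V) {v} → sum t ≈ 1# → v ≈ᴹ sumᴹ (λ i → t i *ₗ x i) →
             weightedSum t x ≋ at v
    at-sum t x e f = ∷-≋ e (≋-sym (coord-cong f))

  member⇒Hull⁰ : ∀ {vs x s} → 0# ≤ s → x ∈ᴹ vs → Hull⁰ vs (s ⊙ at x)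
  member⇒Hull⁰ 0≤s x∈ = comb-member 0≤s (Any.map⁺ (Any.map (λ e → ∷-≋ refl (coord-cong e)) x∈))

  hull⇒Hull⁰ : ∀ {vs v} → hull vs v → Hull⁰ vs (at v)
  hull⇒Hull⁰ {vs} (k , t , x , 0≤t , x∈ , e , f) = comb-resp (at-sum t x e f) (go k t x 0≤t x∈)
    where
    go : ∀ k (t : Fin k → ℝ) (x : Fin k → V) → (∀ i → 0# ≤ t i) → (∀ i → x i ∈ᴹ vs) →
         Hull⁰ vs (weightedSum t x)
    go zero    t x 0≤t x∈ = comb-resp (∷-≋ refl (≋-sym coord-0)) (comb-zero _)
    go (suc k) t x 0≤t x∈ = comb-resp (≋-sym (coord-sum-∷ t x))
      (comb-+ 0≤-+ (member⇒Hull⁰ (0≤t zero) (x∈ zero)) (go k (t ∘ suc) (x ∘ suc) (0≤t ∘ suc) (x∈ ∘ suc)))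

  Hull⁰⇒hull : ∀ {vs v} → Hull⁰ vs (at v) → hull vs v
  Hull⁰⇒hull {vs} {v} c with go vs c
    where
    go : ∀ vs {z} → Hull⁰ vs z → Σ[ k ∈ ℕ ] Σ[ t ∈ (Fin k → ℝ) ] Σ[ x ∈ (Fin k → V) ]
         ((∀ i → 0# ≤ t i) × (∀ i → x i ∈ᴹ vs) × z ≋ weightedSum t x)
    go [] (nil e) = 0 , (λ ()) , (λ ()) , (λ ()) , (λ ()) , ≋-trans e (∷-≋ refl (≋-sym coord-0))
    go (v ∷ vs) (cons {s = s} 0≤s c e) with go vs c
    ... | k , t , x , 0≤t , x∈ , f = suc k , (s ∷ᶠ t) , (v ∷ᶠ x)
      , (λ { zero → 0≤s ; (suc i) → 0≤t i }) , (λ { zero → here ≈ᴹ-refl ; (suc i) → there (x∈ i) })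
      , ≋-trans e (≋-trans (⊕-cong ≋-refl f) (≋-sym (coord-sum-∷ (s ∷ᶠ t) (v ∷ᶠ x))))
  ... | k , t , x , 0≤t , x∈ , f = k , t , x , 0≤t , x∈ , sym (f zero) , coord-injective (f ∘ suc)

  Hull⁺⇒hull : ∀ {vs v} → Hull⁺ vs (at v) → hull vs v
  Hull⁺⇒hull c = Hull⁰⇒hull (comb-map <⇒≤ c)

  -- One half of the Minkowski-Weyl theorem, by elimination: a sum of rays is the projection of a
  -- polyhedral cone, hence again cut out by finitely many inequalities.
  hullRegion : List V → Region {dim}
  hullRegion []       = origin
  hullRegion (v ∷ vs) = sumRegion (ray (coord v)) (hullRegion vs)

  hullRegion⁺ : ∀ vs {z} → Hull⁰ vs z → In (hullRegion vs) z
  hullRegion⁺ []       {z} (nil e)                   = origin⁺ z e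
  hullRegion⁺ (v ∷ vs) {z} (cons {s = s} {y′ = y} 0≤s c e) = sumRegion⁺ (ray (coord v)) (hullRegion vs) (s ⊙ at v) y z
    (ray⁺ (coord v) (s ⊙ at v) (≤-respʳ (sym (*-identityʳ s)) 0≤s) (⊙-cong (sym (*-identityʳ s)) ≋-refl))
      (hullRegion⁺ vs c) e

  hullRegion⁻ : ∀ vs {z} → In (hullRegion vs) z → Hull⁰ vs z
  hullRegion⁻ []       {z} p = nil (origin⁻ z p)
  hullRegion⁻ (v ∷ vs) {z} p with sumRegion⁻ (ray (coord v)) (hullRegion vs) z p
  ... | y , z′ , r , q , e with ray⁻ (coord v) y r
  ... | 0≤y , f = cons 0≤y (hullRegion⁻ vs q) (≋-trans e (⊕-cong (∷-≋ (sym (*-identityʳ _)) f) ≋-refl))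

  minimum : ∀ {x y} → 0# < x → 0# < y → ∃[ m ] (0# < m × m ≤ x × m ≤ y)
  minimum {x} {y} 0<x 0<y with ≤-total x y
  ... | inj₁ x≤y = x , 0<x , ≤-refl , x≤y
  ... | inj₂ y≤x = y , 0<y , y≤x , ≤-refl

  -- Half of `η` is reserved for coordinate 0 and half for the other coordinates.
  small-perturbation : ∀ {k} (b : Vect k) {η} → 0# < η →
    ∃[ ε ] (0# < ε × (∀ (δ : Vect k) → (∀ j → δ j < ε × - δ j < ε) → 0# < η + dot b δ))
  small-perturbation {zero}  b {η} 0<η = 1# , 0<1 , λ δ _ → <-respʳ (sym (+-identityʳ η)) 0<η
  small-perturbation {suc k} b {η} 0<η with small-perturbation (b ∘ suc) (0<-* 0<half 0<η) | head (b zero)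
    where
    η′ = half * η
    0<η′ = 0<-* 0<half 0<η
    scaled : ∀ {c} → 0# < 1# + c → (1# + c) * (η′ * (1# + c) ⁻¹) ≈ η′
    scaled 0<d = trans (*-comm _ _) (*-⁻¹-cancel η′ 0<d)
    -- The radius is η′ / (1 + |c|); the summand 1 keeps the denominator positive.
    head : ∀ c → ∃[ ε ] (0# < ε × (∀ δ → δ < ε → - δ < ε → 0# < η′ + c * δ))
    head c with ≤-total 0# c
    ... | inj₁ 0≤c = η′ * (1# + c) ⁻¹ , 0<-* 0<η′ (0<-⁻¹ 0<d) , λ δ _ -δ<ε → <-respʳ
        (trans (solve 3 (λ c e δ → e :+ c :* (e :- (:- δ)) := (:1 :+ c) :* e :+ c :* δ) refl c _ δ)
          (+-congʳ (scaled 0<d)))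
        (0<-+ˡ (0<-* 0<η′ (0<-⁻¹ 0<d)) (*-nonNeg 0≤c (<⇒≤ (x<y⇒0<y-x -δ<ε))))
      where 0<d = 0<-+ˡ 0<1 0≤c
    ... | inj₂ c≤0 = η′ * (1# + - c) ⁻¹ , 0<-* 0<η′ (0<-⁻¹ 0<d) , λ δ δ<ε _ → <-respʳ
        (trans (solve 3 (λ c e δ → e :+ (:- c) :* (e :- δ) := (:1 :+ :- c) :* e :+ c :* δ) refl c _ δ)
          (+-congʳ (scaled 0<d)))
        (0<-+ˡ (0<-* 0<η′ (0<-⁻¹ 0<d)) (*-nonNeg (0≤-x c≤0) (<⇒≤ (x<y⇒0<y-x δ<ε))))
      where 0<d = 0<-+ˡ 0<1 (0≤-x c≤0)
  ... | ε₁ , 0<ε₁ , f | ε₂ , 0<ε₂ , g with minimum 0<ε₁ 0<ε₂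
  ... | ε , 0<ε , p , q = ε , 0<ε , λ δ h → <-respʳ
      (trans (solve 4 (λ h η x y → (h :* η :+ x) :+ (h :* η :+ y) := (h :+ h) :* η :+ (x :+ y)) refl half η _ _)
        (+-congʳ (trans (*-congʳ half+half) (*-identityˡ η))))
      (0<-+ˡ (g (δ zero) (<-≤-trans (proj₁ (h zero)) q) (<-≤-trans (proj₂ (h zero)) q))
        (<⇒≤ (f (δ ∘ suc) λ j → <-≤-trans (proj₁ (h (suc j))) p , <-≤-trans (proj₂ (h (suc j))) p)))

  module _ {vs : List V} {x : V} (x∈ : Hull⁺ vs (at x)) where

    private
      Near : ℝ → Subset
      Near ε y = affineHull (hull vs) y × Ball x ε y

      module _ (a : Vect (suc dim)) (0≤a : ∀ {v} → v ∈ᴹ vs → 0# ≤ dot a (at v)) where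

        nonNegative : ∀ {us z} → All (λ u → 0# ≤ dot a u) us → Comb (0# <_) us z → 0# ≤ dot a z
        nonNegative [] (nil e) = ≤-reflexive
            (sym (trans (dot-cong {a = a} ≋-refl e) (trans (dot-comm a 0v) (dot-zeroˡ a))))
        nonNegative (p ∷ ps) (cons {u = u} {s = s} {y′ = y} 0<s c e) = ≤-respʳ
            (sym (trans (dot-cong {a = a} ≋-refl e) (trans (dot-⊕ʳ a (s ⊙ u) y) (+-congʳ (dot-⊙ʳ s a u)))))
          (0≤-+ (*-nonNeg (<⇒≤ 0<s) p) (nonNegative ps c))

        -- A sum of non-negative terms is 0 only if each term is, and the positive coefficients can
        -- be cancelled.
        vanishing : ∀ {us z} → All (λ u → 0# ≤ dot a u) us → Comb (0# <_) us z → dot a z ≈ 0# → All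
            (λ u → dot a u ≈ 0#) us
        vanishing [] (nil e) _ = []
        vanishing (p ∷ ps) (cons {u = u} {s = s} {y′ = y} 0<s c e) z≈0 = *-cancel-0
            (0<⇒≉0 0<s) su≈0 ∷ vanishing ps c y≈0
          where
          total : s * dot a u + dot a y ≈ 0#
          total = trans (sym (trans (dot-cong {a = a} ≋-refl e)
              (trans (dot-⊕ʳ a (s ⊙ u) y) (+-congʳ (dot-⊙ʳ s a u))))) z≈0
          0≤su = *-nonNeg (<⇒≤ 0<s) p
          0≤y  = nonNegative ps c
          su≈0 : s * dot a u ≈ 0#
          su≈0 = ≤-antisym (≤-respʳ total (≤-respˡ (+-identityʳ _) (+-mono-≤ ≤-refl 0≤y))) 0≤su
          y≈0 : dot a y ≈ 0#
          y≈0 = trans (sym (+-identityˡ _)) (trans (+-congʳ (sym su≈0)) total)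

        vanishing-comb : ∀ {us z} → All (λ u → dot a u ≈ 0#) us → Comb (0# ≤_) us z → dot a z ≈ 0#
        vanishing-comb [] (nil e) = trans (dot-cong {a = a} ≋-refl e) (trans (dot-comm a 0v) (dot-zeroˡ a))
        vanishing-comb (p ∷ ps) (cons {u = u} {s = s} {y′ = y} _ c e) = trans (dot-cong {a = a} ≋-refl e)
            (trans (dot-⊕ʳ a (s ⊙ u) y)
          (trans (+-cong (trans (dot-⊙ʳ s a u) (trans (*-congˡ p) (zeroʳ s))) (vanishing-comb ps c)) (+-identityˡ 0#)))

        nonNegatives : All (λ u → 0# ≤ dot a u) (map at vs)
        nonNegatives = All.map⁺ (All.tabulate λ v∈ → 0≤a (Any.map (λ { ≡-refl → ≈ᴹ-refl }) v∈))

        -- An inequality that is tight at a positive combination is tight at every vertex, hence on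
        -- the whole affine hull: there it puts no restriction on the points near `x`.
        vanishing-affine : dot a (at x) ≈ 0# → ∀ {y} → affineHull (hull vs) y → dot a (at y) ≈ 0#
        vanishing-affine x≈0 (k , t , ys , ys∈ , e , f) = trans
            (dot-cong {a = a} {y = weightedSum t ys} ≋-refl (≋-sym (at-sum t ys e f))) (go k t ys ys∈)
          where
          zeros = vanishing nonNegatives x∈ x≈0
          go : ∀ k (t : Fin k → ℝ) (ys : Fin k → V) → (∀ i → hull vs (ys i)) → dot a (weightedSum t ys) ≈ 0#
          go zero    t ys ys∈ = trans (dot-cong {a = a} {x = weightedSum t ys} {0v} ≋-refl (∷-≋ refl coord-0))
              (trans (dot-comm a 0v) (dot-zeroˡ a))
          go (suc k) t ys ys∈ = trans (dot-cong {a = a} {x = weightedSum t ys} ≋-refl (coord-sum-∷ t ys))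
              (trans (dot-⊕ʳ a (t zero ⊙ at (ys zero)) (weightedSum (t ∘ suc) (ys ∘ suc)))
            (trans (+-cong (trans (dot-⊙ʳ (t zero) a (at (ys zero)))
              (trans (*-congˡ (vanishing-comb zeros (hull⇒Hull⁰ (ys∈ zero)))) (zeroʳ _)))
              (go k (t ∘ suc) (ys ∘ suc) (ys∈ ∘ suc))) (+-identityˡ 0#)))

        -- An inequality with room to spare at `x` survives a small perturbation; a tight one has
        -- the same value throughout the affine hull.
        near-constraint : ∀ s → Cmp s 0# (dot a (at x)) → ∃[ ε ] (0# < ε × (∀ y → Near ε y → Cmp s 0# (dot a (at y))))
        near-constraint s p with 0≤⇒0≈⊎0< (cmp⇒≤ s p)
        ... | inj₁ x≈0 = 1# , 0<1 , λ y (y∈ , _) → cmp-respʳ s (trans x≈0 (sym (vanishing-affine x≈0 y∈))) p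
        ... | inj₂ 0<x with small-perturbation (a ∘ suc) 0<x
        ... | ε , 0<ε , f = ε , 0<ε , λ y (_ , ball) → <⇒cmp s (<-respʳ (shift y)
          (f (λ j → coord y j - coord x j) λ j → proj₁ (ball j) , <-respˡ
            (solve 2 (λ x y → x :- y := :- (y :- x)) refl (coord x j) (coord y j)) (proj₂ (ball j))))
          where
          shift : ∀ y → dot a (at x) + dot (a ∘ suc) (λ j → coord y j - coord x j) ≈ dot a (at y)
          shift y = trans (+-assoc _ _ _) (+-congˡ (sym (trans
            (dot-cong {a = a ∘ suc} ≋-refl λ j → solve 2 (λ x y → y := x :+ (y :- x)) refl (coord x j) (coord y j))
            (dot-⊕ʳ (a ∘ suc) (coord x) (λ j → coord y j - coord x j)))))

      near-region : ∀ S → In S (at x) → (∀ {v} → v ∈ᴹ vs → In S (at v)) → ∃[ ε ]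
          (0# < ε × (∀ y → Near ε y → In S (at y)))
      near-region []      _        _ = 1# , 0<1 , λ _ _ → []
      near-region (c ∷ S) (p ∷ ps) f
        with near-region S ps (All.tail ∘ f)
           | near-constraint (free c) (λ v∈ → ≤-respʳ (+-identityˡ _) (cmp⇒≤ (strict c) (All.head (f v∈))))
               (strict c) (cmp-respʳ (strict c) (+-identityˡ _) p)
      ... | ε₁ , 0<ε₁ , g | ε₂ , 0<ε₂ , h with minimum 0<ε₁ 0<ε₂
      ... | ε , 0<ε , q , r = ε , 0<ε , λ y near → cmp-respʳ (strict c) (sym (+-identityˡ _))
          (h y (restrict r near)) ∷ g y (restrict q near)
        where
        restrict : ∀ {ε ε′ y} → ε ≤ ε′ → Near ε y → Near ε′ y
        restrict q (y∈ , ball) = y∈ , λ j → <-≤-trans (proj₁ (ball j)) q , <-≤-trans (proj₂ (ball j)) q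

    Hull⁺⇒relint : relint (hull vs) x
    Hull⁺⇒relint with near-region (hullRegion vs) (hullRegion⁺ vs (comb-map <⇒≤ x∈))
      (λ v∈ → hullRegion⁺ vs (comb-resp (λ j → *-identityˡ _) (member⇒Hull⁰ 0≤1 v∈)))
    ... | ε , 0<ε , f = Hull⁺⇒hull x∈ , ε , 0<ε , λ y y∈ ball → Hull⁰⇒hull (hullRegion⁻ vs (f y (y∈ , ball)))

  bounded : ∀ {k} (w : Vect k) → ∃[ B ] (0# < B × (∀ j → w j < B × - w j < B))
  bounded {zero}  w = 1# , 0<1 , λ ()
  bounded {suc k} w with bounded (w ∘ suc) | single (w zero)
    where
    single : ∀ c → ∃[ B ] (0# < B × c < B × - c < B)
    single c with ≤-total 0# c
    ... | inj₁ 0≤c = 1# + c , 0<-+ˡ 0<1 0≤c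
        , 0<y-x⇒x<y (<-respʳ (solve 2 (λ o c → o := o :+ c :- c) refl 1# c) 0<1)
        , 0<y-x⇒x<y (<-respʳ (solve 2 (λ o c → o :+ (c :+ c) := o :+ c :- (:- c)) refl 1# c) (0<-+ˡ 0<1 (0≤-+ 0≤c 0≤c)))
    ... | inj₂ c≤0 = 1# + - c , 0<-+ˡ 0<1 (0≤-x c≤0)
        , 0<y-x⇒x<y (<-respʳ (solve 2 (λ o c → o :+ (:- c :+ :- c) := o :+ :- c :- c) refl 1# c)
          (0<-+ˡ 0<1 (0≤-+ (0≤-x c≤0) (0≤-x c≤0))))
        , 0<y-x⇒x<y (<-respʳ (solve 2 (λ o c → o := o :+ :- c :- :- c) refl 1# c) 0<1)
  ... | B , 0<B , f | B′ , 0<B′ , p , q = B + B′ , 0<-+ˡ 0<B (<⇒≤ 0<B′)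
    , λ { zero → <-≤-trans p B′≤ , <-≤-trans q B′≤ ; (suc j) → <-≤-trans (proj₁ (f j)) B≤ , <-≤-trans (proj₂ (f j)) B≤ }
    where
    B≤ : B ≤ B + B′
    B≤ = ≤-respˡ (+-identityʳ B) (+-mono-≤ ≤-refl (<⇒≤ 0<B′))
    B′≤ : B′ ≤ B + B′
    B′≤ = ≤-respˡ (+-identityˡ B′) (+-mono-≤ (<⇒≤ 0<B) ≤-refl)

  -- The barycentre of the vertices; the given point of the hull rules out that there are none.
  interior-point : ∀ {vs x} → Hull⁰ vs (at x) → ∃[ b ] Hull⁺ vs (at b)
  interior-point {[]}     (nil e) = ⊥-elim (0≉1 (sym (e zero)))
  interior-point {v ∷ vs} _ with total (v ∷ vs)
    where
    total : ∀ vs → ∃[ z ] (0# ≤ z zero × Hull⁺ vs z)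
    total []       = 0v , ≤-refl , nil ≋-refl
    total (v ∷ vs) with total vs
    ... | z , 0≤z , c = 1# ⊙ at v ⊕ z , 0≤-+ (*-nonNeg 0≤1 0≤1) 0≤z , cons 0<1 c ≋-refl
  ... | z , _ , c@(cons {s = s} {y′ = y} 0<s c′ e) = lin ((z zero) ⁻¹ ⊙ (z ∘ suc))
    , comb-resp (∷-≋ (⁻¹-inverseˡ (0<⇒≉0 0<z)) (≋-sym (coord-lin _))) (comb-* ((z zero) ⁻¹) (0<-* (0<-⁻¹ 0<z)) c)
    where
    weight : ∀ vs {y} → Hull⁺ vs y → 0# ≤ y zero
    weight []       (nil e)        = ≤-reflexive (sym (e zero))
    weight (v ∷ vs) (cons 0<s c e) = ≤-respʳ (sym (e zero)) (0≤-+ (*-nonNeg (<⇒≤ 0<s) 0≤1) (weight vs c))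
    0<z : 0# < z zero
    0<z = <-respʳ (sym (e zero)) (0<-+ˡ (0<-* 0<s 0<1) (weight vs c′))

  -- x lies between an interior point b and a point y slightly beyond x, as seen from b.
  relint⇒Hull⁺ : ∀ {vs x} → relint (hull vs) x → Hull⁺ vs (at x)
  relint⇒Hull⁺ {vs} {x} (x∈ , ε , 0<ε , near) with interior-point (hull⇒Hull⁰ x∈)
  ... | b , b∈ with bounded (λ j → coord x j - coord b j)
  ... | B , 0<B , bound = comb-resp
      (∷-≋ (trans (*-congˡ (solve 1 (λ δ → :1 :+ δ :* :1 := :1 :+ δ) refl δ)) (⁻¹-inverseˡ (0<⇒≉0 0<1+δ)))
        λ j → trans (*-congˡ (trans (+-congʳ (y-coord j)) (solve 3
            (λ δ x b → (:1 :+ δ) :* x :+ :- δ :* b :+ δ :* b := (:1 :+ δ) :* x) refl δ (coord x j) (coord b j))))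
          (⁻¹-cancelˡ 0<1+δ _))
      (comb-* ((1# + δ) ⁻¹) (0<-* (0<-⁻¹ 0<1+δ))
        (comb-+ 0<-+ʳ (hull⇒Hull⁰ (near y y-affine y-near)) (comb-* δ (0<-* 0<δ) b∈)))
    where
    -- The point y is x + δ(x - b). As `B` exceeds all coordinates of x - b in absolute value, this
    -- δ keeps y within ε of x.
    δ = ε * B ⁻¹
    0<δ = 0<-* 0<ε (0<-⁻¹ 0<B)
    0<1+δ = 0<-+ˡ 0<1 (<⇒≤ 0<δ)
    t : Fin 2 → ℝ
    t = (1# + δ) ∷ᶠ (- δ ∷ᶠ λ ())
    p : Fin 2 → V
    p = x ∷ᶠ (b ∷ᶠ λ ())
    y = sumᴹ (λ i → t i *ₗ p i)
    y-affine : affineHull (hull vs) y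
    y-affine = 2 , t , p , (λ { zero → x∈ ; (suc zero) → Hull⁺⇒hull b∈ })
      , solve 1 (λ δ → (:1 :+ δ) :+ (:- δ :+ :0) := :1) refl δ , ≈ᴹ-refl
    y-coord : ∀ j → coord y j ≈ (1# + δ) * coord x j + - δ * coord b j
    y-coord j = trans (coord-+ _ _ j)
        (+-cong (coord-* _ x j) (trans (coord-+ _ _ j) (trans (+-cong (coord-* _ b j) (coord-0 j)) (+-identityʳ _))))
    δB≈ε : δ * B ≈ ε
    δB≈ε = *-⁻¹-cancel ε 0<B
    scaled : ∀ {c} → c < B → δ * c < ε
    scaled {c} c<B = <-respʳ δB≈ε (0<y-x⇒x<y
        (<-respʳ (solve 3 (λ δ b c → δ :* (b :- c) := δ :* b :- δ :* c) refl δ B c) (0<-* 0<δ (x<y⇒0<y-x c<B))))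
    y-near : Ball x ε y
    y-near j = <-respˡ (trans (solve 3 (λ δ x b → δ :* (x :- b) := (:1 :+ δ) :* x :+ :- δ :* b :- x) refl δ
        (coord x j) (coord b j)) (+-congʳ (sym (y-coord j)))) (scaled (proj₁ (bound j)))
      , <-respˡ (trans (solve 3 (λ δ x b → δ :* (:- (x :- b)) := x :- ((:1 :+ δ) :* x :+ :- δ :* b)) refl δ
        (coord x j) (coord b j)) (+-congˡ (-‿cong (sym (y-coord j))))) (scaled (proj₂ (bound j)))

-- Hemihedra, their vertices, and solutions over them.

module Hemihedra (R : Reals) (𝕍 : FiniteDimensional R) (dec : ∀ (P : Set) → Dec P) where
  open import Data.Fin.Base using (zero; suc)
  open import Data.Nat.Base using (zero; suc)
  open OrderedField R
  open Reals R hiding (zero)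
  open FiniteDimensional 𝕍 using (V; dim; coord)
  open Vectors R
  open Cones R dim
  open IsCone
  open Elimination (arithmetic R)
  open LeastSolution R dec dim using (Good; Convex; ⟦_⟧ᴾ)
  open Coordinates R 𝕍
  open Combinations R (suc dim)
  open RelativeInterior R 𝕍
  open Reduction R 𝕍 dec
  open Semantics R 𝕍 hiding (eval-mono; ⟦_⟧)

  relint-≐ : ∀ {Q Q′ : Subset} → Q ≐ Q′ → relint Q ⊆ relint Q′
  relint-≐ (f , g) (x∈ , ε , 0<ε , near) = f x∈ , ε , 0<ε
    , λ y (k , t , x , x∈ , e) ball → f (near y (k , t , x , (g ∘ x∈) , e) ball)

  SomeHull : List (List V) → Subset
  SomeHull vss v = Any (λ vs → Hull⁺ vs (at v)) vss

  hemihedron-vertices : ∀ {H} → IsHemihedron H → Σ[ vss ∈ List (List V) ] H ≐ SomeHull vss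
  hemihedron-vertices {H} (_ , m , Q , polytope , H≐) = map vertices (allFin m) , to , from
    where
    vertices : Fin m → List V
    vertices b = proj₁ (polytope b)

    to : H ⊆ SomeHull (map vertices (allFin m))
    to h with proj₁ H≐ h
    ... | b , r = Any.map⁺ (lose (∈-allFin b) (relint⇒Hull⁺ (relint-≐ (proj₂ (polytope b)) r)))

    from : SomeHull (map vertices (allFin m)) ⊆ H
    from h with find (Any.map⁻ h)
    ... | b , _ , c = proj₂ H≐ (b , relint-≐ (proj₂ (proj₂ (polytope b)) , proj₁ (proj₂ (polytope b))) (Hull⁺⇒relint c))

  union-vertices : ∀ {A} → IsFiniteUnionOfHemihedra A → Σ[ vss ∈ List (List V) ] A ≐ SomeHull vss
  union-vertices {A} (m , H , hemihedron , A≐) = concatMap vertices (allFin m) , to , from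
    where
    vertices : Fin m → List (List V)
    vertices a = proj₁ (hemihedron-vertices (hemihedron a))

    to : A ⊆ SomeHull (concatMap vertices (allFin m))
    to h with proj₁ A≐ h
    ... | a , r = Any.concatMap⁺ vertices (lose (∈-allFin a) (proj₁ (proj₂ (hemihedron-vertices (hemihedron a))) r))

    from : SomeHull (concatMap vertices (allFin m)) ⊆ A
    from h with find (Any.concatMap⁻ vertices {xs = allFin m} h)
    ... | a , _ , c = proj₂ A≐ (a , proj₂ (proj₂ (hemihedron-vertices (hemihedron a))) c)

  rayCone : V → Coned
  rayCone v t w = 0# ≤ t × w ≋ t ⊙ coord v

  rayCone-isCone : ∀ v → IsCone (rayCone v)
  rayCone-isCone v .resp p q (0≤t , e) = ≤-respʳ p 0≤t , ≋-trans (≋-sym q) (≋-trans e (⊙-cong p ≋-refl))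
  rayCone-isCone v .zero-∈ = ≤-refl , λ j → sym (zeroˡ _)
  rayCone-isCone v .add (0≤t , e) (0≤t′ , e′) = 0≤-+ 0≤t 0≤t′ , ≋-trans (⊕-cong e e′) (λ j → sym (distribʳ _ _ _))
  rayCone-isCone v .scale 0<s (0≤t , e) = *-nonNeg (<⇒≤ 0<s) 0≤t , λ j → trans (*-congˡ (e j)) (sym (*-assoc _ _ _))
  rayCone-isCone v .positive (0≤t , e) with 0≤⇒0≈⊎0< 0≤t
  ... | inj₁ t≈0 = inj₂ (t≈0 , ≋-trans e λ j → trans (*-congʳ t≈0) (zeroˡ _))
  ... | inj₂ 0<t = inj₁ 0<t

  combination : ∀ {N} → Vect N → (Fin N → V) → Vect dim
  combination {zero}  c x = 0v
  combination {suc N} c x = c zero ⊙ coord (x zero) ⊕ combination (c ∘ suc) (x ∘ suc)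

  combination-⊙ : ∀ {N} s (c : Vect N) x → combination (s ⊙ c) x ≋ s ⊙ combination c x
  combination-⊙ {zero}  s c x j = sym (zeroʳ s)
  combination-⊙ {suc N} s c x j = trans (+-cong (*-assoc _ _ _) (combination-⊙ s (c ∘ suc) (x ∘ suc) j))
      (sym (distribˡ _ _ _))

  act-ray⁻ : ∀ {N} (g : Vect N) x {u} → act g (rayCone ∘ x) u → u ≋ combination g x
  act-ray⁻ {zero}  g x e = e
  act-ray⁻ {suc N} g x (y , v , (_ , e) , a , f) = ≋-trans f (⊕-cong e (act-ray⁻ (g ∘ suc) (x ∘ suc) a))

  act-ray⁺ : ∀ {N} (g : Vect N) x → (∀ ω → 0# ≤ g ω) → act g (rayCone ∘ x) (combination g x)
  act-ray⁺ {zero}  g x 0≤g = ≋-refl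
  act-ray⁺ {suc N} g x 0≤g = _ , _ , (0≤g zero , ≋-refl) , act-ray⁺ (g ∘ suc) (x ∘ suc) (0≤g ∘ suc) , ≋-refl

  module _ {N} (x : Fin N → V) where

    rays : Fin N → Coned
    rays = rayCone ∘ x

    rays-areCones : Cones rays
    rays-areCones = rayCone-isCone ∘ x

    point : Vect N → V
    point c = lin (combination c x)

    -- Over rays a symbolic point has exactly one value, so a monomial consists of the positive
    -- combinations of the values of its factors.
    eval⇒Hull⁺ : ∀ M {z} → Eval rays M (z zero) (z ∘ suc) → Hull⁺ (map point M) z
    eval⇒Hull⁺ [] (nil e f) = nil (∷-≋ e f)
    eval⇒Hull⁺ (c ∷ M) (cons {s = s} {t′ = t} {v} 0<s a ev e f) = cons 0<s (eval⇒Hull⁺ M {t ∷ᶠ v} ev)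
      λ { zero → trans e (+-congʳ (sym (*-identityʳ s)))
        ; (suc j) → trans (f j) (+-congʳ
            (trans (act-ray⁻ (s ⊙ c) x a j) (trans (combination-⊙ s c x j) (*-congˡ (sym (coord-lin _ j)))))) }

    Hull⁺⇒eval : ∀ {M z} → All Convex M → Hull⁺ (map point M) z → Eval rays M (z zero) (z ∘ suc)
    Hull⁺⇒eval [] (nil e) = nil (e zero) (e ∘ suc)
    Hull⁺⇒eval {c ∷ M} (cv ∷ cvs) (cons {s = s} 0<s h e) = cons 0<s
      (act-ray⁺ (s ⊙ c) x λ ω → *-nonNeg (<⇒≤ 0<s) (proj₁ cv ω)) (Hull⁺⇒eval cvs h)
      (trans (e zero) (+-congʳ (*-identityʳ s)))
      λ j → trans (e (suc j)) (+-congʳ (trans (*-congˡ (coord-lin _ j)) (sym (combination-⊙ s c x j))))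

  module _ (points : List V) where

    pointCones : Fin (length points) → Coned
    pointCones = rays (lookup points)

    coord-≡ : ∀ {v w} → v ≡ w → coord v ≋ coord w
    coord-≡ ≡-refl = ≋-refl

    monomial : ∀ {vs} → All (_∈ points) vs → List (Vect (length points))
    monomial []         = []
    monomial (v∈ ∷ vs∈) = unit (index v∈) ∷ monomial vs∈

    monomial-convex : ∀ {vs} (vs∈ : All (_∈ points) vs) → All Convex (monomial vs∈)
    monomial-convex []         = []
    monomial-convex (v∈ ∷ vs∈) = unit-convex (index v∈) ∷ monomial-convex vs∈

    monomial⇒Hull⁺ : ∀ {vs} (vs∈ : All (_∈ points) vs) {z} → Eval pointCones (monomial vs∈) (z zero) (z ∘ suc)
        → Hull⁺ vs z
    monomial⇒Hull⁺ [] (nil e f) = nil (∷-≋ e f)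
    monomial⇒Hull⁺ (v∈ ∷ vs∈) (cons {s = s} {t′ = t} {w} 0<s a ev e f) with act-unit⁻
        (rays-areCones (lookup points)) (index v∈) a
    ... | _ , g = cons 0<s (monomial⇒Hull⁺ vs∈ {t ∷ᶠ w} ev)
      λ { zero → trans e (+-congʳ (sym (*-identityʳ s)))
        ; (suc j) → trans (f j) (+-congʳ (trans (g j) (*-congˡ (sym (coord-≡ (Any.lookup-index v∈) j))))) }

    Hull⁺⇒monomial : ∀ {vs} (vs∈ : All (_∈ points) vs) {z} → Hull⁺ vs z → Eval pointCones (monomial vs∈) (z zero)
        (z ∘ suc)
    Hull⁺⇒monomial [] (nil e) = nil (e zero) (e ∘ suc)
    Hull⁺⇒monomial {v ∷ _} (v∈ ∷ vs∈) (cons {s = s} 0<s h e) = cons 0<s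
      (act-unit⁺ (rays-areCones (lookup points)) (index v∈) {u = s ⊙ coord v}
        (<⇒≤ 0<s , ⊙-cong refl (coord-≡ (Any.lookup-index v∈))))
      (Hull⁺⇒monomial vs∈ h) (trans (e zero) (+-congʳ (*-identityʳ s))) (e ∘ suc)

    -- An empty vertex list has an empty hull and is dropped, as good monomials have at least one
    -- factor.
    monomials : ∀ {vss} → All (All (_∈ points)) vss → Poly (length points)
    monomials []                      = []
    monomials ([] ∷ vss∈)             = monomials vss∈
    monomials (vs∈@(_ ∷ _) ∷ vss∈) = monomial vs∈ ∷ monomials vss∈

    monomials-good : ∀ {vss} (vss∈ : All (All (_∈ points)) vss) → All Good (monomials vss∈)
    monomials-good []                   = []
    monomials-good ([] ∷ vss∈)          = monomials-good vss∈
    monomials-good (vs∈@(_ ∷ _) ∷ vss∈) = (tt , monomial-convex vs∈) ∷ monomials-good vss∈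

    monomials⁺ : ∀ {vss v} (vss∈ : All (All (_∈ points)) vss) → SomeHull vss v → ⟦ monomials vss∈ ⟧ᴾ pointCones 1#
        (coord v)
    monomials⁺ ([] ∷ _)                (here (nil e)) = ⊥-elim (0≉1 (sym (e zero)))
    monomials⁺ ([] ∷ vss∈)             (there h)      = monomials⁺ vss∈ h
    monomials⁺ (vs∈@(_ ∷ _) ∷ _)       (here h)       = monomial vs∈ , here ≡-refl , Hull⁺⇒monomial vs∈ h
    monomials⁺ ((_ ∷ _) ∷ vss∈)        (there h) with monomials⁺ vss∈ h
    ... | M , M∈ , ev = M , there M∈ , ev

    monomials⁻ : ∀ {vss v} (vss∈ : All (All (_∈ points)) vss) → ⟦ monomials vss∈ ⟧ᴾ pointCones 1# (coord v)
        → SomeHull vss v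
    monomials⁻ ([] ∷ vss∈)          r                        = there (monomials⁻ vss∈ r)
    monomials⁻ {v = v} (vs∈@(_ ∷ _) ∷ _)    (_ , here ≡-refl , ev) = here (monomial⇒Hull⁺ vs∈ {at v} ev)
    monomials⁻ ((_ ∷ _) ∷ vss∈)     (M , there M∈ , ev)    = there (monomials⁻ vss∈ (M , M∈ , ev))

  -- Convexity is part of being a solution; each monomial of the solution over the vertices
  -- contributes one polytope, spanned by the values of its symbolic points.
  smallest-isHemihedron : ∀ {n p} (I : System ℝ n p) → IsSystem I → (P : Fin p → Subset)
      → (∀ q → IsFiniteUnionOfHemihedra (P q)) →
                          (X : Fin n → Subset) → IsSmallestSolution I P X → ∀ i → IsHemihedron (X i)
  smallest-isHemihedron {n} {p} I sys P hemihedral X smallest i = proj₁ (proj₁ smallest) i , length F , polytope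
      , (λ k → map (point x) (lookup F k) , id , id) , to , from
    where
    vertices : Fin p → List (List V)
    vertices q = proj₁ (union-vertices (hemihedral q))

    points : List V
    points = concatMap (concat ∘ vertices) (allFin p)

    x : Fin (length points) → V
    x = lookup points

    vertices∈ : ∀ q → All (All (_∈ points)) (vertices q)
    vertices∈ q = All.tabulate λ vs∈ → All.tabulate λ v∈ →
      ∈-concatMap⁺ (concat ∘ vertices) (lose (∈-allFin q) (∈-concat⁺′ v∈ vs∈))

    π : Fin p → Poly (length points)
    π q = monomials points (vertices∈ q)

    module S = Solve I sys P (pointCones points) (rays-areCones x) π (λ q → monomials-good points (vertices∈ q))
      (λ q v∈ → monomials⁺ points (vertices∈ q) (proj₁ (proj₂ (union-vertices (hemihedral q))) v∈))
      (λ q r → proj₂ (proj₂ (union-vertices (hemihedral q))) (monomials⁻ points (vertices∈ q) r))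

    F = solution I π i

    polytope : Fin (length F) → Subset
    polytope k = hull (map (point x) (lookup F k))

    to : ∀ {v} → X i v → ∃[ k ] relint (polytope k) v
    to {v} v∈ = monomial-relint (S.solution-complete smallest i v∈)
      where
      monomial-relint : ⟦ F ⟧ᴾ (pointCones points) 1# (coord v) → ∃[ k ] relint (polytope k) v
      monomial-relint (M , M∈ , ev) = index M∈ , ≡-subst (λ M → relint (hull (map (point x) M)) v) (Any.lookup-index M∈)
        (Hull⁺⇒relint (eval⇒Hull⁺ x M {at v} ev))

    from : ∀ {v} → ∃[ k ] relint (polytope k) v → X i v
    from (k , r) = S.solution-sound smallest i (lookup F k , ∈-lookup k
      , Hull⁺⇒eval x (proj₂ (All.lookup (S.solution-good i) (∈-lookup k))) (relint⇒Hull⁺ r))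

open import Level using (0ℓ; suc)

decide : ExcludedMiddle (suc 0ℓ) → ∀ (P : Set) → Dec P
decide em P = map′ lower lift (em {Lift (suc 0ℓ) P})

corollary1 :
  (ExcludedMiddle (suc 0ℓ) →
   (R : Reals) (𝕍 : FiniteDimensional R) →
   let open Reals R
       open Semantics R 𝕍 in
   (n p : ℕ) (I : System ℝ n p) → IsSystem I →
   (P : Fin p → Subset) → (∀ q → IsFiniteUnionOfHemihedra (P q)) →
   (X : Fin n → Subset) → IsSmallestSolution I P X →
   ∀ i → IsHemihedron (X i))
  ×
  (Σ[ algorithm ∈ Algorithm ]
   (ExcludedMiddle (suc 0ℓ) →
    (R : Reals) (𝕍 : FiniteDimensional R) →
    let open Reals R
        open FiniteDimensional 𝕍
        open Semantics R 𝕍 in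
    (n p : ℕ) (I : System ℝ n p) → IsSystem I →
    (P : Fin p → Subset) → (∀ q → IsFiniteUnionOfHemihedra (P q)) →
    (description : Fin p → Formula ℝ dim) → (∀ q → P q ≐ ⟦ description q ⟧) →
    (X : Fin n → Subset) → IsSmallestSolution I P X →
    ∃[ output ]
      (algorithm (arithmetic R) dim n p I description returns output ×
       (∀ i → X i ≐ ⟦ output i ⟧))))
corollary1 =
    (λ em R 𝕍 n p → Hemihedra.smallest-isHemihedron R 𝕍 (decide em))
  -- The construction is total, so the output is available at time bound 0.
  , (λ arith d n p I description _ → just (Descriptions.describe arith I description))
  , λ em R 𝕍 n p I sys P _ description P≐ X smallest →
      Descriptions.describe (arithmetic R) I description
    , (0 , ≡-refl , λ _ ())
    , DescriptionsCorrect.describe-correct R 𝕍 (decide em) I sys P description P≐ X smallest
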